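{- Let $G$ be a connected outerplanar graph and let $v$ be a vertex of $G$. Then the rooted graph $(G,v)$ admits an odd 4-coloring if and only if $G$ has a block which is not isomorphic to $C_5$, the cycle of length $5$.
   Context: All graphs are simple, finite and undirected. A $k$-coloring of $G$ is a map $\varphi: V(G)\to\{1,\dots,k\}$ with $\varphi(u)\neq\varphi(w)$ for every edge $uw$. A vertex $x$ satisfies the odd condition with respect to $\varphi$ if $|\varphi^{ -1}(i)\cap N_G(x)|$ is odd for some color $i\in\{1,\dots,k\}$, and satisfies the even condition with respect to $\varphi$ if $|\varphi^{ -1}(i)\cap N_G(x)|$ is even (possibly zero) for some color $i\in\{1,\dots,k\}\setminus\{\varphi(x)\}$. An odd $k$-coloring of $G$ is a $k$-coloring in which every non-isolated vertex satisfies the odd condition. The rooted graph $(G,v)$ is $G$ with distinguished root vertex $v$; an odd $k$-coloring of $(G,v)$ is an odd $k$-coloring of $G$ such that $v$ satisfies both the odd condition and the even condition. An outerplanar graph is a graph that can be embedded in the plane with all vertices on the boundary of the outer face. A block is a maximal connected subgraph without a cut vertex.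
   Formalization: The graph is assumed to have at least two vertices: for the one-vertex graph the root is isolated and cannot satisfy the odd condition, although its only block is not C_5, so the statement fails there. -}

module Defs where

open import Data.Nat using (ℕ; zero; suc; _+_; _<_; _%_; _≤_)
open import Data.Fin using (Fin; toℕ; _≟_)
open import Data.List using (List; length; filter; allFin)
open import Data.Bool using (Bool; true; false; _∧_; T; if_then_else_)
open import Data.Product using (Σ; ∃; ∃-syntax; _×_; _,_)
open import Data.Sum using (_⊎_)
open import Data.Empty using (⊥)
open import Relation.Nullary using (¬_; does)
open import Relation.Binary.PropositionalEquality using (_≡_; _≢_)
open import Function.Definitions using (Injective)

record Graph (n : ℕ) : Set where
  field
    adj    : Fin n → Fin n → Bool
    sym    : ∀ x y → adj x y ≡ adj y x
    irrefl : ∀ x → adj x x ≡ false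
open Graph public

VSet : ℕ → Set
VSet n = Fin n → Bool

_⊆_ : ∀ {n} → VSet n → VSet n → Set
S ⊆ S' = ∀ x → T (S x) → T (S' x)

_∖_ : ∀ {n} → VSet n → Fin n → VSet n
(S ∖ x) y = if does (x ≟ y) then false else S y

data Reach {n : ℕ} (G : Graph n) (S : VSet n) : Fin n → Fin n → Set where
  here : ∀ {u} → T (S u) → Reach G S u u
  step : ∀ {u x w} → T (S u) → T (adj G u x) → Reach G S x w → Reach G S u w

ConnectedOn : ∀ {n} → Graph n → VSet n → Set
ConnectedOn G S = ∀ u w → T (S u) → T (S w) → Reach G S u w

all : ∀ {n} → VSet n
all _ = true

Connected : ∀ {n} → Graph n → Set
Connected G = ConnectedOn G all

NoCutVertex : ∀ {n} → Graph n → VSet n → Set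
NoCutVertex G S = ∀ x → T (S x) → ConnectedOn G (S ∖ x)

-- A block: (vertex set of) a maximal connected subgraph without a cut
-- vertex.  Maximal such subgraphs are induced, so vertex sets suffice.
IsBlock : ∀ {n} → Graph n → VSet n → Set
IsBlock G S =
  (∃[ x ] T (S x)) × ConnectedOn G S × NoCutVertex G S ×
  (∀ S' → S ⊆ S' → ConnectedOn G S' → NoCutVertex G S' → S' ⊆ S)

c5adj : Fin 5 → Fin 5 → Set
c5adj i j = (toℕ j ≡ suc (toℕ i) % 5) ⊎ (toℕ i ≡ suc (toℕ j) % 5)

IsoC5 : ∀ {n} → Graph n → VSet n → Set
IsoC5 G S =
  Σ (Fin 5 → Fin _) λ f →
    Injective _≡_ _≡_ f ×
    (∀ x → T (S x) → ∃[ i ] f i ≡ x) ×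
    (∀ i → T (S (f i))) ×
    (∀ i j → T (adj G (f i) (f j)) → c5adj i j) ×
    (∀ i j → c5adj i j → T (adj G (f i) (f j)))

-- Outerplanarity: the vertices can be placed in convex position (in a
-- cyclic order given by the injective map pos) so that no two edges
-- (drawn as chords) cross.
Outerplanar : ∀ {n} → Graph n → Set
Outerplanar {n} G =
  Σ (Fin n → Fin n) λ pos → Injective _≡_ _≡_ pos ×
    (∀ a b c d → T (adj G a b) → T (adj G c d) →
       toℕ (pos a) < toℕ (pos c) → toℕ (pos c) < toℕ (pos b) →
       toℕ (pos b) < toℕ (pos d) → ⊥)

Coloring : ℕ → ℕ → Set
Coloring n k = Fin n → Fin k

Proper : ∀ {n k} → Graph n → Coloring n k → Set
Proper G φ = ∀ u w → T (adj G u w) → φ u ≢ φ w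

colCount : ∀ {n k} → Graph n → Coloring n k → Fin n → Fin k → ℕ
colCount {n} G φ x i =
  length (filter (λ y → T? (adj G x y) ) (filter (λ y → φ y ≟ i) (allFin n)))
  where
  open import Relation.Nullary using (Dec; yes; no)
  T? : (b : Bool) → Dec (T b)
  T? true = yes _
  T? false = no (λ ())

NonIsolated : ∀ {n} → Graph n → Fin n → Set
NonIsolated G x = ∃[ y ] T (adj G x y)

OddCond : ∀ {n k} → Graph n → Coloring n k → Fin n → Set
OddCond G φ x = ∃[ i ] colCount G φ x i % 2 ≡ 1

EvenCond : ∀ {n k} → Graph n → Coloring n k → Fin n → Set
EvenCond G φ x = ∃[ i ] (i ≢ φ x × colCount G φ x i % 2 ≡ 0)

OddColoring : ∀ {n k} → Graph n → Coloring n k → Set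
OddColoring G φ = Proper G φ × (∀ x → NonIsolated G x → OddCond G φ x)

RootedOddColoring : ∀ {n k} → Graph n → Fin n → Coloring n k → Set
RootedOddColoring G v φ = OddColoring G φ × OddCond G φ v × EvenCond G φ v

{-# OPTIONS --safe #-}
module Submission where

-- Identify the four colours with F₂² and let every neighbour y of x contribute
-- (φ x + φ y , 1) ∈ F₂³ to the value of x.  A proper colouring satisfies the odd
-- condition at x iff the value of x is nonzero, and both the odd and the even condition
-- iff the F₂²-component of the value is nonzero.
--
-- Place the root first on the outer cycle.  A connected noncrossing graph is built up from
-- single vertices by joining two rooted pieces by an edge, gluing pieces in series at a
-- vertex, and closing a series of pieces by an edge to a bounded face.  Up to linear
-- automorphisms of F₂², what matters about a colouring of a piece is the colour difference of
-- its two ends and the values there.  Finitely many sets of such states are closed under the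
-- operations, and this finite check yields a rooted colouring unless every block is a pentagon.
--
-- In a pentagon whose last four vertices have nonzero values, the two contributions to the
-- first vertex cancel.  Hence in a tree of pentagons nonzero values elsewhere force the value
-- of the root to be zero, and there is no odd 4-colouring.

open import Defs
open import Data.Bool using (Bool; true; false; T; _∧_; _∨_; _xor_; not; if_then_else_)
open import Data.Bool.Properties using (T?; T-∨; ∧-identityʳ; ∧-zeroʳ) renaming (_≟_ to _≟ᵇ_)
open import Data.Empty using (⊥; ⊥-elim)
open import Data.Fin using (Fin; zero; suc; toℕ; _≟_)
open import Data.Fin.Patterns using (0F; 1F; 2F; 3F; 4F; 5F)
open import Data.Fin.Properties using (all?; any?; toℕ-injective; toℕ<n)
open import Data.List using (List; []; _∷_; map; length; filter; tabulate)
open import Data.List.Membership.Propositional using (find) renaming (_∈_ to _∈ₗ_)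
open import Data.List.Relation.Unary.All as All using (All) renaming (all? to allₗ?)
open import Data.List.Relation.Unary.Any using (Any; here) renaming (any? to anyₗ?)
open import Data.Nat using (ℕ; zero; suc; _+_; _%_; _≤_; _<_; _<?_; z≤n; s≤s) renaming (_≟_ to _≟ⁿ_)
open import Data.Nat.Properties using (≤-refl; ≤-trans; ≤-pred; <-trans; <-≤-trans; ≤-<-trans; <-irrefl; <-cmp; ≮⇒≥; n≮0; m≤n⇒m≤1+n; m≤n+m; +-cancelʳ-<; +-cancelʳ-≡)
open import Data.Product using (_×_; _,_; proj₁; proj₂; ∃-syntax)
open import Data.Product.Properties using (≡-dec)
open import Data.Sum using (_⊎_; inj₁; inj₂; [_,_])
open import Data.Unit using (⊤; tt)
open import Function using (_∘_; flip; id; Equivalence)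
open import Function.Bundles using (_⇔_; mk⇔)
open import Relation.Binary using (DecidableEquality)
open import Relation.Binary.Definitions using (Tri; tri<; tri≈; tri>; Trichotomous; Transitive)
open import Relation.Binary.PropositionalEquality using (_≡_; _≢_; refl; trans; cong; cong₂; subst; module ≡-Reasoning) renaming (sym to ≡-sym)
open import Relation.Nullary using (¬_; Dec; yes; no; does)
open import Relation.Nullary.Decidable using (from-yes; map′; dec-true; ¬?; _→-dec_; _×-dec_; _⊎-dec_)

-- Colours and values

-- For a proper colouring let n₁, n₂, n₃ be the numbers of neighbours of x with colours φ x + 1, φ x
-- + 2, φ x + 3. The vectors (1,1), (2,1), (3,1) form a basis of F₂³, so the value of x encodes
-- precisely the three parities, and its F₂²-component vanishes iff the parities agree. Values add
-- up over pieces at a common vertex, ignore translations of the colours and transform linearly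
-- under automorphisms. Hence pieces glued at a vertex can be coloured separately, twisted
-- independently and then aligned by a translation.
--
-- The obstacle is that one promised state per piece is not enough in general: later pieces change
-- the values at the ends and may cancel them. A type is therefore a set of states all of which the
-- piece realises. It may omit realisable states, and this slack keeps the tables short. The tags
-- let the same check single out the exceptional pieces: they follow the way in which trees of
-- pentagons are built, so the type whose root value is stuck at zero arises for these only.

Colour : Set
Colour = Fin 4

infixl 6 _⊕_ _+ᵛ_
infix 4 _≟ᵛ_

_⊕_ : Colour → Colour → Colour
0F ⊕ y = y
1F ⊕ 0F = 1F
1F ⊕ 1F = 0F
1F ⊕ 2F = 3F
1F ⊕ 3F = 2F
2F ⊕ 0F = 2F
2F ⊕ 1F = 3F
2F ⊕ 2F = 0F
2F ⊕ 3F = 1F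
3F ⊕ 0F = 3F
3F ⊕ 1F = 2F
3F ⊕ 2F = 1F
3F ⊕ 3F = 0F

⊕-assoc : ∀ x y z → (x ⊕ y) ⊕ z ≡ x ⊕ (y ⊕ z)
⊕-assoc = from-yes (all? λ x → all? λ y → all? λ z → (x ⊕ y) ⊕ z ≟ x ⊕ (y ⊕ z))

⊕-comm : ∀ x y → x ⊕ y ≡ y ⊕ x
⊕-comm = from-yes (all? λ x → all? λ y → x ⊕ y ≟ y ⊕ x)

⊕-self : ∀ x → x ⊕ x ≡ 0F
⊕-self = from-yes (all? λ x → x ⊕ x ≟ 0F)

⊕-cancelˡ : ∀ x y → x ⊕ (x ⊕ y) ≡ y
⊕-cancelˡ = from-yes (all? λ x → all? λ y → x ⊕ (x ⊕ y) ≟ y)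

⊕-shift : ∀ x y t → (x ⊕ t) ⊕ (y ⊕ t) ≡ x ⊕ y
⊕-shift = from-yes (all? λ x → all? λ y → all? λ t → (x ⊕ t) ⊕ (y ⊕ t) ≟ x ⊕ y)

⊕≡0⇒≡ : ∀ x y → x ⊕ y ≡ 0F → x ≡ y
⊕≡0⇒≡ = from-yes (all? λ x → all? λ y → (x ⊕ y ≟ 0F) →-dec (x ≟ y))

-- An F₂-linear automorphism is an arbitrary permutation of the nonzero colours.
act : Fin 6 → Colour → Colour
act g 0F = 0F
act 0F x = x
act 1F 1F = 1F
act 1F 2F = 3F
act 1F 3F = 2F
act 2F 1F = 2F
act 2F 2F = 1F
act 2F 3F = 3F
act 3F 1F = 3F
act 3F 2F = 2F
act 3F 3F = 1F
act 4F 1F = 2F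
act 4F 2F = 3F
act 4F 3F = 1F
act 5F 1F = 3F
act 5F 2F = 1F
act 5F 3F = 2F

act-⊕ : ∀ g x y → act g (x ⊕ y) ≡ act g x ⊕ act g y
act-⊕ = from-yes (all? λ g → all? λ x → all? λ y → act g (x ⊕ y) ≟ act g x ⊕ act g y)

act-injective : ∀ g x y → act g x ≡ act g y → x ≡ y
act-injective = from-yes (all? λ g → all? λ x → all? λ y → (act g x ≟ act g y) →-dec (x ≟ y))

V : Set
V = Colour × Bool

0ᵛ : V
0ᵛ = 0F , false

_+ᵛ_ : V → V → V
(x , p) +ᵛ (y , q) = x ⊕ y , p xor q

actᵛ : Fin 6 → V → V
actᵛ g (x , p) = act g x , p

_≟ᵛ_ : DecidableEquality V
_≟ᵛ_ = ≡-dec _≟_ _≟ᵇ_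

allᵇ? : {P : Bool → Set} → (∀ b → Dec (P b)) → Dec (∀ b → P b)
allᵇ? P? = map′ (λ { (t , f) true → t ; (t , f) false → f }) (λ h → h true , h false) (P? true ×-dec P? false)

allᵛ? : {P : V → Set} → (∀ v → Dec (P v)) → Dec (∀ v → P v)
allᵛ? P? = map′ (λ h (x , p) → h x p) (λ h x p → h (x , p)) (all? λ x → allᵇ? λ p → P? (x , p))

+ᵛ-assoc : ∀ u v w → (u +ᵛ v) +ᵛ w ≡ u +ᵛ (v +ᵛ w)
+ᵛ-assoc = from-yes (allᵛ? λ u → allᵛ? λ v → allᵛ? λ w → (u +ᵛ v) +ᵛ w ≟ᵛ u +ᵛ (v +ᵛ w))

+ᵛ-comm : ∀ u v → u +ᵛ v ≡ v +ᵛ u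
+ᵛ-comm = from-yes (allᵛ? λ u → allᵛ? λ v → u +ᵛ v ≟ᵛ v +ᵛ u)

+ᵛ-identityʳ : ∀ v → v +ᵛ 0ᵛ ≡ v
+ᵛ-identityʳ = from-yes (allᵛ? λ v → v +ᵛ 0ᵛ ≟ᵛ v)

+ᵛ-interchange : ∀ a b c d → (a +ᵛ b) +ᵛ (c +ᵛ d) ≡ (a +ᵛ c) +ᵛ (b +ᵛ d)
+ᵛ-interchange a b c d = begin
  (a +ᵛ b) +ᵛ (c +ᵛ d) ≡⟨ +ᵛ-assoc a b (c +ᵛ d) ⟩
  a +ᵛ (b +ᵛ (c +ᵛ d)) ≡⟨ cong (a +ᵛ_) (+ᵛ-assoc b c d) ⟨
  a +ᵛ ((b +ᵛ c) +ᵛ d) ≡⟨ cong (λ z → a +ᵛ (z +ᵛ d)) (+ᵛ-comm b c) ⟩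
  a +ᵛ ((c +ᵛ b) +ᵛ d) ≡⟨ cong (a +ᵛ_) (+ᵛ-assoc c b d) ⟩
  a +ᵛ (c +ᵛ (b +ᵛ d)) ≡⟨ +ᵛ-assoc a c (b +ᵛ d) ⟨
  (a +ᵛ c) +ᵛ (b +ᵛ d) ∎
  where open ≡-Reasoning

actᵛ-+ : ∀ g u v → actᵛ g (u +ᵛ v) ≡ actᵛ g u +ᵛ actᵛ g v
actᵛ-+ g (x , p) (y , q) = cong (_, p xor q) (act-⊕ g x y)

actᵛ-≢0 : ∀ g v → v ≢ 0ᵛ → actᵛ g v ≢ 0ᵛ
actᵛ-≢0 = from-yes (all? λ g → allᵛ? λ v → ¬? (v ≟ᵛ 0ᵛ) →-dec ¬? (actᵛ g v ≟ᵛ 0ᵛ))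

edge : Colour → V
edge d = d , true

-- Vertex sets and reachability

infix 4 _∈_ _∉_

_∈_ _∉_ : ∀ {n} → Fin n → VSet n → Set
x ∈ S = T (S x)
x ∉ S = ¬ x ∈ S

[[_]] : ∀ {n} {P : Fin n → Set} → (∀ x → Dec (P x)) → VSet n
[[ P? ]] x = does (P? x)

∈-intro : ∀ {n} {P : Fin n → Set} (P? : ∀ x → Dec (P x)) {x} → P x → x ∈ [[ P? ]]
∈-intro P? {x} p rewrite dec-true (P? x) p = tt

∈-elim : ∀ {n} {P : Fin n → Set} (P? : ∀ x → Dec (P x)) {x} → x ∈ [[ P? ]] → P x
∈-elim P? {x} m with P? x
... | yes p = p

∖-intro : ∀ {n} {S : VSet n} {x y} → x ≢ y → y ∈ S → y ∈ (S ∖ x)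
∖-intro {x = x} {y} x≢y y∈S with x ≟ y
... | yes x≡y = x≢y x≡y
... | no _    = y∈S

∖-⊆ : ∀ {n} {S : VSet n} {x} → (S ∖ x) ⊆ S
∖-⊆ {x = x} y m with x ≟ y
... | no _ = m

∖-≢ : ∀ {n} {S : VSet n} {x y} → y ∈ (S ∖ x) → x ≢ y
∖-≢ {x = x} {y} m with x ≟ y
... | no x≢y = x≢y

count : ∀ {n} → VSet n → ℕ
count {zero}  S = 0
count {suc n} S = (if S zero then 1 else 0) + count (S ∘ suc)

count-≤ : ∀ {n} {S S' : VSet n} → S ⊆ S' → count S ≤ count S'
count-≤ {zero}  S⊆S' = z≤n
count-≤ {suc n} {S} {S'} S⊆S' with S zero | S' zero | S⊆S' zero
... | true  | true  | _ = s≤s (count-≤ (S⊆S' ∘ suc))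
... | true  | false | h = ⊥-elim (h tt)
... | false | true  | _ = m≤n⇒m≤1+n (count-≤ (S⊆S' ∘ suc))
... | false | false | _ = count-≤ (S⊆S' ∘ suc)

count-< : ∀ {n} {S S' : VSet n} → S ⊆ S' → ∀ x → x ∈ S' → x ∉ S → count S < count S'
count-< {S = S} {S'} S⊆S' zero x∈ x∉ with S zero | S' zero
... | true  | _    = ⊥-elim (x∉ tt)
... | false | true = s≤s (count-≤ (S⊆S' ∘ suc))
count-< {S = S} {S'} S⊆S' (suc x) x∈ x∉ with S zero | S' zero | S⊆S' zero
... | true  | true  | _ = s≤s (count-< (S⊆S' ∘ suc) x x∈ x∉)
... | true  | false | h = ⊥-elim (h tt)
... | false | true  | _ = m≤n⇒m≤1+n (count-< (S⊆S' ∘ suc) x x∈ x∉)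
... | false | false | _ = count-< (S⊆S' ∘ suc) x x∈ x∉

count-∖ : ∀ {n} {S : VSet n} {x k} → x ∈ S → count S ≤ suc k → count (S ∖ x) ≤ k
count-∖ {S = S} {x} x∈S le = ≤-pred (<-≤-trans (count-< (∖-⊆ {S = S} {x}) x x∈S (λ m → ∖-≢ {S = S} m refl)) le)

count-∈ : ∀ {n} {S : VSet n} {x} → x ∈ S → 0 < count S
count-∈ {S = S} {x} x∈S = ≤-trans (s≤s z≤n) (count-< {S = λ _ → false} {S} (λ _ ()) x x∈S (λ ()))

module Reachability {n : ℕ} (G : Graph n) where

  infix 4 _~_

  _~_ : Fin n → Fin n → Set
  x ~ y = T (adj G x y)

  ~-sym : ∀ {x y} → x ~ y → y ~ x
  ~-sym {x} {y} = subst T (sym G x y)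

  ~-irrefl : ∀ {x} → ¬ (x ~ x)
  ~-irrefl {x} = subst T (irrefl G x)

  ~⇒≢ : ∀ {x y} → x ~ y → x ≢ y
  ~⇒≢ x~y refl = ~-irrefl x~y

  source : ∀ {S x y} → Reach G S x y → x ∈ S
  source (here x∈)     = x∈
  source (step x∈ _ _) = x∈

  target : ∀ {S x y} → Reach G S x y → y ∈ S
  target (here x∈)    = x∈
  target (step _ _ r) = target r

  ⟫ : ∀ {S x y z} → Reach G S x y → Reach G S y z → Reach G S x z
  ⟫ (here _)        q = q
  ⟫ (step x∈ x~ p) q = step x∈ x~ (⟫ p q)

  edge-reach : ∀ {S x y} → x ∈ S → y ∈ S → x ~ y → Reach G S x y
  edge-reach x∈ y∈ x~y = step x∈ x~y (here y∈)

  reverse : ∀ {S x y} → Reach G S x y → Reach G S y x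
  reverse (here x∈)        = here x∈
  reverse (step x∈ x~ p) = ⟫ (reverse p) (edge-reach (source p) x∈ (~-sym x~))

  reach-⊆ : ∀ {S S' x y} → S ⊆ S' → Reach G S x y → Reach G S' x y
  reach-⊆ S⊆S' (here x∈)       = here (S⊆S' _ x∈)
  reach-⊆ S⊆S' (step x∈ x~ p) = step (S⊆S' _ x∈) x~ (reach-⊆ S⊆S' p)

  connected-via : ∀ {S} u → (∀ x → x ∈ S → Reach G S x u) → ConnectedOn G S
  connected-via u h x y x∈ y∈ = ⟫ (h x x∈) (reverse (h y y∈))

  -- A path cut at its first stopping vertex stays in `P`, since an edge can leave `P` only from a
  -- stopping vertex. This is how the parts cut out of a connected set are shown to be connected.
  reach-until : ∀ {S} (P : VSet n) {stop : Fin n → Set} → (∀ x → Dec (stop x)) →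
    (∀ {a b} → a ∈ P → ¬ stop a → b ∈ S → a ~ b → b ∈ P) →
    ∀ {x y} → Reach G S x y → stop y → x ∈ P → ∃[ s ] (stop s × Reach G P x s)
  reach-until P stop? closed {x} p stop-y x∈P with stop? x
  ... | yes stop-x = x , stop-x , here x∈P
  reach-until P stop? closed (here _) stop-y x∈P | no ¬stop = ⊥-elim (¬stop stop-y)
  reach-until P stop? closed (step x∈ x~ p) stop-y x∈P | no ¬stop
    with reach-until P stop? closed p stop-y (closed x∈P ¬stop (source p) x~)
  ... | s , stop-s , q = s , stop-s , step x∈P x~ q

  reach-within : ∀ {S} (P : VSet n) → (∀ {a b} → a ∈ P → b ∈ S → a ~ b → b ∈ P) →
    ∀ {x y} → Reach G S x y → x ∈ P → Reach G P x y
  reach-within P closed (here _) x∈P = here x∈P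
  reach-within P closed (step _ x~ p) x∈P = step x∈P x~ (reach-within P closed p (closed x∈P (source p) x~))

  -- Replaces the extraction of a simple path: what follows the last visit to `u` avoids `u`.
  data LastExit (S : VSet n) (u x w : Fin n) : Set where
    avoids : Reach G (S ∖ u) x w → LastExit S u x w
    ends   : u ≡ w → LastExit S u x w
    exits  : ∀ y → u ~ y → Reach G (S ∖ u) y w → LastExit S u x w

  last-exit : ∀ {S} u {x w} → Reach G S x w → LastExit S u x w
  last-exit {S} u {x} (here x∈) with u ≟ x
  ... | yes u≡x = ends u≡x
  ... | no u≢x  = avoids (here (∖-intro {S = S} u≢x x∈))
  last-exit {S} u (step {u = x} x∈ x~ p) with last-exit u p
  ... | ends e       = ends e
  ... | exits y u~ q = exits y u~ q
  ... | avoids q with u ≟ x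
  ...   | yes refl = exits _ x~ q
  ...   | no u≢x   = avoids (step (∖-intro {S = S} u≢x x∈) x~ q)

  -- By `last-exit` a path may be assumed never to return to its first vertex. The search can thus
  -- delete that vertex, and the size of `S` bounds its depth.
  reach-fuel? : ∀ k S → count S ≤ k → ∀ x w → Dec (Reach G S x w)
  reach-fuel? zero S le x w = no λ p → ⊥-elim (n≮0 (≤-trans (count-∈ {S = S} (source p)) le))
    

  reach-fuel? (suc k) S le x w with T? (S x)
  ... | no x∉ = no (x∉ ∘ source)
  ... | yes x∈ = map′ to from
          (x ≟ w ⊎-dec any? λ y → T? (adj G x y) ×-dec reach-fuel? k (S ∖ x) (count-∖ {S = S} x∈ le) y w)
    where
    to : x ≡ w ⊎ (∃[ y ] (x ~ y × Reach G (S ∖ x) y w)) → Reach G S x w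
    to (inj₁ refl)          = here x∈
    to (inj₂ (y , x~y , p)) = step x∈ x~y (reach-⊆ (∖-⊆ {S = S} {x}) p)
    from : Reach G S x w → x ≡ w ⊎ (∃[ y ] (x ~ y × Reach G (S ∖ x) y w))
    from p with last-exit x p
    ... | avoids q      = ⊥-elim (∖-≢ {S = S} (source q) refl)
    ... | ends e        = inj₁ e
    ... | exits y x~y q = inj₂ (y , x~y , q)

  reach? : ∀ S x w → Dec (Reach G S x w)
  reach? S = reach-fuel? (count S) S ≤-refl

-- Decomposition of connected noncrossing graphs

module Trees {n : ℕ} (G : Graph n) where

  open Reachability G public

  -- `X` lists the edges allowed between the two sides away from `w`: none in a series, and only the
  -- closing edge `u v` in a face, where that edge belongs to neither side.
  record Glue (X : Fin n → Fin n → Set) (S S₁ S₂ : VSet n) (w : Fin n) : Set where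
    field
      ⊆₁    : S₁ ⊆ S
      ⊆₂    : S₂ ⊆ S
      cover : ∀ {x} → x ∈ S → x ∈ S₁ ⊎ x ∈ S₂
      meet  : ∀ {x} → x ∈ S₁ → x ∈ S₂ → x ≡ w
      cross : ∀ {a b} → a ∈ S₁ → b ∈ S₂ → a ≢ w → b ≢ w → a ~ b → X a b

  record Bridge (S S₁ S₂ : VSet n) (u v : Fin n) : Set where
    field
      ⊆₁       : S₁ ⊆ S
      ⊆₂       : S₂ ⊆ S
      cover    : ∀ {x} → x ∈ S → x ∈ S₁ ⊎ x ∈ S₂
      disjoint : ∀ {x} → x ∈ S₁ → x ∈ S₂ → ⊥
      joined   : u ~ v
      cross    : ∀ {a b} → a ∈ S₁ → b ∈ S₂ → a ~ b → a ≡ u × b ≡ v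

  Only : Fin n → Fin n → Fin n → Fin n → Set
  Only u v a b = a ≡ u × b ≡ v

  Never : Fin n → Fin n → Set
  Never _ _ = ⊥

  -- The ends u and v of a link are always adjacent: a face is a series of two parts together
  -- with the edge u v.
  data Rooted (S : VSet n) (u : Fin n) : Set
  data Chain (S : VSet n) (u v : Fin n) : Set
  data Link (S : VSet n) (u v : Fin n) : Set

  data Rooted S u where
    leaf : u ∈ S → (∀ {x} → x ∈ S → x ≡ u) → Rooted S u
    grow : ∀ {v} → Chain S u v → Rooted S u

  data Chain S u v where
    one  : Link S u v → Chain S u v
    cons : ∀ {S₁ S₂ w} → Link S₁ u w → Chain S₂ w v → Glue Never S S₁ S₂ w → Chain S u v

  data Link S u v where
    bridge : ∀ {S₁ S₂} → Rooted S₁ u → Rooted S₂ v → Bridge S S₁ S₂ u v → Link S u v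
    face   : ∀ {S₁ S₂ w} → Link S₁ u w → Chain S₂ w v → u ~ v → Glue (Only u v) S S₁ S₂ w → Link S u v

  -- Kept abstract because two kinds of order occur: the outer cycle read from the root, and its
  -- reversal, in which the far end of a bridge comes first.
  record Order : Set₁ where
    infix 4 _≺_
    field
      _≺_      : Fin n → Fin n → Set
      ≺-trans  : Transitive _≺_
      compare  : Trichotomous _≡_ _≺_
      planar   : ∀ {a b c d} → a ~ b → c ~ d → a ≺ c → c ≺ b → b ≺ d → ⊥

    _≺?_ : ∀ x y → Dec (x ≺ y)
    x ≺? y with compare x y
    ... | tri< lt _ _ = yes lt
    ... | tri≈ ¬lt _ _ = no ¬lt
    ... | tri> ¬lt _ _ = no ¬lt

    ≺-irrefl : ∀ {x} → ¬ (x ≺ x)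
    ≺-irrefl {x} lt with compare x x
    ... | tri< _ ne _ = ne refl
    ... | tri≈ ¬lt _ _ = ¬lt lt
    ... | tri> _ ne _ = ne refl

    ≺-asym : ∀ {x y} → x ≺ y → ¬ (y ≺ x)
    ≺-asym p q = ≺-irrefl (≺-trans p q)

    ≺⇒≢ : ∀ {x y} → x ≺ y → x ≢ y
    ≺⇒≢ lt refl = ≺-irrefl lt

    ⊀⇒≻ : ∀ {x y} → x ≢ y → ¬ (x ≺ y) → y ≺ x
    ⊀⇒≻ {x} {y} ne ¬lt with compare x y
    ... | tri< lt _ _ = ⊥-elim (¬lt lt)
    ... | tri≈ _ eq _ = ⊥-elim (ne eq)
    ... | tri> _ _ gt = gt

    IsMin IsMax : VSet n → Fin n → Set
    IsMin S u = u ∈ S × (∀ {x} → x ∈ S → ¬ (x ≺ u))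
    IsMax S v = v ∈ S × (∀ {x} → x ∈ S → ¬ (v ≺ x))

    -- Climbing from x through S: each climb removes x from the candidates.
    max-fuel : ∀ k (S : VSet n) {P : Fin n → Set} → (∀ x → Dec (P x)) → count S ≤ k →
      ∀ x → x ∈ S → P x → (∀ {y} → P y → x ≺ y → y ∈ S) →
      ∃[ m ] (P m × (∀ {y} → P y → ¬ (m ≺ y)))
    max-fuel zero S P? le x x∈ px up = ⊥-elim (n≮0 (≤-trans (count-∈ {S = S} x∈) le))
    max-fuel (suc k) S P? le x x∈ px up with any? (λ y → P? y ×-dec (x ≺? y))
    ... | no none = x , px , λ py x≺y → none (_ , py , x≺y)
    ... | yes (y , py , x≺y) = max-fuel k (S ∖ x) P? (count-∖ {S = S} x∈ le) y
            (∖-intro {S = S} (≺⇒≢ x≺y) (up py x≺y)) py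
            (λ pz y≺z → ∖-intro {S = S} (≺⇒≢ (≺-trans x≺y y≺z)) (up pz (≺-trans x≺y y≺z)))

    maximum : {P : Fin n → Set} → (∀ x → Dec (P x)) → ∀ x → P x →
      ∃[ m ] (P m × (∀ {y} → P y → ¬ (m ≺ y)))
    maximum P? x px = max-fuel (count {n} all) all P? ≤-refl x _ px (λ _ _ → _)

  dual : Order → Order
  dual O = record
    { _≺_     = flip _≺_
    ; ≺-trans = flip ≺-trans
    ; compare = λ x y → swap (compare x y)
    ; planar  = λ a~b c~d c≺a b≺c d≺b → planar (~-sym c~d) (~-sym a~b) d≺b b≺c c≺a
    }
    where
    open Order O
    swap : ∀ {x y} → Tri (x ≺ y) (x ≡ y) (y ≺ x) → Tri (y ≺ x) (x ≡ y) (x ≺ y)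
    swap (tri< a b c) = tri> c b a
    swap (tri≈ a b c) = tri≈ c b a
    swap (tri> a b c) = tri< c b a

  module Cut (O : Order) where
    open Order O

    below above : VSet n → Fin n → VSet n
    below S m = [[ (λ x → T? (S x) ×-dec ¬? (m ≺? x)) ]]
    above S m = [[ (λ x → T? (S x) ×-dec ¬? (x ≺? m)) ]]

    module Slice (S : VSet n) (m : Fin n) where

      below-intro : ∀ {x} → x ∈ S → ¬ (m ≺ x) → x ∈ below S m
      below-intro x∈ ¬lt = ∈-intro (λ x → T? (S x) ×-dec ¬? (m ≺? x)) (x∈ , ¬lt)

      below-elim : ∀ {x} → x ∈ below S m → x ∈ S × ¬ (m ≺ x)
      below-elim = ∈-elim (λ x → T? (S x) ×-dec ¬? (m ≺? x))

      above-intro : ∀ {x} → x ∈ S → ¬ (x ≺ m) → x ∈ above S m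
      above-intro x∈ ¬lt = ∈-intro (λ x → T? (S x) ×-dec ¬? (x ≺? m)) (x∈ , ¬lt)

      above-elim : ∀ {x} → x ∈ above S m → x ∈ S × ¬ (x ≺ m)
      above-elim = ∈-elim (λ x → T? (S x) ×-dec ¬? (x ≺? m))

      below-≺ : ∀ {x} → x ∈ below S m → x ≢ m → x ≺ m
      below-≺ x∈ x≢m = ⊀⇒≻ (x≢m ∘ ≡-sym) (proj₂ (below-elim x∈))

      above-≻ : ∀ {x} → x ∈ above S m → x ≢ m → m ≺ x
      above-≻ x∈ x≢m = ⊀⇒≻ x≢m (proj₂ (above-elim x∈))

      glue-at : {X : Fin n → Fin n → Set} →
        (∀ {a b} → a ∈ S → b ∈ S → a ≺ m → m ≺ b → a ~ b → X a b) →
        Glue X S (below S m) (above S m) m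
      glue-at cut = record
        { ⊆₁ = λ _ → proj₁ ∘ below-elim
        ; ⊆₂ = λ _ → proj₁ ∘ above-elim
        ; cover = λ {x} x∈ → cov x∈ (m ≺? x)
        ; meet = λ {x} p q → eq x (proj₂ (below-elim p)) (proj₂ (above-elim q))
        ; cross = λ a∈ b∈ a≢ b≢ → cut (proj₁ (below-elim a∈)) (proj₁ (above-elim b∈)) (below-≺ a∈ a≢) (above-≻ b∈ b≢)
        }
        where
        cov : ∀ {x} → x ∈ S → Dec (m ≺ x) → x ∈ below S m ⊎ x ∈ above S m
        cov x∈ (yes lt) = inj₂ (above-intro x∈ (≺-asym lt))
        cov x∈ (no ¬lt) = inj₁ (below-intro x∈ ¬lt)
        eq : ∀ x → ¬ (m ≺ x) → ¬ (x ≺ m) → x ≡ m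
        eq x p q with x ≟ m
        ... | yes e = e
        ... | no ne = ⊥-elim (q (⊀⇒≻ (ne ∘ ≡-sym) p))

    min-≺ : ∀ {S u x} → IsMin S u → x ∈ S → x ≢ u → u ≺ x
    min-≺ (_ , least) x∈ x≢u = ⊀⇒≻ x≢u (least x∈)

    max-≺ : ∀ {S v x} → IsMax S v → x ∈ S → x ≢ v → x ≺ v
    max-≺ (_ , greatest) x∈ x≢v = ⊀⇒≻ (x≢v ∘ ≡-sym) (greatest x∈)

  first-step : ∀ {S u v} → Reach G S u v → u ≢ v → ∃[ y ] (y ∈ S × u ~ y)
  first-step (here _)       u≢v = ⊥-elim (u≢v refl)
  first-step (step _ u~y p) u≢v = _ , source p , u~y

  -- The recursion descends on the bound `k` for the number of vertices. `buildLink` is allowed one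
  -- vertex more, because each part of a link omits one of its two ends.
  buildRooted : ∀ k (O : Order) {S u} → count S ≤ k → ConnectedOn G S → Order.IsMin O S u → Rooted S u
  -- Let `m` be the largest neighbour of `u`. An edge jumping over `m` either starts at `u`, against
  -- the choice of `m`, or crosses the edge `u m`. So `m` is `v` or a cut vertex.
  buildChain : ∀ k (O : Order) {S u v} → count S ≤ k → ConnectedOn G S →
    Order.IsMin O S u → Order.IsMax O S v → u ≢ v → Chain S u v
  -- The edge `u v` lies on a cycle iff some vertex is reached from `u` avoiding `v` and from `v`
  -- avoiding `u`; otherwise it is a bridge. On a cycle, take `m` to be the largest neighbour of `u`
  -- other than `v`: now `u v` is the only edge jumping over `m`.
  buildLink : ∀ k (O : Order) {S u v} → count S ≤ suc k → ConnectedOn G S →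
    Order.IsMin O S u → Order.IsMax O S v → u ~ v → Link S u v
  buildSublink : ∀ k (O : Order) {S u v} → count S ≤ k → ConnectedOn G S →
    Order.IsMin O S u → Order.IsMax O S v → u ~ v → Link S u v

  buildSublink zero O {S} le conn min max u~v = ⊥-elim (n≮0 (≤-trans (count-∈ {S = S} (proj₁ min)) le))
  buildSublink (suc k) O le conn min max u~v = buildLink k O le conn min max u~v

  buildRooted k O {S} {u} le conn min with Order.maximum O (λ x → T? (S x)) u (proj₁ min)
  ... | v , v∈ , greatest with v ≟ u
  ...   | no v≢u   = grow (buildChain k O le conn min (v∈ , greatest) (v≢u ∘ ≡-sym))
  ...   | yes refl = leaf v∈ eq
    where
    open Order O
    eq : ∀ {x} → x ∈ S → x ≡ u
    eq {x} x∈ with x ≟ u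
    ... | yes e = e
    ... | no ne = ⊥-elim (greatest x∈ (Cut.min-≺ O min x∈ ne))

  buildChain zero O {S} le conn min max u≢v = ⊥-elim (n≮0 (≤-trans (count-∈ {S = S} (proj₁ min)) le))
  buildChain (suc k) O {S} {u} {v} le conn min max u≢v
    with first-step (conn u v (proj₁ min) (proj₁ max)) u≢v
  ... | y , y∈ , u~y
    with Order.maximum O (λ x → T? (S x) ×-dec T? (adj G u x)) y (y∈ , u~y)
  ... | m , (m∈ , u~m) , greatest with m ≟ v
  ...   | yes refl = one (buildLink k O le conn min max u~m)
  ...   | no m≢v =
    cons (buildLink k O (≤-trans (count-≤ {S = below S m} {S} (λ _ → proj₁ ∘ below-elim)) le) conn₁
           (below-intro (proj₁ min) (≺-asym u≺m) , λ x∈ → proj₂ min (proj₁ (below-elim x∈)))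
           (below-intro m∈ ≺-irrefl , λ x∈ → proj₂ (below-elim x∈)) u~m)
         (buildChain k O count₂ conn₂
           (above-intro m∈ ≺-irrefl , λ x∈ → proj₂ (above-elim x∈))
           (above-intro (proj₁ max) (≺-asym (max-≺ max m∈ m≢v)) , λ x∈ → proj₂ max (proj₁ (above-elim x∈))) m≢v)
         (glue-at cut)
    where
    open Order O
    open Cut O
    open Slice S m
    u≺m : u ≺ m
    u≺m = min-≺ min m∈ (~⇒≢ u~m ∘ ≡-sym)
    cut : ∀ {a b} → a ∈ S → b ∈ S → a ≺ m → m ≺ b → a ~ b → ⊥
    cut {a} {b} a∈ b∈ a≺m m≺b a~b with a ≟ u
    ... | yes refl = greatest (b∈ , a~b) m≺b
    ... | no a≢u   = planar u~m a~b (min-≺ min a∈ a≢u) a≺m m≺b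
    conn₁ : ConnectedOn G (below S m)
    conn₁ = connected-via m λ x x∈ → reaches x x∈
      where
      closed : ∀ {a b} → a ∈ below S m → a ≢ m → b ∈ S → a ~ b → b ∈ below S m
      closed a∈ a≢m b∈ a~b = below-intro b∈ λ m≺b → cut (proj₁ (below-elim a∈)) b∈ (below-≺ a∈ a≢m) m≺b a~b
      reaches : ∀ x → x ∈ below S m → Reach G (below S m) x m
      reaches x x∈ with reach-until (below S m) (_≟ m) closed (conn x m (proj₁ (below-elim x∈)) m∈) refl x∈
      ... | _ , refl , p = p
    conn₂ : ConnectedOn G (above S m)
    conn₂ = connected-via m λ x x∈ → reaches x x∈
      where
      closed : ∀ {a b} → a ∈ above S m → a ≢ m → b ∈ S → a ~ b → b ∈ above S m
      closed a∈ a≢m b∈ a~b = above-intro b∈ λ b≺m → cut b∈ (proj₁ (above-elim a∈)) b≺m (above-≻ a∈ a≢m) (~-sym a~b)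
      reaches : ∀ x → x ∈ above S m → Reach G (above S m) x m
      reaches x x∈ with reach-until (above S m) (_≟ m) closed (conn x m (proj₁ (above-elim x∈)) m∈) refl x∈
      ... | _ , refl , p = p
    count₂ : count (above S m) ≤ k
    count₂ = ≤-pred (<-≤-trans (count-< {S = above S m} {S} (λ _ → proj₁ ∘ above-elim) u (proj₁ min) (λ u∈ → proj₂ (above-elim u∈) u≺m)) le)

  buildLink k O {S} {u} {v} le conn min max u~v
    with any? (λ x → reach? (S ∖ v) u x ×-dec reach? (S ∖ u) v x)
  ... | no separate = bridge
      (buildRooted k O (count-left) (connected-via u (λ x x∈ → reverse (within-left x (leftE x∈))))
        (leftI (here u∈) , λ x∈ → proj₂ min (left-⊆ _ x∈)))
      -- Reversing the order makes v the first vertex of its component.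
      (buildRooted k (dual O) (count-right) (connected-via v (λ x x∈ → reverse (within-right x (rightE x∈))))
        (rightI (here v∈) , λ x∈ → proj₂ max (right-⊆ _ x∈)))
      record
        { ⊆₁ = left-⊆
        ; ⊆₂ = right-⊆
        ; cover = λ {x} x∈ → cov x (conn u x (proj₁ min) x∈)
        ; disjoint = λ {x} p q → separate (x , leftE p , rightE q)
        ; joined = u~v
        ; cross = cross
        }
    where
    left right : VSet n
    left  = [[ reach? (S ∖ v) u ]]
    right = [[ reach? (S ∖ u) v ]]
    leftI : ∀ {x} → Reach G (S ∖ v) u x → x ∈ left
    leftI = ∈-intro (reach? (S ∖ v) u)
    leftE : ∀ {x} → x ∈ left → Reach G (S ∖ v) u x
    leftE = ∈-elim (reach? (S ∖ v) u)
    rightI : ∀ {x} → Reach G (S ∖ u) v x → x ∈ right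
    rightI = ∈-intro (reach? (S ∖ u) v)
    rightE : ∀ {x} → x ∈ right → Reach G (S ∖ u) v x
    rightE = ∈-elim (reach? (S ∖ u) v)
    u∈ : u ∈ (S ∖ v)
    u∈ = ∖-intro {S = S} (~⇒≢ u~v ∘ ≡-sym) (proj₁ min)
    v∈ : v ∈ (S ∖ u)
    v∈ = ∖-intro {S = S} (~⇒≢ u~v) (proj₁ max)
    left-⊆ : left ⊆ S
    left-⊆ x x∈ = ∖-⊆ {S = S} {v} x (target (leftE x∈))
    right-⊆ : right ⊆ S
    right-⊆ x x∈ = ∖-⊆ {S = S} {u} x (target (rightE x∈))
    count-left : count left ≤ k
    count-left = ≤-pred (<-≤-trans (count-< left-⊆ v (proj₁ max) (λ m → ∖-≢ {S = S} (target (leftE m)) refl)) le)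
    count-right : count right ≤ k
    count-right = ≤-pred (<-≤-trans (count-< right-⊆ u (proj₁ min) (λ m → ∖-≢ {S = S} (target (rightE m)) refl)) le)
    extend-left : ∀ {a b} → a ∈ left → b ∈ (S ∖ v) → a ~ b → b ∈ left
    extend-left a∈ b∈ a~b = leftI (⟫ (leftE a∈) (edge-reach (target (leftE a∈)) b∈ a~b))
    extend-right : ∀ {a b} → a ∈ right → b ∈ (S ∖ u) → a ~ b → b ∈ right
    extend-right a∈ b∈ a~b = rightI (⟫ (rightE a∈) (edge-reach (target (rightE a∈)) b∈ a~b))
    within-left : ∀ x → Reach G (S ∖ v) u x → Reach G left u x
    within-left x p = reach-within left extend-left p (leftI (here u∈))
    within-right : ∀ x → Reach G (S ∖ u) v x → Reach G right v x
    within-right x p = reach-within right extend-right p (rightI (here v∈))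
    cov : ∀ x → Reach G S u x → x ∈ left ⊎ x ∈ right
    cov x p with last-exit v p
    ... | avoids q = inj₁ (leftI q)
    ... | ends refl = inj₂ (rightI (here v∈))
    ... | exits y v~y q with last-exit u q
    ...   | avoids r = inj₂ (rightI (step v∈ v~y (reach-⊆ {(S ∖ v) ∖ u} {S ∖ u} swap r)))
      where
      swap : ((S ∖ v) ∖ u) ⊆ (S ∖ u)
      swap z z∈ = ∖-intro {S = S} (∖-≢ {S = S ∖ v} {u} z∈) (∖-⊆ {S = S} {v} z (∖-⊆ {S = S ∖ v} {u} z z∈))
    ...   | ends refl = inj₁ (leftI (here u∈))
    ...   | exits z u~z r = inj₁ (leftI (step u∈ u~z (reach-⊆ (∖-⊆ {S = S ∖ v} {u}) r)))
    cross : ∀ {a b} → a ∈ left → b ∈ right → a ~ b → a ≡ u × b ≡ v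
    cross {a} {b} a∈ b∈ a~b with a ≟ u | b ≟ v
    ... | yes p | yes q = p , q
    ... | _ | no b≢v = ⊥-elim (separate (b , leftE (extend-left a∈ (∖-intro {S = S} (b≢v ∘ ≡-sym) (right-⊆ b b∈)) a~b) , rightE b∈))
    ... | no a≢u | _ = ⊥-elim (separate (a , leftE a∈ , rightE (extend-right b∈ (∖-intro {S = S} (a≢u ∘ ≡-sym) (left-⊆ a a∈)) (~-sym a~b))))
  ... | yes (x , p , q) with last-exit u p
  ...   | avoids r = ⊥-elim (∖-≢ {S = S ∖ v} {u} (source r) refl)
  ...   | ends refl = ⊥-elim (∖-≢ {S = S} (target q) refl)
  ...   | exits y u~y r
    with Order.maximum O (λ z → T? (S z) ×-dec T? (adj G u z) ×-dec ¬? (z ≟ v)) y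
           (∖-⊆ {S = S} {v} y (∖-⊆ {S = S ∖ v} {u} y (source r)) , u~y ,
            λ y≡v → ∖-≢ {S = S} (∖-⊆ {S = S ∖ v} {u} y (source r)) (≡-sym y≡v))
  ...     | m , (m∈ , u~m , m≢v) , greatest =
    face (buildSublink k O count₁ conn₁
           (below-intro (proj₁ min) (≺-asym u≺m) , λ x∈ → proj₂ min (proj₁ (below-elim x∈)))
           (below-intro m∈ ≺-irrefl , λ x∈ → proj₂ (below-elim x∈)) u~m)
         (buildChain k O count₂ conn₂
           (above-intro m∈ ≺-irrefl , λ x∈ → proj₂ (above-elim x∈))
           (v∈₂ , λ x∈ → proj₂ max (proj₁ (above-elim x∈))) m≢v)
         u~v (glue-at cut)
    where
    open Order O
    open Cut O
    open Slice S m
    u≺m : u ≺ m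
    u≺m = min-≺ min m∈ (~⇒≢ u~m ∘ ≡-sym)
    m≺v : m ≺ v
    m≺v = max-≺ max m∈ m≢v
    v∈₂ : v ∈ above S m
    v∈₂ = above-intro (proj₁ max) (≺-asym m≺v)
    cut : ∀ {a b} → a ∈ S → b ∈ S → a ≺ m → m ≺ b → a ~ b → a ≡ u × b ≡ v
    cut {a} {b} a∈ b∈ a≺m m≺b a~b with a ≟ u | b ≟ v
    ... | yes refl | yes e = refl , e
    ... | yes refl | no ne = ⊥-elim (greatest (b∈ , a~b , ne) m≺b)
    ... | no a≢u   | _     = ⊥-elim (planar u~m a~b (min-≺ min a∈ a≢u) a≺m m≺b)
    -- A path leaves this side only through `m` or along `u v`, hence from `u`; and `m` is adjacent
    -- to `u`.
    conn₁ : ConnectedOn G (below S m)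
    conn₁ = connected-via u λ x x∈ → reaches x x∈
      where
      closed : ∀ {a b} → a ∈ below S m → ¬ (a ≡ u ⊎ a ≡ m) → b ∈ S → a ~ b → b ∈ below S m
      closed a∈ ¬stop b∈ a~b = below-intro b∈ λ m≺b →
        ¬stop (inj₁ (proj₁ (cut (proj₁ (below-elim a∈)) b∈ (below-≺ a∈ (¬stop ∘ inj₂)) m≺b a~b)))
      reaches : ∀ x → x ∈ below S m → Reach G (below S m) x u
      reaches x x∈ with reach-until (below S m) (λ z → (z ≟ u) ⊎-dec (z ≟ m)) closed (conn x u (proj₁ (below-elim x∈)) (proj₁ min)) (inj₁ refl) x∈
      ... | _ , inj₁ refl , p = p
      ... | _ , inj₂ refl , p = ⟫ p (edge-reach (target p) (below-intro (proj₁ min) (≺-asym u≺m)) (~-sym u~m))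
    -- The cycle through `u v` enters here. It gives a path from `v` to `y` avoiding `u`, and `y`, a
    -- neighbour of `u` other than `v`, does not lie beyond `m`. Away from `u` this path can leave
    -- the upper side only through `m`.
    m-to-v : Reach G (above S m) m v
    m-to-v with reach-until (above S m) (λ z → ¬? (m ≺? z)) closed
                  (⟫ q (reverse (reach-⊆ {(S ∖ v) ∖ u} {S ∖ u} swap r)))
                  (greatest (∖-⊆ {S = S} {v} y (∖-⊆ {S = S ∖ v} {u} y (source r)) , u~y ,
                     λ y≡v → ∖-≢ {S = S} (∖-⊆ {S = S ∖ v} {u} y (source r)) (≡-sym y≡v)))
                  v∈₂
      where
      swap : ((S ∖ v) ∖ u) ⊆ (S ∖ u)
      swap z z∈ = ∖-intro {S = S} (∖-≢ {S = S ∖ v} {u} z∈) (∖-⊆ {S = S} {v} z (∖-⊆ {S = S ∖ v} {u} z z∈))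
      closed : ∀ {a b} → a ∈ above S m → ¬ ¬ (m ≺ a) → b ∈ (S ∖ u) → a ~ b → b ∈ above S m
      closed {a} {b} a∈ m≺a b∈ a~b = above-intro b∈S λ b≺m →
          m≺a λ m≺a → ∖-≢ {S = S} b∈ (≡-sym (proj₁ (cut b∈S (proj₁ (above-elim a∈)) b≺m m≺a (~-sym a~b))))
        where b∈S = ∖-⊆ {S = S} {u} b b∈
    ... | s , ¬m≺s , p' with s ≟ m
    ...   | yes refl = reverse p'
    ...   | no s≢m   = ⊥-elim (¬m≺s (above-≻ (target p') s≢m))
    conn₂ : ConnectedOn G (above S m)
    conn₂ = connected-via v λ x x∈ → reaches x x∈
      where
      closed : ∀ {a b} → a ∈ above S m → ¬ (a ≡ v ⊎ a ≡ m) → b ∈ S → a ~ b → b ∈ above S m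
      closed a∈ ¬stop b∈ a~b = above-intro b∈ λ b≺m →
        ¬stop (inj₁ (proj₂ (cut b∈ (proj₁ (above-elim a∈)) b≺m (above-≻ a∈ (¬stop ∘ inj₂)) (~-sym a~b))))
      reaches : ∀ x → x ∈ above S m → Reach G (above S m) x v
      reaches x x∈ with reach-until (above S m) (λ z → (z ≟ v) ⊎-dec (z ≟ m)) closed (conn x v (proj₁ (above-elim x∈)) (proj₁ max)) (inj₁ refl) x∈
      ... | _ , inj₁ refl , p = p
      ... | _ , inj₂ refl , p = ⟫ p m-to-v
    count₁ : count (below S m) ≤ k
    count₁ = ≤-pred (<-≤-trans (count-< {S = below S m} {S} (λ _ → proj₁ ∘ below-elim) v (proj₁ max) (λ v∈ → proj₂ (below-elim v∈) m≺v)) le)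
    count₂ : count (above S m) ≤ k
    count₂ = ≤-pred (<-≤-trans (count-< {S = above S m} {S} (λ _ → proj₁ ∘ above-elim) u (proj₁ min) (λ u∈ → proj₂ (above-elim u∈) u≺m)) le)

-- Values of a colouring

Σᵛ : ∀ {n} → (Fin n → V) → V
Σᵛ {zero}  f = 0ᵛ
Σᵛ {suc n} f = f zero +ᵛ Σᵛ (f ∘ suc)

Σᵛ-cong : ∀ {n} {f g : Fin n → V} → (∀ x → f x ≡ g x) → Σᵛ f ≡ Σᵛ g
Σᵛ-cong {zero}  f≗g = refl
Σᵛ-cong {suc n} f≗g = cong₂ _+ᵛ_ (f≗g zero) (Σᵛ-cong (f≗g ∘ suc))

Σᵛ-+ : ∀ {n} (f g : Fin n → V) → Σᵛ (λ x → f x +ᵛ g x) ≡ Σᵛ f +ᵛ Σᵛ g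
Σᵛ-+ {zero}  f g = refl
Σᵛ-+ {suc n} f g = trans (cong (f zero +ᵛ g zero +ᵛ_) (Σᵛ-+ (f ∘ suc) (g ∘ suc)))
                         (+ᵛ-interchange (f zero) (g zero) (Σᵛ (f ∘ suc)) (Σᵛ (g ∘ suc)))

Σᵛ-act : ∀ {n} g (f : Fin n → V) → Σᵛ (actᵛ g ∘ f) ≡ actᵛ g (Σᵛ f)
Σᵛ-act {zero}  g f = refl
Σᵛ-act {suc n} g f = trans (cong (actᵛ g (f zero) +ᵛ_) (Σᵛ-act g (f ∘ suc)))
                           (≡-sym (actᵛ-+ g (f zero) (Σᵛ (f ∘ suc))))

Σᵛ-0 : ∀ {n} {f : Fin n → V} → (∀ x → f x ≡ 0ᵛ) → Σᵛ f ≡ 0ᵛ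
Σᵛ-0 {zero}  f≗0 = refl
Σᵛ-0 {suc n} f≗0 = cong₂ _+ᵛ_ (f≗0 zero) (Σᵛ-0 (f≗0 ∘ suc))

Σᵛ-single : ∀ {n} {f : Fin n → V} y → (∀ x → x ≢ y → f x ≡ 0ᵛ) → Σᵛ f ≡ f y
Σᵛ-single {f = f} zero h = trans (cong (f zero +ᵛ_) (Σᵛ-0 (λ x → h (suc x) (λ ())))) (+ᵛ-identityʳ (f zero))
Σᵛ-single {f = f} (suc y) h = cong₂ _+ᵛ_ (h zero (λ ())) (Σᵛ-single y (λ x x≢y → h (suc x) (λ { refl → x≢y refl })))

term : Bool → Bool → Colour → V
term s a d = if s ∧ a then edge d else 0ᵛ

term-cong : ∀ s s' a {d d'} → (T a → T s → T s' × d ≡ d') → (T a → T s' → T s) → term s a d ≡ term s' a d'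
term-cong true  true  true  h k = cong edge (proj₂ (h tt tt))
term-cong true  false true  h k = ⊥-elim (proj₁ (h tt tt))
term-cong false true  true  h k = ⊥-elim (k tt tt)
term-cong false false true  h k = refl
term-cong true  true  false h k = refl
term-cong true  false false h k = refl
term-cong false true  false h k = refl
term-cong false false false h k = refl

term-+ : ∀ s s₁ s₂ a {d} → (T a → T s → T s₁ ⊎ T s₂) → (T a → T s₁ → T s) → (T a → T s₂ → T s) →
  (T a → T s₁ → T s₂ → ⊥) → term s a d ≡ term s₁ a d +ᵛ term s₂ a d
term-+ true  true  true  true h k₁ k₂ dis = ⊥-elim (dis tt tt tt)
term-+ true  true  false true h k₁ k₂ dis = ≡-sym (+ᵛ-identityʳ _)
term-+ true  false true  true h k₁ k₂ dis = refl
term-+ true  false false true h k₁ k₂ dis = ⊥-elim ([ (λ z → z) , (λ z → z) ] (h tt tt))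
term-+ false true  s₂    true h k₁ k₂ dis = ⊥-elim (k₁ tt tt)
term-+ false false true  true h k₁ k₂ dis = ⊥-elim (k₂ tt tt)
term-+ false false false true h k₁ k₂ dis = refl
term-+ true  true  true  false h k₁ k₂ dis = refl
term-+ true  true  false false h k₁ k₂ dis = refl
term-+ true  false true  false h k₁ k₂ dis = refl
term-+ true  false false false h k₁ k₂ dis = refl
term-+ false true  true  false h k₁ k₂ dis = refl
term-+ false true  false false h k₁ k₂ dis = refl
term-+ false false true  false h k₁ k₂ dis = refl
term-+ false false false false h k₁ k₂ dis = refl

term-act : ∀ g s a d → term s a (act g d) ≡ actᵛ g (term s a d)
term-act g true  true  d = refl
term-act g true  false d = refl
term-act g false a     d = refl

term-∉ : ∀ s a d → (T a → T s → ⊥) → term s a d ≡ 0ᵛ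
term-∉ true  true  d h = ⊥-elim (h tt tt)
term-∉ true  false d h = refl
term-∉ false a     d h = refl

module Values {n : ℕ} (G : Graph n) where

  open Trees G public

  Colours : Set
  Colours = Fin n → Colour

  -- The first component is the Laplacian of `φ` at `x` over F₂², the second the parity of the
  -- degree, both restricted to neighbours in `S`.
  val : VSet n → Colours → Fin n → V
  val S φ x = Σᵛ (λ y → term (S y) (adj G x y) (φ x ⊕ φ y))

  val-cong : ∀ {S S'} φ φ' x → φ x ≡ φ' x → (∀ y → x ~ y → y ∈ S → y ∈ S' × φ y ≡ φ' y) →
    (∀ y → x ~ y → y ∈ S' → y ∈ S) → val S φ x ≡ val S' φ' x
  val-cong {S} {S'} φ φ' x eq h k = Σᵛ-cong λ y → term-cong (S y) (S' y) (adj G x y)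
    (λ a s → proj₁ (h y a s) , cong₂ _⊕_ eq (proj₂ (h y a s))) (k y)

  val-+ : ∀ {S S₁ S₂} φ x → (∀ y → x ~ y → y ∈ S → y ∈ S₁ ⊎ y ∈ S₂) →
    (∀ y → x ~ y → y ∈ S₁ → y ∈ S) → (∀ y → x ~ y → y ∈ S₂ → y ∈ S) →
    (∀ y → x ~ y → y ∈ S₁ → y ∈ S₂ → ⊥) → val S φ x ≡ val S₁ φ x +ᵛ val S₂ φ x
  val-+ {S} {S₁} {S₂} φ x h k₁ k₂ dis =
    trans (Σᵛ-cong λ y → term-+ (S y) (S₁ y) (S₂ y) (adj G x y) (h y) (k₁ y) (k₂ y) (dis y))
          (Σᵛ-+ (λ y → term (S₁ y) (adj G x y) (φ x ⊕ φ y)) (λ y → term (S₂ y) (adj G x y) (φ x ⊕ φ y)))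

  -- Values depend on colour differences only, so the translation by `t` disappears and the linear
  -- part commutes with the sum.
  val-act : ∀ S φ g t x → val S (λ y → act g (φ y) ⊕ t) x ≡ actᵛ g (val S φ x)
  val-act S φ g t x = trans
    (Σᵛ-cong λ y → trans (cong (term (S y) (adj G x y)) (trans (⊕-shift (act g (φ x)) (act g (φ y)) t) (≡-sym (act-⊕ g (φ x) (φ y)))))
                         (term-act g (S y) (adj G x y) (φ x ⊕ φ y)))
    (Σᵛ-act g (λ y → term (S y) (adj G x y) (φ x ⊕ φ y)))

  val-none : ∀ {S} φ x → (∀ y → x ~ y → y ∈ S → ⊥) → val S φ x ≡ 0ᵛ
  val-none {S} φ x h = Σᵛ-0 λ y → term-∉ (S y) (adj G x y) (φ x ⊕ φ y) (h y)

  ⟨_⟩ : Fin n → VSet n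
  ⟨ v ⟩ = [[ v ≟_ ]]

  ∈⟨⟩ : ∀ v → v ∈ ⟨ v ⟩
  ∈⟨⟩ v = ∈-intro (v ≟_) refl

  ⟨⟩-≡ : ∀ {v x} → x ∈ ⟨ v ⟩ → v ≡ x
  ⟨⟩-≡ {v} = ∈-elim (v ≟_)

  val-⟨⟩ : ∀ {v} φ x → x ~ v → val ⟨ v ⟩ φ x ≡ edge (φ x ⊕ φ v)
  val-⟨⟩ {v} φ x x~v = trans
    (Σᵛ-single v (λ y y≢v → term-∉ (does (v ≟ y)) (adj G x y) (φ x ⊕ φ y) (λ _ s → y≢v (≡-sym (⟨⟩-≡ {v} s)))))
    (term-in (does (v ≟ v)) (adj G x v) (φ x ⊕ φ v) (∈⟨⟩ v) x~v)
    where
    term-in : ∀ s a d → T s → T a → term s a d ≡ edge d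
    term-in true true d _ _ = refl

  link-source : ∀ {S u v} → Link S u v → u ∈ S
  link-target : ∀ {S u v} → Link S u v → v ∈ S
  link-≢ : ∀ {S u v} → Link S u v → u ≢ v
  chain-source : ∀ {S u v} → Chain S u v → u ∈ S
  chain-target : ∀ {S u v} → Chain S u v → v ∈ S
  chain-≢ : ∀ {S u v} → Chain S u v → u ≢ v
  root-∈ : ∀ {S u} → Rooted S u → u ∈ S

  root-∈ (leaf u∈ _) = u∈
  root-∈ (grow c)    = chain-source c

  link-source (bridge l r b)   = Bridge.⊆₁ b _ (root-∈ l)
  link-source (face e c u~v g) = Glue.⊆₁ g _ (link-source e)
  link-target (bridge l r b)   = Bridge.⊆₂ b _ (root-∈ r)
  link-target (face e c u~v g) = Glue.⊆₂ g _ (chain-target c)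
  link-≢ (bridge l r b)   = ~⇒≢ (Bridge.joined b)
  link-≢ (face e c u~v g) = ~⇒≢ u~v
  chain-source (one e)      = link-source e
  chain-source (cons e c g) = Glue.⊆₁ g _ (link-source e)
  chain-target (one e)      = link-target e
  chain-target (cons e c g) = Glue.⊆₂ g _ (chain-target c)
  chain-≢ (one e) = link-≢ e
  chain-≢ (cons {S₂ = S₂} e c g) u≡v = link-≢ e (Glue.meet g (link-source e) (subst (_∈ S₂) (≡-sym u≡v) (chain-target c)))

  link-~ : ∀ {S u v} → Link S u v → u ~ v
  link-~ (bridge l r b)   = Bridge.joined b
  link-~ (face e c u~v g) = u~v

  module BridgeVal {S S₁ S₂ u v} (b : Bridge S S₁ S₂ u v) (u∈ : u ∈ S₁) (v∈ : v ∈ S₂) (φ : Colours) where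
    open Bridge b

    val₁ : ∀ {x} → x ∈ S₁ → x ≢ u → val S φ x ≡ val S₁ φ x
    val₁ {x} x∈ x≢u = val-cong φ φ x refl
      (λ y x~y y∈ → [ (λ y∈₁ → y∈₁) , (λ y∈₂ → ⊥-elim (x≢u (proj₁ (cross x∈ y∈₂ x~y)))) ] (cover y∈) , refl)
      (λ y _ → ⊆₁ y)

    val₂ : ∀ {x} → x ∈ S₂ → x ≢ v → val S φ x ≡ val S₂ φ x
    val₂ {x} x∈ x≢v = val-cong φ φ x refl
      (λ y x~y y∈ → [ (λ y∈₁ → ⊥-elim (x≢v (proj₂ (cross y∈₁ x∈ (~-sym x~y))))) , (λ y∈₂ → y∈₂) ] (cover y∈) , refl)
      (λ y _ → ⊆₂ y)

    val-u : val S φ u ≡ val S₁ φ u +ᵛ edge (φ u ⊕ φ v)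
    val-u = trans (val-+ φ u
      (λ y u~y y∈ → [ inj₁ , (λ y∈₂ → inj₂ (subst (_∈ ⟨ v ⟩) (≡-sym (proj₂ (cross u∈ y∈₂ u~y))) (∈⟨⟩ v))) ] (cover y∈))
      (λ y _ → ⊆₁ y) (λ y _ y∈ → subst (_∈ S) (⟨⟩-≡ y∈) (⊆₂ v v∈))
      (λ y _ y∈₁ y∈ → disjoint y∈₁ (subst (_∈ S₂) (⟨⟩-≡ y∈) v∈)))
      (cong (val S₁ φ u +ᵛ_) (val-⟨⟩ φ u joined))

    val-v : val S φ v ≡ val S₂ φ v +ᵛ edge (φ v ⊕ φ u)
    val-v = trans (val-+ φ v
      (λ y v~y y∈ → [ (λ y∈₁ → inj₂ (subst (_∈ ⟨ u ⟩) (≡-sym (proj₁ (cross y∈₁ v∈ (~-sym v~y)))) (∈⟨⟩ u))) , inj₁ ] (cover y∈))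
      (λ y _ → ⊆₂ y) (λ y _ y∈ → subst (_∈ S) (⟨⟩-≡ y∈) (⊆₁ u u∈))
      (λ y _ y∈₂ y∈ → disjoint (subst (_∈ S₁) (⟨⟩-≡ y∈) u∈) y∈₂))
      (cong (val S₂ φ v +ᵛ_) (val-⟨⟩ φ v (~-sym joined)))

  module GlueVal {X S S₁ S₂ w} (g : Glue X S S₁ S₂ w) (w∈₁ : w ∈ S₁) (w∈₂ : w ∈ S₂) (φ : Colours) where
    open Glue g

    val₁ : ∀ {x} → x ∈ S₁ → x ≢ w → (∀ y → ¬ X x y) → val S φ x ≡ val S₁ φ x
    val₁ {x} x∈ x≢w none = val-cong φ φ x refl
      (λ y x~y y∈ → [ (λ y∈₁ → y∈₁) , inside y x~y ] (cover y∈) , refl)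
      (λ y _ → ⊆₁ y)
      where
      inside : ∀ y → x ~ y → y ∈ S₂ → y ∈ S₁
      inside y x~y y∈₂ with y ≟ w
      ... | yes refl = w∈₁
      ... | no y≢w = ⊥-elim (none y (cross x∈ y∈₂ x≢w y≢w x~y))

    val₂ : ∀ {x} → x ∈ S₂ → x ≢ w → (∀ y → ¬ X y x) → val S φ x ≡ val S₂ φ x
    val₂ {x} x∈ x≢w none = val-cong φ φ x refl
      (λ y x~y y∈ → [ inside y x~y , (λ y∈₂ → y∈₂) ] (cover y∈) , refl)
      (λ y _ → ⊆₂ y)
      where
      inside : ∀ y → x ~ y → y ∈ S₁ → y ∈ S₂
      inside y x~y y∈₁ with y ≟ w
      ... | yes refl = w∈₂
      ... | no y≢w = ⊥-elim (none y (cross y∈₁ x∈ y≢w x≢w (~-sym x~y)))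

    val-w : val S φ w ≡ val S₁ φ w +ᵛ val S₂ φ w
    val-w = val-+ φ w (λ y _ → cover) (λ y _ → ⊆₁ y) (λ y _ → ⊆₂ y)
      (λ y w~y y∈₁ y∈₂ → ~⇒≢ w~y (≡-sym (meet y∈₁ y∈₂)))

  module FaceVal {S S₁ S₂ u w v} (g : Glue (Only u v) S S₁ S₂ w) (u~v : u ~ v)
    (u∈ : u ∈ S₁) (w∈₁ : w ∈ S₁) (w∈₂ : w ∈ S₂) (v∈ : v ∈ S₂) (u≢w : u ≢ w) (w≢v : w ≢ v) (φ : Colours) where
    open Glue g
    open GlueVal g w∈₁ w∈₂ φ public using (val-w)

    v∉₁ : v ∉ S₁
    v∉₁ v∈₁ = w≢v (≡-sym (meet v∈₁ v∈))

    u∉₂ : u ∉ S₂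
    u∉₂ u∈₂ = u≢w (meet u∈ u∈₂)

    val₁ : ∀ {x} → x ∈ S₁ → x ≢ u → x ≢ w → val S φ x ≡ val S₁ φ x
    val₁ x∈ x≢u x≢w = GlueVal.val₁ g w∈₁ w∈₂ φ x∈ x≢w (λ _ → x≢u ∘ proj₁)

    val₂ : ∀ {x} → x ∈ S₂ → x ≢ w → x ≢ v → val S φ x ≡ val S₂ φ x
    val₂ x∈ x≢w x≢v = GlueVal.val₂ g w∈₁ w∈₂ φ x∈ x≢w (λ _ → x≢v ∘ proj₂)

    val-u : val S φ u ≡ val S₁ φ u +ᵛ edge (φ u ⊕ φ v)
    val-u = trans (val-+ φ u
      (λ y u~y y∈ → [ inj₁ , split y u~y ] (cover y∈))
      (λ y _ → ⊆₁ y) (λ y _ y∈ → subst (_∈ S) (⟨⟩-≡ y∈) (⊆₂ v v∈))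
      (λ y _ y∈₁ y∈ → v∉₁ (subst (_∈ S₁) (≡-sym (⟨⟩-≡ y∈)) y∈₁)))
      (cong (val S₁ φ u +ᵛ_) (val-⟨⟩ φ u u~v))
      where
      split : ∀ y → u ~ y → y ∈ S₂ → y ∈ S₁ ⊎ y ∈ ⟨ v ⟩
      split y u~y y∈₂ with y ≟ w
      ... | yes refl = inj₁ w∈₁
      ... | no y≢w = inj₂ (subst (_∈ ⟨ v ⟩) (≡-sym (proj₂ (cross u∈ y∈₂ u≢w y≢w u~y))) (∈⟨⟩ v))

    val-v : val S φ v ≡ val S₂ φ v +ᵛ edge (φ v ⊕ φ u)
    val-v = trans (val-+ φ v
      (λ y v~y y∈ → [ split y v~y , inj₁ ] (cover y∈))
      (λ y _ → ⊆₂ y) (λ y _ y∈ → subst (_∈ S) (⟨⟩-≡ y∈) (⊆₁ u u∈))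
      (λ y _ y∈₂ y∈ → u∉₂ (subst (_∈ S₂) (≡-sym (⟨⟩-≡ y∈)) y∈₂)))
      (cong (val S₂ φ v +ᵛ_) (val-⟨⟩ φ v (~-sym u~v)))
      where
      split : ∀ y → v ~ y → y ∈ S₁ → y ∈ S₂ ⊎ y ∈ ⟨ u ⟩
      split y v~y y∈₁ with y ≟ w
      ... | yes refl = inj₁ w∈₂
      ... | no y≢w = inj₂ (subst (_∈ ⟨ u ⟩) (≡-sym (proj₁ (cross y∈₁ v∈ y≢w (w≢v ∘ ≡-sym) (~-sym v~y)))) (∈⟨⟩ u))

-- The finite check

-- The colour difference of the two ends of a piece and the values at these ends.
State : Set
State = Colour × V × V

_≟ˢ_ : DecidableEquality State
_≟ˢ_ = ≡-dec _≟_ (≡-dec _≟ᵛ_ _≟ᵛ_)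

-- Tag 5 marks cacti of pentagons, tag k ∈ {1,…,4} paths of k edges with such
-- cacti attached, and tag 0 everything else.
Tag : Set
Tag = Fin 6

Type : Set
Type = Tag × List State

ty : Tag → Bool → Bool → List (Colour × Colour × Colour) → Type
ty s p q l = s , map (λ (d , a , b) → d , (a , p) , (b , q)) l

-- Each entry of the next two tables lists states, up to automorphism, that are realised by
-- every piece of one kind; the tables were found by computer search.  In ty s p q l, the
-- booleans p and q are the degree parities of the two ends.
linkTypes : List Type
linkTypes =
    ty 1F true true ((1F , 1F , 1F) ∷ [])
  ∷ ty 5F false false ((1F , 0F , 0F) ∷ (1F , 0F , 2F) ∷ (1F , 2F , 0F) ∷ [])
  ∷ ty 0F false false ((1F , 0F , 2F) ∷ (1F , 1F , 2F) ∷ [])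
  ∷ ty 0F false false ((1F , 1F , 2F) ∷ (1F , 2F , 1F) ∷ [])
  ∷ ty 0F false false ((1F , 2F , 0F) ∷ (1F , 2F , 1F) ∷ [])
  ∷ ty 0F false false ((1F , 2F , 2F) ∷ [])
  ∷ ty 0F false false ((1F , 2F , 3F) ∷ [])
  ∷ ty 0F false true ((1F , 0F , 2F) ∷ (1F , 1F , 2F) ∷ [])
  ∷ ty 0F false true ((1F , 0F , 1F) ∷ (1F , 2F , 1F) ∷ [])
  ∷ ty 0F false true ((1F , 2F , 0F) ∷ (1F , 2F , 2F) ∷ [])
  ∷ ty 0F false true ((1F , 2F , 0F) ∷ (1F , 2F , 3F) ∷ [])
  ∷ ty 0F false true ((1F , 2F , 1F) ∷ (1F , 2F , 3F) ∷ [])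
  ∷ ty 0F true false ((1F , 1F , 0F) ∷ (1F , 1F , 2F) ∷ [])
  ∷ ty 0F true false ((1F , 2F , 0F) ∷ (1F , 2F , 1F) ∷ [])
  ∷ ty 0F true false ((1F , 0F , 2F) ∷ (1F , 2F , 2F) ∷ [])
  ∷ ty 0F true false ((1F , 0F , 2F) ∷ (1F , 2F , 3F) ∷ [])
  ∷ ty 0F true false ((1F , 1F , 2F) ∷ (1F , 2F , 3F) ∷ [])
  ∷ ty 0F true true ((1F , 1F , 2F) ∷ [])
  ∷ ty 0F true true ((1F , 0F , 2F) ∷ (1F , 2F , 0F) ∷ [])
  ∷ ty 0F true true ((1F , 2F , 1F) ∷ [])
  ∷ ty 0F true true ((1F , 0F , 0F) ∷ (1F , 2F , 2F) ∷ [])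
  ∷ ty 0F true true ((1F , 0F , 0F) ∷ (1F , 2F , 3F) ∷ [])
  ∷ []

chainTypes : List Type
chainTypes =
    ty 1F true true ((1F , 1F , 1F) ∷ [])
  ∷ ty 2F true true ((1F , 2F , 3F) ∷ [])
  ∷ ty 3F true true ((0F , 1F , 2F) ∷ (1F , 2F , 2F) ∷ [])
  ∷ ty 4F true true ((0F , 1F , 2F) ∷ (1F , 1F , 1F) ∷ (1F , 1F , 2F) ∷ (1F , 2F , 1F) ∷ [])
  ∷ ty 5F false false ((1F , 0F , 0F) ∷ (1F , 0F , 2F) ∷ (1F , 2F , 0F) ∷ [])
  ∷ ty 0F false false ((1F , 0F , 2F) ∷ (1F , 1F , 2F) ∷ [])
  ∷ ty 0F false false ((1F , 1F , 2F) ∷ (1F , 2F , 1F) ∷ [])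
  ∷ ty 0F false false ((1F , 2F , 0F) ∷ (1F , 2F , 1F) ∷ [])
  ∷ ty 0F false false ((1F , 2F , 2F) ∷ [])
  ∷ ty 0F false false ((1F , 2F , 3F) ∷ [])
  ∷ ty 0F false true ((1F , 0F , 2F) ∷ (1F , 1F , 2F) ∷ [])
  ∷ ty 0F false true ((1F , 2F , 1F) ∷ [])
  ∷ ty 0F false true ((0F , 1F , 2F) ∷ (1F , 2F , 2F) ∷ [])
  ∷ ty 0F false true ((1F , 2F , 0F) ∷ (1F , 2F , 2F) ∷ [])
  ∷ ty 0F false true ((1F , 0F , 2F) ∷ (1F , 2F , 3F) ∷ [])
  ∷ ty 0F false true ((1F , 2F , 0F) ∷ (1F , 2F , 3F) ∷ [])
  ∷ ty 0F true false ((1F , 1F , 0F) ∷ (1F , 1F , 2F) ∷ [])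
  ∷ ty 0F true false ((1F , 0F , 2F) ∷ (1F , 2F , 1F) ∷ [])
  ∷ ty 0F true false ((1F , 2F , 0F) ∷ (1F , 2F , 1F) ∷ [])
  ∷ ty 0F true false ((1F , 0F , 2F) ∷ (1F , 2F , 2F) ∷ [])
  ∷ ty 0F true false ((0F , 1F , 2F) ∷ (1F , 2F , 1F) ∷ (1F , 2F , 2F) ∷ [])
  ∷ ty 0F true false ((1F , 0F , 2F) ∷ (1F , 2F , 3F) ∷ [])
  ∷ ty 0F true false ((1F , 1F , 2F) ∷ (1F , 2F , 3F) ∷ [])
  ∷ ty 0F true false ((0F , 1F , 0F) ∷ (0F , 1F , 1F) ∷ (1F , 2F , 0F) ∷ (1F , 2F , 3F) ∷ [])
  ∷ ty 0F true true ((0F , 1F , 2F) ∷ (1F , 0F , 2F) ∷ [])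
  ∷ ty 0F true true ((1F , 1F , 2F) ∷ [])
  ∷ ty 0F true true ((1F , 0F , 2F) ∷ (1F , 2F , 0F) ∷ [])
  ∷ ty 0F true true ((1F , 2F , 1F) ∷ [])
  ∷ ty 0F true true ((1F , 0F , 0F) ∷ (1F , 2F , 2F) ∷ [])
  ∷ ty 0F true true ((1F , 2F , 0F) ∷ (1F , 2F , 2F) ∷ [])
  ∷ ty 0F true true ((0F , 1F , 1F) ∷ (1F , 2F , 3F) ∷ [])
  ∷ ty 0F true true ((1F , 0F , 0F) ∷ (1F , 2F , 3F) ∷ [])
  ∷ ty 0F true true ((1F , 0F , 2F) ∷ (1F , 2F , 3F) ∷ [])
  ∷ []

-- The only entry without a value of nonzero F₂²-component carries the tag of trees of pentagons, a
-- single vertex included. `root-good` turns this into the dichotomy behind the theorem.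
rootTypes : List (Tag × List V)
rootTypes =
    (5F , (0F , false) ∷ [])
  ∷ (0F , (1F , false) ∷ [])
  ∷ (0F , (1F , true) ∷ [])
  ∷ []

-- A bridge between two trees of pentagons is a path of one edge, series composition lengthens such
-- paths, and a face made of one such edge, a path of three and the closing edge has five sides.
seriesTag faceTag bridgeTag : Tag → Tag → Tag

seriesTag 1F 1F = 2F
seriesTag 1F 2F = 3F
seriesTag 1F 3F = 4F
seriesTag 5F 5F = 5F
seriesTag _  _  = 0F

faceTag 1F 3F = 5F
faceTag _  _  = 0F

bridgeTag 5F 5F = 1F
bridgeTag _  _  = 0F

rootTag : Tag → Tag
rootTag 5F = 5F
rootTag _  = 0F

-- The automorphisms `g` and `h` are independent, since a translation aligns the two colourings at
-- the joint. The joint becomes an inner vertex, so the sum of its two values must not vanish.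
Series : List State → List State → State → Set
Series e c (d , a , b) =
  Any (λ (d₁ , a₁ , b₁) → ∃[ g ] (a ≡ actᵛ g a₁ ×
    Any (λ (d₂ , a₂ , b₂) → ∃[ h ] (b ≡ actᵛ h b₂ ×
      d ≡ act g d₁ ⊕ act h d₂ × actᵛ g b₁ +ᵛ actᵛ h a₂ ≢ 0ᵛ)) c)) e

series? : ∀ e c t → Dec (Series e c t)
series? e c (d , a , b) =
  anyₗ? (λ (d₁ , a₁ , b₁) → any? λ g → (a ≟ᵛ actᵛ g a₁) ×-dec
    anyₗ? (λ (d₂ , a₂ , b₂) → any? λ h → (b ≟ᵛ actᵛ h b₂) ×-dec
      (d ≟ act g d₁ ⊕ act h d₂) ×-dec ¬? (actᵛ g b₁ +ᵛ actᵛ h a₂ ≟ᵛ 0ᵛ)) c) e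

-- The closing edge contributes `edge d` at both ends. In characteristic two the state before
-- closing is obtained by adding the same vector again.
Face : List State → List State → State → Set
Face e c (d , a , b) = d ≢ 0F × Series e c (d , a +ᵛ edge d , b +ᵛ edge d)

face? : ∀ e c t → Dec (Face e c t)
face? e c (d , a , b) = ¬? (d ≟ 0F) ×-dec series? e c (d , a +ᵛ edge d , b +ᵛ edge d)

Bridged : List V → List V → State → Set
Bridged l r (d , a , b) = d ≢ 0F ×
  Any (λ a₁ → ∃[ g ] a +ᵛ edge d ≡ actᵛ g a₁) l × Any (λ b₁ → ∃[ h ] b +ᵛ edge d ≡ actᵛ h b₁) r

bridged? : ∀ l r t → Dec (Bridged l r t)
bridged? l r (d , a , b) = ¬? (d ≟ 0F) ×-dec
  anyₗ? (λ a₁ → any? λ g → a +ᵛ edge d ≟ᵛ actᵛ g a₁) l ×-dec anyₗ? (λ b₁ → any? λ h → b +ᵛ edge d ≟ᵛ actᵛ h b₁) r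

-- The far end of the chain stops being an end, so from now on its value must be nonzero.
Grown : List State → V → Set
Grown c a = Any (λ (_ , a₁ , b₁) → b₁ ≢ 0ᵛ × ∃[ g ] a ≡ actᵛ g a₁) c

grown? : ∀ c a → Dec (Grown c a)
grown? c a = anyₗ? (λ (_ , a₁ , b₁) → ¬? (b₁ ≟ᵛ 0ᵛ) ×-dec any? λ g → a ≟ᵛ actᵛ g a₁) c

Has : {A : Set} → List (Tag × List A) → Tag → (A → Set) → Set
Has types s P = Any (λ (s' , l) → s' ≡ s × All P l) types

has? : {A : Set} (types : List (Tag × List A)) (s : Tag) {P : A → Set} → (∀ t → Dec (P t)) → Dec (Has types s P)
has? types s P? = anyₗ? (λ (s' , l) → (s' ≟ s) ×-dec allₗ? P? l) types

abstract
  -- For every pair of entries, one entry of the predicted tag has all its states obtainable from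
  -- states of the two. With the closure facts that follow, induction over the decomposition never
  -- leaves the tables.
  series-closed : All (λ (s , e) → All (λ (s' , c) → Has chainTypes (seriesTag s s') (Series e c)) chainTypes) linkTypes
  series-closed = from-yes (allₗ? (λ (s , e) → allₗ? (λ (s' , c) → has? chainTypes (seriesTag s s') (series? e c)) chainTypes) linkTypes)

  face-closed : All (λ (s , e) → All (λ (s' , c) → Has linkTypes (faceTag s s') (Face e c)) chainTypes) linkTypes
  face-closed = from-yes (allₗ? (λ (s , e) → allₗ? (λ (s' , c) → has? linkTypes (faceTag s s') (face? e c)) chainTypes) linkTypes)

  -- A type may be weakened to a sublist, since it only promises states. For instance the link entry
  -- with `(1F , 0F , 1F)` and `(1F , 2F , 1F)` continues as the chain entry with `(1F , 2F , 1F)`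
  -- alone.
  one-closed : All (λ (s , e) → Has chainTypes s (λ t → Any (t ≡_) e)) linkTypes
  one-closed = from-yes (allₗ? (λ (s , e) → has? chainTypes s (λ t → anyₗ? (t ≟ˢ_) e)) linkTypes)

  bridge-closed : All (λ (s , l) → All (λ (s' , r) → Has linkTypes (bridgeTag s s') (Bridged l r)) rootTypes) rootTypes
  bridge-closed = from-yes (allₗ? (λ (s , l) → allₗ? (λ (s' , r) → has? linkTypes (bridgeTag s s') (bridged? l r)) rootTypes) rootTypes)

  grow-closed : All (λ (s , c) → Has rootTypes (rootTag s) (Grown c)) chainTypes
  grow-closed = from-yes (allₗ? (λ (s , c) → has? rootTypes (rootTag s) (grown? c)) chainTypes)

  root-good : All (λ (s , l) → s ≡ 5F ⊎ Any (λ a → proj₁ a ≢ 0F) l) rootTypes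
  root-good = from-yes (allₗ? (λ (s , l) → (s ≟ 5F) ⊎-dec anyₗ? (λ a → ¬? (proj₁ a ≟ 0F)) l) rootTypes)

-- Composition of colourings

module Realisations {n : ℕ} (G : Graph n) where

  open Values G public

  ProperOn : VSet n → Colours → Set
  ProperOn S φ = ∀ {x y} → x ∈ S → y ∈ S → x ~ y → φ x ≢ φ y

  -- A colouring that may violate the odd condition at the two ends only.
  record Real (S : VSet n) (u v : Fin n) (t : State) : Set where
    field
      φ      : Colours
      proper : ProperOn S φ
      diff   : φ u ⊕ φ v ≡ proj₁ t
      at-u   : val S φ u ≡ proj₁ (proj₂ t)
      at-v   : val S φ v ≡ proj₂ (proj₂ t)
      inner  : ∀ {x} → x ∈ S → x ≢ u → x ≢ v → val S φ x ≢ 0ᵛ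

  record RootReal (S : VSet n) (u : Fin n) (a : V) : Set where
    field
      φ      : Colours
      proper : ProperOn S φ
      at-u   : val S φ u ≡ a
      inner  : ∀ {x} → x ∈ S → x ≢ u → val S φ x ≢ 0ᵛ

  -- The affine map of F₂² with linear part `act g` that sends the colour of `w` to `c`.
  move : Fin 6 → Colour → Colours → Fin n → Colours
  move g c φ w x = act g (φ x) ⊕ (act g (φ w) ⊕ c)

  module Move (g : Fin 6) (c : Colour) (φ : Colours) (w : Fin n) where

    move-base : move g c φ w w ≡ c
    move-base = ⊕-cancelˡ (act g (φ w)) c

    move-diff : ∀ x y → move g c φ w x ⊕ move g c φ w y ≡ act g (φ x ⊕ φ y)
    move-diff x y = trans (⊕-shift (act g (φ x)) (act g (φ y)) (act g (φ w) ⊕ c)) (≡-sym (act-⊕ g (φ x) (φ y)))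

    move-val : ∀ S x → val S (move g c φ w) x ≡ actᵛ g (val S φ x)
    move-val S x = val-act S φ g (act g (φ w) ⊕ c) x

    move-inner : ∀ {S x} → val S φ x ≢ 0ᵛ → val S (move g c φ w) x ≢ 0ᵛ
    move-inner {S} {x} ne eq = actᵛ-≢0 g (val S φ x) ne (trans (≡-sym (move-val S x)) eq)

    move-proper : ∀ {S} → ProperOn S φ → ProperOn S (move g c φ w)
    move-proper p {x} {y} x∈ y∈ x~y eq = p x∈ y∈ x~y (act-injective g (φ x) (φ y)
      (⊕≡0⇒≡ (act g (φ x)) (act g (φ y)) (trans (≡-sym (act-⊕ g (φ x) (φ y)))
        (trans (≡-sym (move-diff x y)) (trans (cong (_⊕ move g c φ w y) eq) (⊕-self (move g c φ w y)))))))

  moveReal : ∀ {S u v d a b} → Real S u v (d , a , b) → ∀ g w c →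
    ∃[ r ] Real.φ {S} {u} {v} {act g d , actᵛ g a , actᵛ g b} r w ≡ c
  moveReal {S} {u} {v} r g w c = record
      { φ      = move g c φ w
      ; proper = move-proper {S} proper
      ; diff   = trans (move-diff u v) (cong (act g) diff)
      ; at-u   = trans (move-val S u) (cong (actᵛ g) at-u)
      ; at-v   = trans (move-val S v) (cong (actᵛ g) at-v)
      ; inner  = λ x∈ x≢u x≢v → move-inner (inner x∈ x≢u x≢v)
      } , move-base
    where
    open Real r
    open Move g c φ w

  moveRoot : ∀ {S u a} → RootReal S u a → ∀ g c → ∃[ r ] RootReal.φ {S} {u} {actᵛ g a} r u ≡ c
  moveRoot {S} {u} r g c = record
      { φ      = move g c φ u
      ; proper = move-proper {S} proper
      ; at-u   = trans (move-val S u) (cong (actᵛ g) at-u)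
      ; inner  = λ x∈ x≢u → move-inner (inner x∈ x≢u)
      } , move-base
    where
    open RootReal r
    open Move g c φ u

  merge : VSet n → Colours → Colours → Colours
  merge S₁ φ₁ φ₂ x = if S₁ x then φ₁ x else φ₂ x

  module Merge {S₁ S₂ : VSet n} {φ₁ φ₂ : Colours} (agree : ∀ {x} → x ∈ S₁ → x ∈ S₂ → φ₁ x ≡ φ₂ x) where

    merge₁ : ∀ {x} → x ∈ S₁ → merge S₁ φ₁ φ₂ x ≡ φ₁ x
    merge₁ {x} x∈ with S₁ x
    ... | true = refl

    merge₂ : ∀ {x} → x ∈ S₂ → merge S₁ φ₁ φ₂ x ≡ φ₂ x
    merge₂ {x} x∈ with S₁ x | agree {x}
    ... | true  | eq = eq tt x∈
    ... | false | _  = refl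

    merge-val₁ : ∀ {x} → x ∈ S₁ → val S₁ (merge S₁ φ₁ φ₂) x ≡ val S₁ φ₁ x
    merge-val₁ {x} x∈ = val-cong (merge S₁ φ₁ φ₂) φ₁ x (merge₁ x∈) (λ y _ y∈ → y∈ , merge₁ y∈) (λ y _ y∈ → y∈)

    merge-val₂ : ∀ {x} → x ∈ S₂ → val S₂ (merge S₁ φ₁ φ₂) x ≡ val S₂ φ₂ x
    merge-val₂ {x} x∈ = val-cong (merge S₁ φ₁ φ₂) φ₂ x (merge₂ x∈) (λ y _ y∈ → y∈ , merge₂ y∈) (λ y _ y∈ → y∈)

    merge-proper₁ : ProperOn S₁ φ₁ → ProperOn S₁ (merge S₁ φ₁ φ₂)
    merge-proper₁ p x∈ y∈ x~y eq = p x∈ y∈ x~y (trans (≡-sym (merge₁ x∈)) (trans eq (merge₁ y∈)))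

    merge-proper₂ : ProperOn S₂ φ₂ → ProperOn S₂ (merge S₁ φ₁ φ₂)
    merge-proper₂ p x∈ y∈ x~y eq = p x∈ y∈ x~y (trans (≡-sym (merge₂ x∈)) (trans eq (merge₂ y∈)))

  glue-proper : ∀ {X S S₁ S₂ w} → Glue X S S₁ S₂ w → w ∈ S₁ → w ∈ S₂ → ∀ {φ} → ProperOn S₁ φ → ProperOn S₂ φ →
    (∀ {a b} → X a b → φ a ≢ φ b) → ProperOn S φ
  glue-proper {X} {S} {S₁} {S₂} {w} g w∈₁ w∈₂ {φ} p₁ p₂ pX {x} {y} x∈ y∈ x~y = go (cover x∈) (cover y∈)
    where
    open Glue g
    mixed : ∀ {a b} → a ∈ S₁ → b ∈ S₂ → a ~ b → φ a ≢ φ b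
    mixed {a} {b} a∈ b∈ a~b with a ≟ w | b ≟ w
    ... | yes refl | _        = p₂ w∈₂ b∈ a~b
    ... | no _     | yes refl = p₁ a∈ w∈₁ a~b
    ... | no a≢w   | no b≢w   = pX (cross a∈ b∈ a≢w b≢w a~b)
    go : x ∈ S₁ ⊎ x ∈ S₂ → y ∈ S₁ ⊎ y ∈ S₂ → φ x ≢ φ y
    go (inj₁ a) (inj₁ b) = p₁ a b x~y
    go (inj₁ a) (inj₂ b) = mixed a b x~y
    go (inj₂ a) (inj₁ b) = mixed b a (~-sym x~y) ∘ ≡-sym
    go (inj₂ a) (inj₂ b) = p₂ a b x~y

  module Joint {X S S₁ S₂ u w v d₁ a₁ b₁ d₂ a₂ b₂} (g : Glue X S S₁ S₂ w)
    (u∈ : u ∈ S₁) (w∈₁ : w ∈ S₁) (w∈₂ : w ∈ S₂) (v∈ : v ∈ S₂)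
    (r₁ : Real S₁ u w (d₁ , a₁ , b₁)) (r₂ : Real S₂ w v (d₂ , a₂ , b₂)) (same : Real.φ r₂ w ≡ Real.φ r₁ w) where

    φ₁ = Real.φ r₁
    φ₂ = Real.φ r₂

    φ : Colours
    φ = merge S₁ φ₁ φ₂

    open Merge {S₁} {S₂} {φ₁} {φ₂} (λ x∈₁ x∈₂ → subst (λ z → φ₁ z ≡ φ₂ z) (≡-sym (Glue.meet g x∈₁ x∈₂)) (≡-sym same)) public

    joint-diff : φ u ⊕ φ v ≡ d₁ ⊕ d₂
    joint-diff = begin
      φ u ⊕ φ v                         ≡⟨ cong₂ _⊕_ (merge₁ u∈) (merge₂ v∈) ⟩
      φ₁ u ⊕ φ₂ v                       ≡⟨ cong (φ₁ u ⊕_) (⊕-cancelˡ (φ₁ w) (φ₂ v)) ⟨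
      φ₁ u ⊕ (φ₁ w ⊕ (φ₁ w ⊕ φ₂ v))   ≡⟨ ⊕-assoc (φ₁ u) (φ₁ w) (φ₁ w ⊕ φ₂ v) ⟨
      (φ₁ u ⊕ φ₁ w) ⊕ (φ₁ w ⊕ φ₂ v)   ≡⟨ cong (λ z → (φ₁ u ⊕ φ₁ w) ⊕ (z ⊕ φ₂ v)) same ⟨
      (φ₁ u ⊕ φ₁ w) ⊕ (φ₂ w ⊕ φ₂ v)   ≡⟨ cong₂ _⊕_ (Real.diff r₁) (Real.diff r₂) ⟩
      d₁ ⊕ d₂                           ∎
      where open ≡-Reasoning

    val-u₁ : val S₁ φ u ≡ a₁
    val-u₁ = trans (merge-val₁ u∈) (Real.at-u r₁)

    val-v₂ : val S₂ φ v ≡ b₂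
    val-v₂ = trans (merge-val₂ v∈) (Real.at-v r₂)

    val-joint : val S φ w ≡ b₁ +ᵛ a₂
    val-joint = trans (GlueVal.val-w g w∈₁ w∈₂ φ)
      (cong₂ _+ᵛ_ (trans (merge-val₁ w∈₁) (Real.at-v r₁)) (trans (merge-val₂ w∈₂) (Real.at-u r₂)))

    inner₁ : ∀ {x} → x ∈ S₁ → x ≢ u → x ≢ w → val S₁ φ x ≢ 0ᵛ
    inner₁ x∈ x≢u x≢w eq = Real.inner r₁ x∈ x≢u x≢w (trans (≡-sym (merge-val₁ x∈)) eq)

    inner₂ : ∀ {x} → x ∈ S₂ → x ≢ w → x ≢ v → val S₂ φ x ≢ 0ᵛ
    inner₂ x∈ x≢w x≢v eq = Real.inner r₂ x∈ x≢w x≢v (trans (≡-sym (merge-val₂ x∈)) eq)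

    joint-proper : (∀ {a b} → X a b → φ a ≢ φ b) → ProperOn S φ
    joint-proper = glue-proper g w∈₁ w∈₂ {φ} (merge-proper₁ (Real.proper r₁)) (merge-proper₂ (Real.proper r₂))

  module _ {S S₁ S₂ : VSet n} {u w v : Fin n} {d₁ d₂ : Colour} {a₁ b₁ a₂ b₂ : V}
    (e : Link S₁ u w) (c : Chain S₂ w v)
    (r₁ : Real S₁ u w (d₁ , a₁ , b₁)) (r₂ : Real S₂ w v (d₂ , a₂ , b₂))
    (h₁ h₂ : Fin 6) (joint-≢0 : actᵛ h₁ b₁ +ᵛ actᵛ h₂ a₂ ≢ 0ᵛ) where

    private
      -- The colour `0F` is arbitrary; the second piece is then translated to agree with the first
      -- at `w`.
      r₁' = proj₁ (moveReal r₁ h₁ w 0F)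
      r₂' = moveReal r₂ h₂ w (Real.φ r₁' w)

    series-real : Glue Never S S₁ S₂ w → Real S u v (act h₁ d₁ ⊕ act h₂ d₂ , actᵛ h₁ a₁ , actᵛ h₂ b₂)
    series-real g = record
      { φ      = φ
      ; proper = joint-proper (λ ())
      ; diff   = joint-diff
      ; at-u   = trans (val₁ (link-source e) (link-≢ e) (λ _ ())) val-u₁
      ; at-v   = trans (val₂ (chain-target c) (chain-≢ c ∘ ≡-sym) (λ _ ())) val-v₂
      ; inner  = inside
      }
      where
      open Joint g (link-source e) (link-target e) (chain-source c) (chain-target c) r₁' (proj₁ r₂') (proj₂ r₂')
      open GlueVal g (link-target e) (chain-source c) φ
      inside : ∀ {x} → x ∈ S → x ≢ u → x ≢ v → val S φ x ≢ 0ᵛ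
      inside {x} x∈ x≢u x≢v eq with x ≟ w
      ... | yes refl = joint-≢0 (trans (≡-sym val-joint) eq)
      ... | no x≢w with Glue.cover g x∈
      ...   | inj₁ x∈₁ = inner₁ x∈₁ x≢u x≢w (trans (≡-sym (val₁ x∈₁ x≢w (λ _ ()))) eq)
      ...   | inj₂ x∈₂ = inner₂ x∈₂ x≢w x≢v (trans (≡-sym (val₂ x∈₂ x≢w (λ _ ()))) eq)

    face-real : Glue (Only u v) S S₁ S₂ w → u ~ v → act h₁ d₁ ⊕ act h₂ d₂ ≢ 0F →
      Real S u v (act h₁ d₁ ⊕ act h₂ d₂ , actᵛ h₁ a₁ +ᵛ edge (act h₁ d₁ ⊕ act h₂ d₂) , actᵛ h₂ b₂ +ᵛ edge (act h₁ d₁ ⊕ act h₂ d₂))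
    face-real g u~v d≢0 = record
      { φ      = φ
      ; proper = joint-proper λ { (refl , refl) eq → d≢0 (trans (≡-sym joint-diff) (trans (cong (_⊕ φ v) eq) (⊕-self (φ v)))) }
      ; diff   = joint-diff
      ; at-u   = trans val-u (cong₂ _+ᵛ_ val-u₁ (cong edge joint-diff))
      ; at-v   = trans val-v (cong₂ _+ᵛ_ val-v₂ (cong edge (trans (⊕-comm (φ v) (φ u)) joint-diff)))
      ; inner  = inside
      }
      where
      open Joint g (link-source e) (link-target e) (chain-source c) (chain-target c) r₁' (proj₁ r₂') (proj₂ r₂')
      open FaceVal g u~v (link-source e) (link-target e) (chain-source c) (chain-target c) (link-≢ e) (chain-≢ c) φ
      inside : ∀ {x} → x ∈ S → x ≢ u → x ≢ v → val S φ x ≢ 0ᵛ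
      inside {x} x∈ x≢u x≢v eq with x ≟ w
      ... | yes refl = joint-≢0 (trans (≡-sym val-joint) eq)
      ... | no x≢w with Glue.cover g x∈
      ...   | inj₁ x∈₁ = inner₁ x∈₁ x≢u x≢w (trans (≡-sym (val₁ x∈₁ x≢u x≢w)) eq)
      ...   | inj₂ x∈₂ = inner₂ x∈₂ x≢w x≢v (trans (≡-sym (val₂ x∈₂ x≢w x≢v)) eq)

  -- The parts are disjoint, so the colours of both ends are free: `0F` at `u` and `d` at `v` give
  -- the prescribed difference.
  bridge-real : ∀ {S S₁ S₂ u v a b} → Rooted S₁ u → Rooted S₂ v → Bridge S S₁ S₂ u v →
    RootReal S₁ u a → RootReal S₂ v b → ∀ h₁ h₂ d → d ≢ 0F →
    Real S u v (d , actᵛ h₁ a +ᵛ edge d , actᵛ h₂ b +ᵛ edge d)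
  bridge-real {S} {S₁} {S₂} {u} {v} l r β ρ₁ ρ₂ h₁ h₂ d d≢0 with moveRoot ρ₁ h₁ 0F | moveRoot ρ₂ h₂ d
  ... | ρ₁' , base₁ | ρ₂' , base₂ = record
    { φ      = φ
    ; proper = λ x∈ y∈ x~y → prop (cover x∈) (cover y∈) x~y
    ; diff   = diff
    ; at-u   = trans val-u (cong₂ _+ᵛ_ (trans (merge-val₁ (root-∈ l)) (RootReal.at-u ρ₁')) (cong edge diff))
    ; at-v   = trans val-v (cong₂ _+ᵛ_ (trans (merge-val₂ (root-∈ r)) (RootReal.at-u ρ₂'))
                 (cong edge (trans (⊕-comm (φ v) (φ u)) diff)))
    ; inner  = λ x∈ → inside (cover x∈)
    }
    where
    open Bridge β
    φ : Colours
    φ = merge S₁ (RootReal.φ ρ₁') (RootReal.φ ρ₂')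
    open Merge {S₁} {S₂} {RootReal.φ ρ₁'} {RootReal.φ ρ₂'} (λ x∈₁ x∈₂ → ⊥-elim (disjoint x∈₁ x∈₂))
    open BridgeVal β (root-∈ l) (root-∈ r) φ
    diff : φ u ⊕ φ v ≡ d
    diff = cong₂ _⊕_ (trans (merge₁ (root-∈ l)) base₁) (trans (merge₂ (root-∈ r)) base₂)
    mixed : ∀ {x y} → x ∈ S₁ → y ∈ S₂ → x ~ y → φ x ≢ φ y
    mixed x∈ y∈ x~y eq with cross x∈ y∈ x~y
    ... | refl , refl = d≢0 (trans (≡-sym diff) (trans (cong (_⊕ φ v) eq) (⊕-self (φ v))))
    prop : ∀ {x y} → x ∈ S₁ ⊎ x ∈ S₂ → y ∈ S₁ ⊎ y ∈ S₂ → x ~ y → φ x ≢ φ y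
    prop (inj₁ a) (inj₁ b) x~y = merge-proper₁ (RootReal.proper ρ₁') a b x~y
    prop (inj₁ a) (inj₂ b) x~y = mixed a b x~y
    prop (inj₂ a) (inj₁ b) x~y = mixed b a (~-sym x~y) ∘ ≡-sym
    prop (inj₂ a) (inj₂ b) x~y = merge-proper₂ (RootReal.proper ρ₂') a b x~y
    inside : ∀ {x} → x ∈ S₁ ⊎ x ∈ S₂ → x ≢ u → x ≢ v → val S φ x ≢ 0ᵛ
    inside (inj₁ x∈) x≢u x≢v eq = RootReal.inner ρ₁' x∈ x≢u (trans (≡-sym (trans (val₁ x∈ x≢u) (merge-val₁ x∈))) eq)
    inside (inj₂ x∈) x≢u x≢v eq = RootReal.inner ρ₂' x∈ x≢v (trans (≡-sym (trans (val₂ x∈ x≢v) (merge-val₂ x∈))) eq)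

  grow-real : ∀ {S u v d a b} → Real S u v (d , a , b) → b ≢ 0ᵛ → ∀ g → RootReal S u (actᵛ g a)
  grow-real {S} {u} {v} r b≢0 g = proj₁ (moveRoot ρ g 0F)
    where
    ρ : RootReal S u _
    ρ = record { φ = Real.φ r ; proper = Real.proper r ; at-u = Real.at-u r ; inner = inside }
      where
      inside : ∀ {x} → x ∈ S → x ≢ u → val S (Real.φ r) x ≢ 0ᵛ
      inside {x} x∈ x≢u eq with x ≟ v
      ... | yes refl = b≢0 (trans (≡-sym (Real.at-v r)) eq)
      ... | no x≢v   = Real.inner r x∈ x≢u x≢v eq

  leaf-real : ∀ {S u} → (∀ {x} → x ∈ S → x ≡ u) → RootReal S u 0ᵛ
  leaf-real {S} {u} only = record
    { φ      = λ _ → 0F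
    ; proper = λ x∈ y∈ x~y → ⊥-elim (~⇒≢ x~y (trans (only x∈) (≡-sym (only y∈))))
    ; at-u   = val-none (λ _ → 0F) u (λ y u~y y∈ → ~⇒≢ u~y (≡-sym (only y∈)))
    ; inner  = λ x∈ x≢u → ⊥-elim (x≢u (only x∈))
    }

-- Classification of pieces

edge-cancel : ∀ a d → a +ᵛ edge d +ᵛ edge d ≡ a
edge-cancel a d = trans (+ᵛ-assoc a (edge d) (edge d))
  (trans (cong (λ z → a +ᵛ (z , false)) (⊕-self d)) (+ᵛ-identityʳ a))

module Classification {n : ℕ} (G : Graph n) where

  open Realisations G public

  -- The combinatorial meaning of the tags. A side of a pentagon is `Plain` and not just an edge,
  -- because whatever hangs at its vertices is stored in the two parts of a bridge.
  data CactusRooted : ∀ {S u} → Rooted S u → Set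
  data CactusChain  : ∀ {S u v} → Chain S u v → Set
  data Pentagon     : ∀ {S u v} → Link S u v → Set
  data Plain        : ∀ {S u v} → Link S u v → Set
  data PlainPath    : ℕ → ∀ {S u v} → Chain S u v → Set

  data CactusRooted where
    leaf : ∀ {S u} {u∈ : u ∈ S} {only : ∀ {x} → x ∈ S → x ≡ u} → CactusRooted (leaf {S} u∈ only)
    grow : ∀ {S u v} {c : Chain S u v} → CactusChain c → CactusRooted (grow c)

  data CactusChain where
    one  : ∀ {S u v} {e : Link S u v} → Pentagon e → CactusChain (one e)
    cons : ∀ {S S₁ S₂ u w v} {e : Link S₁ u w} {c : Chain S₂ w v} {g : Glue Never S S₁ S₂ w} →
      Pentagon e → CactusChain c → CactusChain (cons e c g)

  data Pentagon where
    pentagon : ∀ {S S₁ S₂ u w v} {e : Link S₁ u w} {c : Chain S₂ w v} {u~v} {g : Glue (Only u v) S S₁ S₂ w} →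
      Plain e → PlainPath 3 c → Pentagon (face e c u~v g)

  data Plain where
    plain : ∀ {S S₁ S₂ u v} {l : Rooted S₁ u} {r : Rooted S₂ v} {b : Bridge S S₁ S₂ u v} →
      CactusRooted l → CactusRooted r → Plain (bridge l r b)

  data PlainPath where
    one  : ∀ {S u v} {e : Link S u v} → Plain e → PlainPath 1 (one e)
    cons : ∀ {k S S₁ S₂ u w v} {e : Link S₁ u w} {c : Chain S₂ w v} {g : Glue Never S S₁ S₂ w} →
      Plain e → PlainPath k c → PlainPath (suc k) (cons e c g)

  LinkTag : Tag → ∀ {S u v} → Link S u v → Set
  LinkTag 0F e = ⊤
  LinkTag 1F e = Plain e
  LinkTag 5F e = Pentagon e
  -- No link is tagged as a path of two to four edges, and `⊥` discards these cases in the tag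
  -- lemmas.
  LinkTag _  e = ⊥

  ChainTag : Tag → ∀ {S u v} → Chain S u v → Set
  ChainTag 0F c = ⊤
  ChainTag 1F c = PlainPath 1 c
  ChainTag 2F c = PlainPath 2 c
  ChainTag 3F c = PlainPath 3 c
  ChainTag 4F c = PlainPath 4 c
  ChainTag 5F c = CactusChain c

  RootTag : Tag → ∀ {S u} → Rooted S u → Set
  RootTag 5F r = CactusRooted r
  RootTag _  r = ⊤

  one-tag : ∀ s {S u v} {e : Link S u v} → LinkTag s e → ChainTag s (one e)
  one-tag 0F t = tt
  one-tag 1F t = one t
  one-tag 5F t = one t

  series-tag : ∀ s s' {S S₁ S₂ u w v} {e : Link S₁ u w} {c : Chain S₂ w v} {g : Glue Never S S₁ S₂ w} →
    LinkTag s e → ChainTag s' c → ChainTag (seriesTag s s') (cons e c g)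
  series-tag 0F _  _ _ = tt
  series-tag 1F 0F _ _ = tt
  series-tag 1F 1F p q = cons p q
  series-tag 1F 2F p q = cons p q
  series-tag 1F 3F p q = cons p q
  series-tag 1F 4F _ _ = tt
  series-tag 1F 5F _ _ = tt
  series-tag 5F 0F _ _ = tt
  series-tag 5F 1F _ _ = tt
  series-tag 5F 2F _ _ = tt
  series-tag 5F 3F _ _ = tt
  series-tag 5F 4F _ _ = tt
  series-tag 5F 5F p q = cons p q

  face-tag : ∀ s s' {S S₁ S₂ u w v} {e : Link S₁ u w} {c : Chain S₂ w v} {u~v} {g : Glue (Only u v) S S₁ S₂ w} →
    LinkTag s e → ChainTag s' c → LinkTag (faceTag s s') (face e c u~v g)
  face-tag 0F _  _ _ = tt
  face-tag 1F 0F _ _ = tt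
  face-tag 1F 1F _ _ = tt
  face-tag 1F 2F _ _ = tt
  face-tag 1F 3F p q = pentagon p q
  face-tag 1F 4F _ _ = tt
  face-tag 1F 5F _ _ = tt
  face-tag 5F _  _ _ = tt

  bridge-tag : ∀ s s' {S S₁ S₂ u v} {l : Rooted S₁ u} {r : Rooted S₂ v} {b : Bridge S S₁ S₂ u v} →
    RootTag s l → RootTag s' r → LinkTag (bridgeTag s s') (bridge l r b)
  bridge-tag 0F _  _ _ = tt
  bridge-tag 1F _  _ _ = tt
  bridge-tag 2F _  _ _ = tt
  bridge-tag 3F _  _ _ = tt
  bridge-tag 4F _  _ _ = tt
  bridge-tag 5F 0F _ _ = tt
  bridge-tag 5F 1F _ _ = tt
  bridge-tag 5F 2F _ _ = tt
  bridge-tag 5F 3F _ _ = tt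
  bridge-tag 5F 4F _ _ = tt
  bridge-tag 5F 5F p q = plain p q

  grow-tag : ∀ s {S u v} {c : Chain S u v} → ChainTag s c → RootTag (rootTag s) (grow c)
  grow-tag 0F _ = tt
  grow-tag 1F _ = tt
  grow-tag 2F _ = tt
  grow-tag 3F _ = tt
  grow-tag 4F _ = tt
  grow-tag 5F p = grow p

  Classified : {A : Set} → List (Tag × List A) → (Tag → Set) → (A → Set) → Set
  Classified types Tagged P = ∃[ s ] ∃[ l ] ((s , l) ∈ₗ types × Tagged s × All P l)

  classified : {A : Set} {types : List (Tag × List A)} {Tagged : Tag → Set} {P Q : A → Set} {s : Tag} →
    Has types s P → Tagged s → (∀ {t} → P t → Q t) → Classified types Tagged Q
  classified has tagged P⇒Q with find has
  ... | (s , l) , s∈ , refl , ps = s , l , s∈ , tagged , All.map P⇒Q ps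

  classifyLink  : ∀ {S u v} (e : Link S u v) → Classified linkTypes (λ s → LinkTag s e) (Real S u v)
  classifyChain : ∀ {S u v} (c : Chain S u v) → Classified chainTypes (λ s → ChainTag s c) (Real S u v)
  classifyRoot  : ∀ {S u} (r : Rooted S u) → Classified rootTypes (λ s → RootTag s r) (RootReal S u)

  classifyRoot (leaf u∈ only) = 5F , _ , here refl , leaf , leaf-real only All.∷ All.[]
  classifyRoot {S} {u} (grow c) with classifyChain c
  ... | s , l , s∈ , tag , reals =
    classified {Tagged = λ s → RootTag s (grow c)} (All.lookup grow-closed s∈) (grow-tag s tag) real
    where
    real : ∀ {a} → Grown l a → RootReal S u a
    real grown with find grown
    ... | _ , t∈ , b≢0 , g , refl = grow-real (All.lookup reals t∈) b≢0 g

  classifyChain {S} {u} {v} (one e) with classifyLink e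
  ... | s , l , s∈ , tag , reals =
    classified {Tagged = λ s → ChainTag s (one e)} (All.lookup one-closed s∈) (one-tag s tag) (All.lookup reals)
  classifyChain {S} {u} {v} (cons e c g) with classifyLink e | classifyChain c
  ... | s , l , s∈ , tag , reals | s' , l' , s'∈ , tag' , reals' =
    classified {Tagged = λ s → ChainTag s (cons e c g)}
      (All.lookup (All.lookup series-closed s∈) s'∈) (series-tag s s' tag tag') real
    where
    real : ∀ {t} → Series l l' t → Real S u v t
    real series with find series
    ... | _ , t₁∈ , h₁ , refl , rest with find rest
    ...   | _ , t₂∈ , h₂ , refl , refl , ne =
      series-real e c (All.lookup reals t₁∈) (All.lookup reals' t₂∈) h₁ h₂ ne g

  classifyLink {S} {u} {v} (bridge l r b) with classifyRoot l | classifyRoot r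
  ... | s , vs , s∈ , tag , reals | s' , vs' , s'∈ , tag' , reals' =
    classified {Tagged = λ s → LinkTag s (bridge l r b)}
      (All.lookup (All.lookup bridge-closed s∈) s'∈) (bridge-tag s s' tag tag') real
    where
    real : ∀ {t} → Bridged vs vs' t → Real S u v t
    real {d , a , a'} (d≢0 , left , right) with find left | find right
    ... | _ , a₁∈ , h₁ , eq₁ | _ , b₁∈ , h₂ , eq₂ =
      subst (Real S u v) (cong (d ,_) (cong₂ _,_ (shift eq₁) (shift eq₂)))
        (bridge-real l r b (All.lookup reals a₁∈) (All.lookup reals' b₁∈) h₁ h₂ d d≢0)
      where
      shift : ∀ {a z} → a +ᵛ edge d ≡ z → z +ᵛ edge d ≡ a
      shift {a} refl = edge-cancel a d
  classifyLink {S} {u} {v} (face e c u~v g) with classifyLink e | classifyChain c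
  ... | s , l , s∈ , tag , reals | s' , l' , s'∈ , tag' , reals' =
    classified {Tagged = λ s → LinkTag s (face e c u~v g)}
      (All.lookup (All.lookup face-closed s∈) s'∈) (face-tag s s' tag tag') real
    where
    real : ∀ {t} → Face l l' t → Real S u v t
    real {d , a , a'} (d≢0 , series) with find series
    ... | _ , t₁∈ , h₁ , eq₁ , rest with find rest
    ...   | _ , t₂∈ , h₂ , eq₂ , refl , ne =
      subst (Real S u v) (cong (d ,_) (cong₂ _,_ (shift eq₁) (shift eq₂)))
        (face-real e c (All.lookup reals t₁∈) (All.lookup reals' t₂∈) h₁ h₂ ne g u~v d≢0)
      where
      shift : ∀ {a z} → a +ᵛ edge d ≡ z → z +ᵛ edge d ≡ a
      shift {a} refl = edge-cancel a d

  cactus-or-real : ∀ {S u} (r : Rooted S u) → CactusRooted r ⊎ ∃[ a ] (proj₁ a ≢ 0F × RootReal S u a)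
  cactus-or-real {S} {u} r with classifyRoot r
  ... | s , l , s∈ , tag , reals with All.lookup root-good s∈
  ...   | inj₁ refl = inj₁ tag
  ...   | inj₂ good with find good
  ...     | a , a∈ , ne = inj₂ (a , ne , All.lookup reals a∈)

-- Parities, and trees of pentagons

bit : Bool → ℕ
bit b = if b then 1 else 0

bit-injective : ∀ {a b} → bit a ≡ bit b → a ≡ b
bit-injective {true}  {true}  _ = refl
bit-injective {false} {false} _ = refl

suc-%2 : ∀ m b → m % 2 ≡ bit b → suc m % 2 ≡ bit (not b)
suc-%2 zero          false _  = refl
suc-%2 (suc zero)    true  _  = refl
suc-%2 (suc (suc m)) b     eq = suc-%2 m b eq

xor-sum : ∀ {n} → (Fin n → Bool) → Bool
xor-sum {zero}  f = false
xor-sum {suc n} f = f zero xor xor-sum (f ∘ suc)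

does-T : ∀ {b} (d : Dec (T b)) → does d ≡ b
does-T {true}  (yes _) = refl
does-T {true}  (no h)  = ⊥-elim (h tt)
does-T {false} (yes h) = ⊥-elim h
does-T {false} (no _)  = refl

filter-%2 : ∀ {A : Set} {p : A → Bool} {Q : A → Set} (P? : ∀ y → Dec (T (p y))) (Q? : ∀ y → Dec (Q y)) {m} (f : Fin m → A) →
  length (filter P? (filter Q? (tabulate f))) % 2 ≡ bit (xor-sum (λ k → does (Q? (f k)) ∧ p (f k)))
filter-%2 P? Q? {zero} f = refl
filter-%2 {p = p} P? Q? {suc m} f with does (Q? (f zero))
... | false = filter-%2 P? Q? (f ∘ suc)
... | true with does (P? (f zero)) | p (f zero) | does-T (P? (f zero))
...   | false | .false | refl = filter-%2 P? Q? (f ∘ suc)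
...   | true  | .true  | refl = suc-%2 (length (filter P? (filter Q? (tabulate (f ∘ suc))))) _ (filter-%2 P? Q? (f ∘ suc))

-- The linear functional on V that takes (c , true) to [ c = j ] for all nonzero c.
ℓ : Colour → V → Bool
ℓ j (c , p) = not (does (c ≟ 0F) ∨ does (c ≟ j)) xor p

-- For nonzero `j` the elements `0F` and `j` form a subgroup of index two in F₂², so the indicator
-- of its complement is linear; the parity bit is linear as well.
ℓ-+ : ∀ j → j ≢ 0F → ∀ u v → ℓ j (u +ᵛ v) ≡ ℓ j u xor ℓ j v
ℓ-+ = from-yes (all? λ j → ¬? (j ≟ 0F) →-dec allᵛ? λ u → allᵛ? λ v → ℓ j (u +ᵛ v) ≟ᵇ ℓ j u xor ℓ j v)

ℓ-edge : ∀ j → j ≢ 0F → ∀ x y → x ≢ y → ℓ j (edge (x ⊕ y)) ≡ does (y ≟ x ⊕ j)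
ℓ-edge = from-yes (all? λ j → ¬? (j ≟ 0F) →-dec all? λ x → all? λ y → ¬? (x ≟ y) →-dec (ℓ j (edge (x ⊕ y)) ≟ᵇ does (y ≟ x ⊕ j)))

ℓ-0 : ∀ j → ℓ j 0ᵛ ≡ false
ℓ-0 = from-yes (all? λ j → ℓ j 0ᵛ ≟ᵇ false)

ℓ-Σ : ∀ j → j ≢ 0F → ∀ {n} (f : Fin n → V) → ℓ j (Σᵛ f) ≡ xor-sum (ℓ j ∘ f)
ℓ-Σ j j≢0 {zero} f = ℓ-0 j
ℓ-Σ j j≢0 {suc n} f = trans (ℓ-+ j j≢0 (f zero) (Σᵛ (f ∘ suc))) (cong (ℓ j (f zero) xor_) (ℓ-Σ j j≢0 (f ∘ suc)))

-- The three functionals are the basis dual to the vectors `edge j` with `j` nonzero, so a vector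
-- killed by all of them is zero.
ℓ-odd : ∀ v → v ≢ 0ᵛ → ∃[ j ] (j ≢ 0F × ℓ j v ≡ true)
ℓ-odd = from-yes (allᵛ? λ v → ¬? (v ≟ᵛ 0ᵛ) →-dec any? λ j → ¬? (j ≟ 0F) ×-dec (ℓ j v ≟ᵇ true))

-- If all three functionals took the value `true`, the vector would be the sum of the three basis
-- vectors, whose F₂²-component is zero.
ℓ-even : ∀ v → proj₁ v ≢ 0F → ∃[ j ] (j ≢ 0F × ℓ j v ≡ false)
ℓ-even = from-yes (allᵛ? λ v → ¬? (proj₁ v ≟ 0F) →-dec any? λ j → ¬? (j ≟ 0F) ×-dec (ℓ j v ≟ᵇ false))

xor-sum-cong : ∀ {n} {f g : Fin n → Bool} → (∀ x → f x ≡ g x) → xor-sum f ≡ xor-sum g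
xor-sum-cong {zero}  f≗g = refl
xor-sum-cong {suc n} f≗g = cong₂ _xor_ (f≗g zero) (xor-sum-cong (f≗g ∘ suc))

xor-sum-false : ∀ {n} {f : Fin n → Bool} → (∀ x → f x ≡ false) → xor-sum f ≡ false
xor-sum-false {zero}  f≗0 = refl
xor-sum-false {suc n} f≗0 = cong₂ _xor_ (f≗0 zero) (xor-sum-false (f≗0 ∘ suc))

-- The two terms at `c₁` add up to `(c₀ ⊕ c₂ , false)`, so a nonzero value says that the two
-- neighbours have different colours. Hence `c₀`, `c₁`, `c₂`, `c₃` are pairwise distinct, and `c₄`,
-- which differs from `c₀`, `c₂` and `c₃`, must equal `c₁`. So the neighbours of the first vertex
-- have the same colour.
colours-of-pentagon : ∀ c₀ c₁ c₂ c₃ c₄ → c₀ ≢ c₁ → c₁ ≢ c₂ → c₂ ≢ c₃ → c₃ ≢ c₄ → c₄ ≢ c₀ →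
  edge (c₁ ⊕ c₀) +ᵛ edge (c₁ ⊕ c₂) ≢ 0ᵛ → edge (c₂ ⊕ c₁) +ᵛ edge (c₂ ⊕ c₃) ≢ 0ᵛ →
  edge (c₃ ⊕ c₂) +ᵛ edge (c₃ ⊕ c₄) ≢ 0ᵛ → edge (c₄ ⊕ c₃) +ᵛ edge (c₄ ⊕ c₀) ≢ 0ᵛ →
  edge (c₀ ⊕ c₁) +ᵛ edge (c₀ ⊕ c₄) ≡ 0ᵛ
colours-of-pentagon = from-yes (all? λ c₀ → all? λ c₁ → all? λ c₂ → all? λ c₃ → all? λ c₄ →
  ¬? (c₀ ≟ c₁) →-dec ¬? (c₁ ≟ c₂) →-dec ¬? (c₂ ≟ c₃) →-dec ¬? (c₃ ≟ c₄) →-dec ¬? (c₄ ≟ c₀) →-dec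
  ¬? (edge (c₁ ⊕ c₀) +ᵛ edge (c₁ ⊕ c₂) ≟ᵛ 0ᵛ) →-dec ¬? (edge (c₂ ⊕ c₁) +ᵛ edge (c₂ ⊕ c₃) ≟ᵛ 0ᵛ) →-dec
  ¬? (edge (c₃ ⊕ c₂) +ᵛ edge (c₃ ⊕ c₄) ≟ᵛ 0ᵛ) →-dec ¬? (edge (c₄ ⊕ c₃) +ᵛ edge (c₄ ⊕ c₀) ≟ᵛ 0ᵛ) →-dec
  (edge (c₀ ⊕ c₁) +ᵛ edge (c₀ ⊕ c₄) ≟ᵛ 0ᵛ))

module Parity {n : ℕ} (G : Graph n) where

  open Classification G public

  module _ {φ : Colours} (proper : Proper G φ) (x : Fin n) where

    -- The colours other than that of `x` are `φ x ⊕ j` with `j` nonzero, and by `ℓ-edge` the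
    -- functional `ℓ j` counts the neighbours of that colour modulo two.
    colCount-%2 : ∀ j → j ≢ 0F → colCount G φ x (φ x ⊕ j) % 2 ≡ bit (ℓ j (val all φ x))
    colCount-%2 j j≢0 = trans (filter-%2 _ (λ y → φ y ≟ φ x ⊕ j) id)
      (cong bit (trans (xor-sum-cong same) (≡-sym (ℓ-Σ j j≢0 (λ y → term true (adj G x y) (φ x ⊕ φ y))))))
      where
      same : ∀ y → does (φ y ≟ φ x ⊕ j) ∧ adj G x y ≡ ℓ j (term true (adj G x y) (φ x ⊕ φ y))
      same y with adj G x y in eq
      ... | true  = trans (∧-identityʳ _) (≡-sym (ℓ-edge j j≢0 (φ x) (φ y) (proper x y (subst T (≡-sym eq) tt))))
      ... | false = trans (∧-zeroʳ _) (≡-sym (ℓ-0 j))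

    colCount-own : colCount G φ x (φ x) % 2 ≡ 0
    colCount-own = trans (filter-%2 _ (λ y → φ y ≟ φ x) id) (cong bit (xor-sum-false none))
      where
      none : ∀ y → does (φ y ≟ φ x) ∧ adj G x y ≡ false
      none y with φ y ≟ φ x | adj G x y in eq
      ... | yes e | true  = ⊥-elim (proper x y (subst T (≡-sym eq) tt) (≡-sym e))
      ... | yes _ | false = refl
      ... | no _  | _     = refl

    odd⇒val≢0 : OddCond G φ x → val all φ x ≢ 0ᵛ
    odd⇒val≢0 (i , odd) eq with φ x ⊕ i ≟ 0F
    ... | yes e = 0≢1 (trans (≡-sym colCount-own) (trans (cong (λ c → colCount G φ x c % 2) (⊕≡0⇒≡ (φ x) i e)) odd))
      where
      0≢1 : 0 ≢ 1
      0≢1 ()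
    ... | no ne = false≢true (trans (≡-sym (ℓ-0 (φ x ⊕ i))) (trans (cong (ℓ (φ x ⊕ i)) (≡-sym eq)) (bit-injective
        (trans (≡-sym (colCount-%2 (φ x ⊕ i) ne)) (trans (cong (λ c → colCount G φ x c % 2) (⊕-cancelˡ (φ x) i)) odd)))))
      where
      false≢true : false ≢ true
      false≢true ()

    val≢0⇒odd : val all φ x ≢ 0ᵛ → OddCond G φ x
    val≢0⇒odd ne with ℓ-odd (val all φ x) ne
    ... | j , j≢0 , eq = φ x ⊕ j , trans (colCount-%2 j j≢0) (cong bit eq)

    lap≢0⇒even : proj₁ (val all φ x) ≢ 0F → EvenCond G φ x
    lap≢0⇒even ne with ℓ-even (val all φ x) ne
    ... | j , j≢0 , eq = φ x ⊕ j
      , (λ e → j≢0 (trans (≡-sym (⊕-cancelˡ (φ x) j)) (trans (cong (φ x ⊕_) e) (⊕-self (φ x)))))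
      , trans (colCount-%2 j j≢0) (cong bit eq)

  module Vanishing {φ : Colours} (proper : Proper G φ) where

    Inner : VSet n → Fin n → Fin n → Set
    Inner S u v = ∀ {x} → x ∈ S → x ≢ u → x ≢ v → val S φ x ≢ 0ᵛ

    -- By induction the trees hanging at the ends of a plain link contribute nothing there. So a
    -- plain link acts as a single edge and a pentagon with its attachments as a bare pentagon, to
    -- which `colours-of-pentagon` applies.
    rooted-vanishes : ∀ {S u} {r : Rooted S u} → CactusRooted r → (∀ {x} → x ∈ S → x ≢ u → val S φ x ≢ 0ᵛ) → val S φ u ≡ 0ᵛ
    chain-vanishes : ∀ {S u v} {c : Chain S u v} → CactusChain c → (∀ {x} → x ∈ S → x ≢ u → val S φ x ≢ 0ᵛ) → val S φ u ≡ 0ᵛ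
    pentagon-vanishes : ∀ {S u v} {e : Link S u v} → Pentagon e → (∀ {x} → x ∈ S → x ≢ u → val S φ x ≢ 0ᵛ) → val S φ u ≡ 0ᵛ
    plain-source : ∀ {S u v} {e : Link S u v} → Plain e → Inner S u v → val S φ u ≡ edge (φ u ⊕ φ v)
    plain-target : ∀ {S u v} {e : Link S u v} → Plain e → Inner S u v → val S φ v ≡ edge (φ v ⊕ φ u)

    rooted-vanishes {u = u} (leaf {only = only}) _ = val-none φ u (λ y u~y y∈ → ~⇒≢ u~y (≡-sym (only y∈)))
    rooted-vanishes (grow c) h = chain-vanishes c h

    plain-source {u = u} {v} (plain {S₁ = S₁} {l = l} {r} {b} p q) h = trans val-u
        (cong (_+ᵛ edge (φ u ⊕ φ v)) (rooted-vanishes p λ x∈ x≢u eq →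
          h (⊆₁ _ x∈) x≢u (λ { refl → disjoint x∈ (root-∈ r) }) (trans (val₁ x∈ x≢u) eq)))
      where
      open Bridge b
      open BridgeVal b (root-∈ l) (root-∈ r) φ

    plain-target {u = u} {v} (plain {S₁ = S₁} {l = l} {r} {b} p q) h = trans val-v
        (cong (_+ᵛ edge (φ v ⊕ φ u)) (rooted-vanishes q λ x∈ x≢v eq →
          h (⊆₂ _ x∈) (λ { refl → disjoint (root-∈ l) x∈ }) x≢v (trans (val₂ x∈ x≢v) eq)))
      where
      open Bridge b
      open BridgeVal b (root-∈ l) (root-∈ r) φ

    chain-vanishes (one p) h = pentagon-vanishes p h
    chain-vanishes {S} {u} {v} (cons {S₁ = S₁} {S₂} {w = w} {e = e} {c} {g} p q) h =
        trans (val₁ (link-source e) (link-≢ e) (λ _ ())) (pentagon-vanishes p inner₁)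
      where
      open Glue g
      open GlueVal g (link-target e) (chain-source c) φ
      u∉₂ : u ∉ S₂
      u∉₂ u∈₂ = link-≢ e (meet (link-source e) u∈₂)
      inner₂ : ∀ {x} → x ∈ S₂ → x ≢ w → val S₂ φ x ≢ 0ᵛ
      inner₂ x∈ x≢w eq = h (⊆₂ _ x∈) (λ { refl → u∉₂ x∈ }) (trans (val₂ x∈ x≢w (λ _ ())) eq)
      inner₁ : ∀ {x} → x ∈ S₁ → x ≢ u → val S₁ φ x ≢ 0ᵛ
      inner₁ {x} x∈ x≢u eq with x ≟ w
      ... | no x≢w   = h (⊆₁ _ x∈) x≢u (trans (val₁ x∈ x≢w (λ _ ())) eq)
      -- At the joint the rest of the chain contributes zero by induction, so the first pentagon
      -- alone has the nonzero value there.
      ... | yes refl = h (⊆₁ _ x∈) x≢u (trans val-w (cong₂ _+ᵛ_ eq (chain-vanishes q inner₂)))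

    module SeriesInner {S S₁ S₂ u w v} (e : Link S₁ u w) (c : Chain S₂ w v) (g : Glue Never S S₁ S₂ w) (h : Inner S u v) where
      open Glue g
      open GlueVal g (link-target e) (chain-source c) φ

      inner₁ : Inner S₁ u w
      inner₁ x∈ x≢u x≢w eq = h (⊆₁ _ x∈) x≢u (λ { refl → x≢w (meet x∈ (chain-target c)) }) (trans (val₁ x∈ x≢w (λ _ ())) eq)

      inner₂ : Inner S₂ w v
      inner₂ x∈ x≢w x≢v eq = h (⊆₂ _ x∈) (λ { refl → x≢w (meet (link-source e) x∈) }) x≢v (trans (val₂ x∈ x≢w (λ _ ())) eq)

      joint : val S₁ φ w +ᵛ val S₂ φ w ≢ 0ᵛ
      joint eq = h (⊆₁ _ (link-target e)) (link-≢ e ∘ ≡-sym) (chain-≢ c) (trans val-w eq)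

      source-val : val S φ u ≡ val S₁ φ u
      source-val = val₁ (link-source e) (link-≢ e) (λ _ ())

      target-val : val S φ v ≡ val S₂ φ v
      target-val = val₂ (chain-target c) (chain-≢ c ∘ ≡-sym) (λ _ ())

    pentagon-vanishes {S} {u} {v} (pentagon {S₁ = S₁} {S₂} {w = x₁} {e = e₁} {c₁} {u~v} {g}
        p₁ (cons {w = x₂} {e = e₂} {c₂} {g₂} p₂ (cons {w = x₃} {e = e₃} {g = g₃} p₃ (one {e = e₄} p₄)))) h =
        trans val-u (trans (cong (_+ᵛ edge (φ u ⊕ φ v)) (plain-source p₁ inner₁))
          (colours-of-pentagon (φ u) (φ x₁) (φ x₂) (φ x₃) (φ v)
            (proper _ _ (link-~ e₁)) (proper _ _ (link-~ e₂)) (proper _ _ (link-~ e₃)) (proper _ _ (link-~ e₄))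
            (proper _ _ (~-sym u~v))
            (λ eq → h (⊆₁ _ (link-target e₁)) (link-≢ e₁ ∘ ≡-sym)
              (trans val-w (trans (cong₂ _+ᵛ_ (plain-target p₁ inner₁) (trans A.source-val (plain-source p₂ A.inner₁))) eq)))
            (λ eq → A.joint (trans (cong₂ _+ᵛ_ (plain-target p₂ A.inner₁) (trans B.source-val (plain-source p₃ B.inner₁))) eq))
            (λ eq → B.joint (trans (cong₂ _+ᵛ_ (plain-target p₃ B.inner₁) (plain-source p₄ B.inner₂)) eq))
            (λ eq → h (⊆₂ _ (chain-target c₁)) (~⇒≢ u~v ∘ ≡-sym)
              (trans val-v (trans (cong (_+ᵛ edge (φ v ⊕ φ u))
                (trans A.target-val (trans B.target-val (plain-target p₄ B.inner₂)))) eq)))))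
      where
      open Glue g
      open FaceVal g u~v (link-source e₁) (link-target e₁) (chain-source c₁) (chain-target c₁) (link-≢ e₁) (chain-≢ c₁) φ
      inner₁ : Inner S₁ u x₁
      inner₁ x∈ x≢u x≢w eq = h (⊆₁ _ x∈) x≢u (trans (val₁ x∈ x≢u x≢w) eq)
      inner₂ : Inner S₂ x₁ v
      inner₂ x∈ x≢w x≢v eq = h (⊆₂ _ x∈) (λ { refl → u∉₂ x∈ }) (trans (val₂ x∈ x≢w x≢v) eq)
      module A = SeriesInner e₂ c₂ g₂ inner₂
      module B = SeriesInner e₃ (one e₄) g₃ A.inner₂

-- Blocks

infixl 6 _∪_

_∪_ : ∀ {n} → VSet n → VSet n → VSet n
(A ∪ B) x = A x ∨ B x

module _ {n} (A B : VSet n) where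

  ∪₁ : A ⊆ (A ∪ B)
  ∪₁ x x∈ = Equivalence.from T-∨ (inj₁ x∈)

  ∪₂ : B ⊆ (A ∪ B)
  ∪₂ x x∈ = Equivalence.from (T-∨ {A x}) (inj₂ x∈)

  ∪-elim : ∀ {x} → x ∈ (A ∪ B) → x ∈ A ⊎ x ∈ B
  ∪-elim {x} = Equivalence.to (T-∨ {A x})

∖-mono : ∀ {n} {A B : VSet n} → A ⊆ B → ∀ x → (A ∖ x) ⊆ (B ∖ x)
∖-mono {A = A} {B} A⊆B x y y∈ = ∖-intro {S = B} {x} (∖-≢ {S = A} {x} y∈) (A⊆B y (∖-⊆ {S = A} {x} y y∈))

module Blocks {n : ℕ} (G : Graph n) where

  open Parity G public

  -- Ranging over all `x` avoids case distinctions: for `x` outside `S` the condition says that `S`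
  -- is connected.
  Robust : VSet n → Set
  Robust S = ∀ x → ConnectedOn G (S ∖ x)

  robust : ∀ {S} → ConnectedOn G S → NoCutVertex G S → Robust S
  robust {S} conn nocut x with T? (S x)
  ... | yes x∈ = nocut x x∈
  ... | no x∉  = λ a b a∈ b∈ → reach-⊆ (λ y y∈ → ∖-intro {S = S} {x} (λ { refl → x∉ y∈ }) y∈)
                   (conn a b (∖-⊆ {S = S} {x} a a∈) (∖-⊆ {S = S} {x} b b∈))

  carry : ∀ {S} (P : Fin n → Set) → (∀ {a b} → a ∈ S → b ∈ S → a ~ b → P a → P b) →
    ∀ {x y} → Reach G S x y → P x → P y
  carry P preserved (here _) px = px
  carry P preserved (step a∈ a~b p) px = carry P preserved p (preserved a∈ (source p) a~b px)

  spread : ∀ {S} → Robust S → ∀ w (A : VSet n) →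
    (∀ {a b} → a ∈ S → a ≢ w → b ∈ S → b ≢ w → a ~ b → a ∈ A → b ∈ A) →
    ∀ {x y} → x ∈ S → x ≢ w → x ∈ A → y ∈ S → y ≢ w → y ∈ A
  spread {S} rob w A preserved {x} {y} x∈ x≢w x∈A y∈ y≢w = carry (_∈ A)
    (λ {a} {b} a∈ b∈ → preserved (∖-⊆ {S = S} {w} a a∈) (∖-≢ {S = S} a∈ ∘ ≡-sym) (∖-⊆ {S = S} {w} b b∈) (∖-≢ {S = S} b∈ ∘ ≡-sym))
    (rob w x y (∖-intro {S = S} (x≢w ∘ ≡-sym) x∈) (∖-intro {S = S} (y≢w ∘ ≡-sym) y∈)) x∈A

  -- `S` stays connected without `w`, and away from `w` no edge joins the two sides, so one vertex
  -- other than `w` decides the side.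
  one-side : ∀ {S₀ S₁ S₂ w S} → Glue Never S₀ S₁ S₂ w → w ∈ S₁ → Robust S → S ⊆ S₀ →
    ∀ {x} → x ∈ S → x ∈ S₁ → x ≢ w → S ⊆ S₁
  one-side {S₁ = S₁} {w = w} {S} g w∈ rob S⊆ x∈ x∈₁ x≢w y y∈ with y ≟ w
  ... | yes refl = w∈
  ... | no y≢w   = spread rob w S₁ stay x∈ x≢w x∈₁ y∈ y≢w
    where
    open Glue g
    stay : ∀ {a b} → a ∈ S → a ≢ w → b ∈ S → b ≢ w → a ~ b → a ∈ S₁ → b ∈ S₁
    stay a∈ a≢w b∈ b≢w a~b a∈₁ with cover (S⊆ _ b∈)
    ... | inj₁ b∈₁ = b∈₁
    ... | inj₂ b∈₂ = ⊥-elim (cross a∈₁ b∈₂ a≢w b≢w a~b)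

  glue-swap : ∀ {S₀ S₁ S₂ w} → Glue Never S₀ S₁ S₂ w → Glue Never S₀ S₂ S₁ w
  glue-swap g = record
    { ⊆₁ = ⊆₂ ; ⊆₂ = ⊆₁ ; cover = [ inj₂ , inj₁ ] ∘ cover ; meet = flip meet
    ; cross = λ a∈ b∈ a≢ b≢ a~b → cross b∈ a∈ b≢ a≢ (~-sym a~b) }
    where open Glue g

  dichotomy : ∀ {S₀ S₁ S₂ w S} → Glue Never S₀ S₁ S₂ w → w ∈ S₁ → w ∈ S₂ → Robust S → S ⊆ S₀ → S ⊆ S₁ ⊎ S ⊆ S₂
  dichotomy {S₁ = S₁} {S₂} {w} {S} g w∈₁ w∈₂ rob S⊆ with any? (λ x → T? (S x) ×-dec T? (S₁ x) ×-dec ¬? (x ≟ w))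
  ... | yes (x , x∈ , x∈₁ , x≢w) = inj₁ (one-side g w∈₁ rob S⊆ x∈ x∈₁ x≢w)
  ... | no none = inj₂ rest
    where
    rest : S ⊆ S₂
    rest x x∈ with Glue.cover g (S⊆ x x∈) | x ≟ w
    ... | inj₂ x∈₂ | _        = x∈₂
    ... | inj₁ _   | yes refl = w∈₂
    ... | inj₁ x∈₁ | no x≢w   = ⊥-elim (none (x , x∈ , x∈₁ , x≢w))

  -- A side of a face need not contain every robust set that meets it twice, the block of the face
  -- being an example. What survives in both parts of a gluing is that edges of `S₀` leave a piece
  -- only from its two ends.
  Attached : VSet n → VSet n → Fin n → Fin n → Set
  Attached S₀ T a b = ∀ {x y} → x ∈ T → x ≢ a → x ≢ b → y ∈ S₀ → x ~ y → y ∈ T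

  module _ {X : Fin n → Fin n → Set} {S₀ S S₁ S₂ u w v} (g : Glue X S S₁ S₂ w) (X⇒ends : ∀ {a b} → X a b → a ≡ u × b ≡ v)
    (e : Link S₁ u w) (c : Chain S₂ w v) (att : Attached S₀ S u v) where
    open Glue g

    attached₁ : Attached S₀ S₁ u w
    attached₁ {x} {y} x∈ x≢u x≢w y∈ x~y
      with cover (att (⊆₁ x x∈) x≢u (λ { refl → x≢w (meet x∈ (chain-target c)) }) y∈ x~y) | y ≟ w
    ... | inj₁ y∈₁ | _        = y∈₁
    ... | inj₂ _   | yes refl = link-target e
    ... | inj₂ y∈₂ | no y≢w   = ⊥-elim (x≢u (proj₁ (X⇒ends (cross x∈ y∈₂ x≢w y≢w x~y))))

    attached₂ : Attached S₀ S₂ w v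
    attached₂ {x} {y} x∈ x≢w x≢v y∈ x~y
      with cover (att (⊆₂ x x∈) (λ { refl → x≢w (meet (link-source e) x∈) }) x≢v y∈ x~y) | y ≟ w
    ... | inj₂ y∈₂ | _        = y∈₂
    ... | inj₁ _   | yes refl = chain-source c
    ... | inj₁ y∈₁ | no y≢w   = ⊥-elim (x≢v (proj₂ (X⇒ends (cross y∈₁ x∈ y≢w x≢w (~-sym x~y)))))

  -- The end `a` separates the rest of `T₁` from everything else: the bridge starts at `a`, and
  -- edges leaving `T` start at `a` or `b`, where `b` is not in `T₁`. A robust set cannot extend
  -- past such a cut vertex; likewise for `b` and `T₂`.
  module Hanging {S₀ T T₁ T₂ a b} (β : Bridge T T₁ T₂ a b) (a∈ : a ∈ T₁) (b∈ : b ∈ T₂) (att : Attached S₀ T a b)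
    {S} (rob : Robust S) (S⊆ : S ⊆ S₀) where
    open Bridge β

    hang₁ : ∀ {x} → x ∈ S → x ∈ T₁ → x ≢ a → S ⊆ T₁
    hang₁ x∈ x∈₁ x≢a y y∈ with y ≟ a
    ... | yes refl = a∈
    ... | no y≢a   = spread rob a T₁ stay x∈ x≢a x∈₁ y∈ y≢a
      where
      stay : ∀ {p q} → p ∈ S → p ≢ a → q ∈ S → q ≢ a → p ~ q → p ∈ T₁ → q ∈ T₁
      stay p∈ p≢a q∈ q≢a p~q p∈₁ with cover (att (⊆₁ _ p∈₁) p≢a (λ { refl → disjoint p∈₁ b∈ }) (S⊆ _ q∈) p~q)
      ... | inj₁ q∈₁ = q∈₁
      ... | inj₂ q∈₂ = ⊥-elim (p≢a (proj₁ (cross p∈₁ q∈₂ p~q)))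

    hang₂ : ∀ {x} → x ∈ S → x ∈ T₂ → x ≢ b → S ⊆ T₂
    hang₂ x∈ x∈₂ x≢b y y∈ with y ≟ b
    ... | yes refl = b∈
    ... | no y≢b   = spread rob b T₂ stay x∈ x≢b x∈₂ y∈ y≢b
      where
      stay : ∀ {p q} → p ∈ S → p ≢ b → q ∈ S → q ≢ b → p ~ q → p ∈ T₂ → q ∈ T₂
      stay p∈ p≢b q∈ q≢b p~q p∈₂ with cover (att (⊆₂ _ p∈₂) (λ { refl → disjoint a∈ p∈₂ }) p≢b (S⊆ _ q∈) p~q)
      ... | inj₂ q∈₂ = q∈₂
      ... | inj₁ q∈₁ = ⊥-elim (p≢b (proj₂ (cross q∈₁ p∈₂ (~-sym p~q))))

  -- The vertex set of the union of the bounded faces (or of the single edge) of a link,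
  -- respectively of all links of a chain.
  linkB  : ∀ {S u v} → Link S u v → VSet n
  chainB : ∀ {S u v} → Chain S u v → VSet n
  linkB {u = u} {v} (bridge _ _ _) = ⟨ u ⟩ ∪ ⟨ v ⟩
  linkB (face e c _ _) = linkB e ∪ chainB c
  chainB (one e)      = linkB e
  chainB (cons e c _) = linkB e ∪ chainB c

  linkB-source : ∀ {S u v} (e : Link S u v) → u ∈ linkB e
  linkB-source {u = u} {v} (bridge _ _ _) = ∪₁ ⟨ u ⟩ ⟨ v ⟩ u (∈⟨⟩ u)
  linkB-source (face e c _ _) = ∪₁ (linkB e) (chainB c) _ (linkB-source e)

  chainB-source : ∀ {S u v} (c : Chain S u v) → u ∈ chainB c
  chainB-source (one e)      = linkB-source e
  chainB-source (cons e c _) = ∪₁ (linkB e) (chainB c) _ (linkB-source e)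

  linkB-target  : ∀ {S u v} (e : Link S u v) → v ∈ linkB e
  chainB-target : ∀ {S u v} (c : Chain S u v) → v ∈ chainB c
  linkB-target {u = u} {v} (bridge _ _ _) = ∪₂ ⟨ u ⟩ ⟨ v ⟩ v (∈⟨⟩ v)
  linkB-target (face e c _ _) = ∪₂ (linkB e) (chainB c) _ (chainB-target c)
  chainB-target (one e)      = linkB-target e
  chainB-target (cons e c _) = ∪₂ (linkB e) (chainB c) _ (chainB-target c)

  linkB-⊆  : ∀ {S u v} (e : Link S u v) → linkB e ⊆ S
  chainB-⊆ : ∀ {S u v} (c : Chain S u v) → chainB c ⊆ S
  linkB-⊆ {S} {u} {v} e@(bridge _ _ _) x x∈ with ∪-elim ⟨ u ⟩ ⟨ v ⟩ x∈
  ... | inj₁ x∈₁ = subst (_∈ S) (⟨⟩-≡ x∈₁) (link-source e)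
  ... | inj₂ x∈₂ = subst (_∈ S) (⟨⟩-≡ x∈₂) (link-target e)
  linkB-⊆ (face e c _ g) x x∈ with ∪-elim (linkB e) (chainB c) x∈
  ... | inj₁ x∈₁ = Glue.⊆₁ g x (linkB-⊆ e x x∈₁)
  ... | inj₂ x∈₂ = Glue.⊆₂ g x (chainB-⊆ c x x∈₂)
  chainB-⊆ (one e) = linkB-⊆ e
  chainB-⊆ (cons e c g) x x∈ with ∪-elim (linkB e) (chainB c) x∈
  ... | inj₁ x∈₁ = Glue.⊆₁ g x (linkB-⊆ e x x∈₁)
  ... | inj₂ x∈₂ = Glue.⊆₂ g x (chainB-⊆ c x x∈₂)

  -- A chain of several links has cut vertices and is not `Robust`. This is the share of
  -- 2-connectedness that a series keeps, and together with the edge `u v` it becomes `Robust`.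
  Escapes : VSet n → Fin n → Fin n → Set
  Escapes B u v = ∀ x {y} → y ∈ (B ∖ x) → Reach G (B ∖ x) y u ⊎ Reach G (B ∖ x) y v

  escapes⇒robust : ∀ {B u v} → u ~ v → u ∈ B → v ∈ B → Escapes B u v → Robust B
  escapes⇒robust {B} {u} {v} u~v u∈ v∈ esc x with x ≟ u
  ... | yes refl = connected-via v λ y y∈ → [ (λ p → ⊥-elim (∖-≢ {S = B} {x} (target p) refl)) , id ] (esc x y∈)
  ... | no x≢u   = connected-via u λ y y∈ →
    [ id , (λ p → ⟫ p (edge-reach (target p) (∖-intro {S = B} x≢u u∈) (~-sym u~v))) ] (esc x y∈)

  robust⇒escapes : ∀ {B u v} → u ≢ v → u ∈ B → v ∈ B → Robust B → Escapes B u v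
  robust⇒escapes {B} {u} {v} u≢v u∈ v∈ rob x {y} y∈ with x ≟ u
  ... | no x≢u   = inj₁ (rob x y u y∈ (∖-intro {S = B} x≢u u∈))
  ... | yes refl = inj₂ (rob x y v y∈ (∖-intro {S = B} u≢v v∈))

  edge-robust : ∀ {u v} → u ~ v → Robust (⟨ u ⟩ ∪ ⟨ v ⟩)
  edge-robust {u} {v} u~v = escapes⇒robust u~v (∪₁ ⟨ u ⟩ ⟨ v ⟩ u (∈⟨⟩ u)) (∪₂ ⟨ u ⟩ ⟨ v ⟩ v (∈⟨⟩ v)) escapes
    where
    B = ⟨ u ⟩ ∪ ⟨ v ⟩
    escapes : Escapes B u v
    escapes x {y} y∈ with ∪-elim ⟨ u ⟩ ⟨ v ⟩ (∖-⊆ {S = B} {x} y y∈)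
    ... | inj₁ y∈₁ = inj₁ (subst (Reach G (B ∖ x) y) (≡-sym (⟨⟩-≡ y∈₁)) (here y∈))
    ... | inj₂ y∈₂ = inj₂ (subst (Reach G (B ∖ x) y) (≡-sym (⟨⟩-≡ y∈₂)) (here y∈))

  link-robust   : ∀ {S u v} (e : Link S u v) → Robust (linkB e)
  chain-escapes : ∀ {S u v} (c : Chain S u v) → Escapes (chainB c) u v
  chain-through : ∀ {S u v} (c : Chain S u v) → ∀ {x} → x ∉ S → Reach G (chainB c ∖ x) u v
  -- If `u` is deleted, the first link still reaches `w`, and the second part, which does not
  -- contain `u`, leads on to `v`. If another vertex is deleted, whatever reaches `w` continues to
  -- `u` inside the first link.
  glue-escapes  : ∀ {S₁ S₂ u w v} (e : Link S₁ u w) (c : Chain S₂ w v) → u ∉ S₂ → Escapes (linkB e ∪ chainB c) u v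

  ∉⇒≢ : ∀ (S : VSet n) {x y} → x ∉ S → y ∈ S → x ≢ y
  ∉⇒≢ S x∉ y∈ refl = x∉ y∈

  glue-escapes {u = u} {w} {v} e c u∉ x {y} y∈ = go (x ≟ u) (∪-elim A C (∖-⊆ {S = A ∪ C} {x} y y∈))
    where
    A C : VSet n
    A = linkB e
    C = chainB c
    x≢y : x ≢ y
    x≢y = ∖-≢ {S = A ∪ C} y∈
    inA : ∀ {p q} → Reach G (A ∖ x) p q → Reach G ((A ∪ C) ∖ x) p q
    inA = reach-⊆ (∖-mono {A = A} {A ∪ C} (∪₁ A C) x)
    inC : ∀ {p q} → Reach G (C ∖ x) p q → Reach G ((A ∪ C) ∖ x) p q
    inC = reach-⊆ (∖-mono {A = C} {A ∪ C} (∪₂ A C) x)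
    through : x ≡ u → Reach G ((A ∪ C) ∖ x) w v
    through refl = inC (chain-through c u∉)
    go : Dec (x ≡ u) → y ∈ A ⊎ y ∈ C → Reach G ((A ∪ C) ∖ x) y u ⊎ Reach G ((A ∪ C) ∖ x) y v
    go (no x≢u) (inj₁ y∈A) = inj₁ (inA (link-robust e x y u (∖-intro {S = A} x≢y y∈A) (∖-intro {S = A} x≢u (linkB-source e))))
    go (yes refl) (inj₁ y∈A) = inj₂ (⟫ (inA (link-robust e x y w (∖-intro {S = A} x≢y y∈A) (∖-intro {S = A} (link-≢ e) (linkB-target e)))) (through refl))
    go x≟u (inj₂ y∈C) with chain-escapes c x (∖-intro {S = C} x≢y y∈C)
    ... | inj₂ p = inj₂ (inC p)
    go (yes x≡u) (inj₂ y∈C) | inj₁ p = inj₂ (⟫ (inC p) (through x≡u))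
    go (no x≢u) (inj₂ y∈C) | inj₁ p = inj₁ (⟫ (inC p)
      (inA (link-robust e x w u (∖-intro {S = A} {x} (∖-≢ {S = C} {x} (target p)) (linkB-target e)) (∖-intro {S = A} x≢u (linkB-source e)))))

  link-robust {u = u} {v} (bridge _ _ b) = edge-robust (Bridge.joined b)
  link-robust e₀@(face e c u~v g) = escapes⇒robust u~v (linkB-source e₀) (linkB-target e₀)
    (glue-escapes e c (λ u∈ → link-≢ e (Glue.meet g (link-source e) u∈)))

  chain-escapes (one e) = robust⇒escapes (link-≢ e) (linkB-source e) (linkB-target e) (link-robust e)
  chain-escapes (cons e c g) = glue-escapes e c (λ u∈ → link-≢ e (Glue.meet g (link-source e) u∈))

  chain-through {S} {u} {v} (one e) {x} x∉ = link-robust e x u v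
    (∖-intro {S = linkB e} (∉⇒≢ S x∉ (link-source e)) (linkB-source e)) (∖-intro {S = linkB e} (∉⇒≢ S x∉ (link-target e)) (linkB-target e))
  chain-through {u = u} (cons {S₁ = S₁} {w = w} e c g) {x} x∉ = ⟫
      (reach-⊆ (∖-mono {A = linkB e} {linkB e ∪ chainB c} (∪₁ (linkB e) (chainB c)) x)
        (link-robust e x u w (∖-intro {S = linkB e} (∉⇒≢ S₁ x∉₁ (link-source e)) (linkB-source e))
                             (∖-intro {S = linkB e} (∉⇒≢ S₁ x∉₁ (link-target e)) (linkB-target e))))
      (reach-⊆ (∖-mono {A = chainB c} {linkB e ∪ chainB c} (∪₂ (linkB e) (chainB c)) x) (chain-through c (x∉ ∘ ⊆₂ x)))
    where
    open Glue g
    x∉₁ = x∉ ∘ ⊆₁ x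

  robust⇒connected : ∀ {B u v} → u ~ v → u ∈ B → v ∈ B → Robust B → ConnectedOn G B
  robust⇒connected {B} {u} {v} u~v u∈ v∈ rob = connected-via u to-u
    where
    to-u : ∀ y → y ∈ B → Reach G B y u
    to-u y y∈ with y ≟ v
    ... | yes refl = edge-reach y∈ u∈ (~-sym u~v)
    ... | no y≢v   = reach-⊆ (∖-⊆ {S = B} {v}) (rob v y u
      (∖-intro {S = B} (y≢v ∘ ≡-sym) y∈) (∖-intro {S = B} (~⇒≢ u~v ∘ ≡-sym) u∈))

  module _ {S₀ S} (rob : Robust S) (S⊆ : S ⊆ S₀) where

    -- A vertex of `S` hanging beyond one end of a bridge would trap `S` on that side, although the
    -- other end also belongs to `S`.
    link-maximal  : ∀ {T a b} (e : Link T a b) → Attached S₀ T a b → linkB e ⊆ S → ∀ {x} → x ∈ S → x ∈ T → x ∈ linkB e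
    chain-maximal : ∀ {T a b} (c : Chain T a b) → Attached S₀ T a b → chainB c ⊆ S → ∀ {x} → x ∈ S → x ∈ T → x ∈ chainB c

    link-maximal {a = a} {b} e@(bridge l r β) att B⊆ {x} x∈ x∈T with cover x∈T
      where open Bridge β
    ... | inj₁ x∈₁ with x ≟ a
    ...   | yes refl = linkB-source e
    ...   | no x≢a   = ⊥-elim (Bridge.disjoint β (hang₁ x∈ x∈₁ x≢a b (B⊆ b (linkB-target e))) (root-∈ r))
      where open Hanging β (root-∈ l) (root-∈ r) att rob S⊆
    link-maximal {a = a} {b} e@(bridge l r β) att B⊆ {x} x∈ x∈T | inj₂ x∈₂ with x ≟ b
    ...   | yes refl = linkB-target e
    ...   | no x≢b   = ⊥-elim (Bridge.disjoint β (root-∈ l) (hang₂ x∈ x∈₂ x≢b a (B⊆ a (linkB-source e))))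
      where open Hanging β (root-∈ l) (root-∈ r) att rob S⊆
    link-maximal (face e c _ g) att B⊆ {x} x∈ x∈T with Glue.cover g x∈T
    ... | inj₁ x∈₁ = ∪₁ (linkB e) (chainB c) x (link-maximal e (attached₁ g id e c att) (λ y → B⊆ y ∘ ∪₁ (linkB e) (chainB c) y) x∈ x∈₁)
    ... | inj₂ x∈₂ = ∪₂ (linkB e) (chainB c) x (chain-maximal c (attached₂ g id e c att) (λ y → B⊆ y ∘ ∪₂ (linkB e) (chainB c) y) x∈ x∈₂)

    chain-maximal (one e) = link-maximal e
    chain-maximal (cons e c g) att B⊆ {x} x∈ x∈T with Glue.cover g x∈T
    ... | inj₁ x∈₁ = ∪₁ (linkB e) (chainB c) x (link-maximal e (attached₁ g (λ ()) e c att) (λ y → B⊆ y ∘ ∪₁ (linkB e) (chainB c) y) x∈ x∈₁)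
    ... | inj₂ x∈₂ = ∪₂ (linkB e) (chainB c) x (chain-maximal c (attached₂ g (λ ()) e c att) (λ y → B⊆ y ∘ ∪₂ (linkB e) (chainB c) y) x∈ x∈₂)

  -- Lets maximality be tested inside a piece: a robust set containing the candidate block has two
  -- vertices in the piece, hence lies in it.
  Closed : VSet n → Set
  Closed S₀ = ∀ {S} → Robust S → ∀ {a b} → a ∈ S → a ∈ S₀ → b ∈ S → b ∈ S₀ → a ≢ b → S ⊆ S₀

  link-block : ∀ {S u v} (e : Link S u v) → Closed S → IsBlock G (linkB e)
  link-block {S} {u} {v} e closed = (u , linkB-source e) , robust⇒connected (link-~ e) (linkB-source e) (linkB-target e) (link-robust e) , (λ x _ → link-robust e x) , maximal
    where
    maximal : ∀ S' → linkB e ⊆ S' → ConnectedOn G S' → NoCutVertex G S' → S' ⊆ linkB e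
    maximal S' B⊆ conn nocut x x∈ = link-maximal rob S'⊆ e (λ _ _ _ y∈ _ → y∈) B⊆ x∈ (S'⊆ x x∈)
      where
      rob = robust conn nocut
      S'⊆ = closed rob (B⊆ u (linkB-source e)) (link-source e) (B⊆ v (linkB-target e)) (link-target e) (link-≢ e)

-- Pentagons

c5adj? : ∀ i j → Dec (c5adj i j)
c5adj? i j = (toℕ j ≟ⁿ suc (toℕ i) % 5) ⊎-dec (toℕ i ≟ⁿ suc (toℕ j) % 5)

next : Fin 5 → Fin 5
next 0F = 1F
next 1F = 2F
next 2F = 3F
next 3F = 4F
next 4F = 0F

c5adj⇒next : ∀ i j → c5adj i j → j ≡ next i ⊎ i ≡ next j
c5adj⇒next = from-yes (all? λ i → all? λ j → c5adj? i j →-dec ((j ≟ next i) ⊎-dec (i ≟ next j)))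

c5-cases : ∀ i j → c5adj i j ⊎ i ≡ j ⊎ j ≡ next (next i) ⊎ i ≡ next (next j)
c5-cases = from-yes (all? λ i → all? λ j → c5adj? i j ⊎-dec (i ≟ j) ⊎-dec (j ≟ next (next i)) ⊎-dec (i ≟ next (next j)))

c5-degree : ∀ i j → c5adj i j → ∀ k → c5adj i k → ∀ l → c5adj i l → j ≢ k → j ≢ l → ¬ (k ≢ l)
c5-degree = from-yes (all? λ i → all? λ j → c5adj? i j →-dec all? λ k → c5adj? i k →-dec all? λ l → c5adj? i l →-dec
  ¬? (j ≟ k) →-dec ¬? (j ≟ l) →-dec ¬? (¬? (k ≟ l)))

c5-triangle-free : ∀ i j → c5adj i j → ∀ k → c5adj j k → ¬ c5adj k i
c5-triangle-free = from-yes (all? λ i → all? λ j → c5adj? i j →-dec all? λ k → c5adj? j k →-dec ¬? (c5adj? k i))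

c5-square-free : ∀ i j → c5adj i j → ∀ k → c5adj j k → i ≢ k → ∀ l → c5adj k l → j ≢ l → ¬ c5adj l i
c5-square-free = from-yes (all? λ i → all? λ j → c5adj? i j →-dec all? λ k → c5adj? j k →-dec ¬? (i ≟ k) →-dec
  all? λ l → c5adj? k l →-dec ¬? (j ≟ l) →-dec ¬? (c5adj? l i))

c5-path : ∀ i j → c5adj i j → ∀ k → c5adj j k → i ≢ k → ∀ l → c5adj k l → j ≢ l → ∀ m → c5adj l m → k ≢ m → c5adj i m
c5-path = from-yes (all? λ i → all? λ j → c5adj? i j →-dec all? λ k → c5adj? j k →-dec ¬? (i ≟ k) →-dec
  all? λ l → c5adj? k l →-dec ¬? (j ≟ l) →-dec all? λ m → c5adj? l m →-dec ¬? (k ≟ m) →-dec c5adj? i m)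

module Cacti {n : ℕ} (G : Graph n) where

  open Blocks G public

  module Pentagonal {B : VSet n} (iso : IsoC5 G B) where

    private
      f     = proj₁ iso
      onto  = proj₁ (proj₂ (proj₂ iso))
      toC5  = proj₁ (proj₂ (proj₂ (proj₂ (proj₂ iso))))
      toG   = proj₂ (proj₂ (proj₂ (proj₂ (proj₂ iso))))

      ≢-index : ∀ {i j} → f i ≢ f j → i ≢ j
      ≢-index ne refl = ne refl

    degree : ∀ {x y₁ y₂ y₃} → x ∈ B → y₁ ∈ B → y₂ ∈ B → y₃ ∈ B → x ~ y₁ → x ~ y₂ → x ~ y₃ → y₁ ≢ y₂ → y₁ ≢ y₃ → ¬ (y₂ ≢ y₃)
    degree {x} {y₁} {y₂} {y₃} x∈ y₁∈ y₂∈ y₃∈ a₁ a₂ a₃ n₁ n₂ n₃ with onto x x∈ | onto y₁ y₁∈ | onto y₂ y₂∈ | onto y₃ y₃∈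
    ... | i , refl | j , refl | k , refl | l , refl =
      c5-degree i j (toC5 i j a₁) k (toC5 i k a₂) l (toC5 i l a₃) (≢-index n₁) (≢-index n₂) (≢-index n₃)

    triangle-free : ∀ {x y z} → x ∈ B → y ∈ B → z ∈ B → x ~ y → y ~ z → ¬ (z ~ x)
    triangle-free {x} {y} {z} x∈ y∈ z∈ a₁ a₂ a₃ with onto x x∈ | onto y y∈ | onto z z∈
    ... | i , refl | j , refl | k , refl = c5-triangle-free i j (toC5 i j a₁) k (toC5 j k a₂) (toC5 k i a₃)

    square-free : ∀ {x y z t} → x ∈ B → y ∈ B → z ∈ B → t ∈ B → x ~ y → y ~ z → x ≢ z → z ~ t → y ≢ t → ¬ (t ~ x)
    square-free {x} {y} {z} {t} x∈ y∈ z∈ t∈ a₁ a₂ n₁ a₃ n₂ a₄ with onto x x∈ | onto y y∈ | onto z z∈ | onto t t∈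
    ... | i , refl | j , refl | k , refl | l , refl =
      c5-square-free i j (toC5 i j a₁) k (toC5 j k a₂) (≢-index n₁) l (toC5 k l a₃) (≢-index n₂) (toC5 l i a₄)

    path-closes : ∀ {x y z t s} → x ∈ B → y ∈ B → z ∈ B → t ∈ B → s ∈ B →
      x ~ y → y ~ z → x ≢ z → z ~ t → y ≢ t → t ~ s → z ≢ s → x ~ s
    path-closes {x} {y} {z} {t} {s} x∈ y∈ z∈ t∈ s∈ a₁ a₂ n₁ a₃ n₂ a₄ n₃
      with onto x x∈ | onto y y∈ | onto z z∈ | onto t t∈ | onto s s∈
    ... | i , refl | j , refl | k , refl | l , refl | m , refl =
      toG i m (c5-path i j (toC5 i j a₁) k (toC5 j k a₂) (≢-index n₁) l (toC5 k l a₃) (≢-index n₂) m (toC5 l m a₄) (≢-index n₃))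

  module _ {S S₁ S₂ T₁ T₂ U₁ U₂ u x₁ x₂ x₃ v}
    (e₁ : Link S₁ u x₁) (e₂ : Link T₁ x₁ x₂) (e₃ : Link U₁ x₂ x₃) (e₄ : Link U₂ x₃ v)
    (g₃ : Glue Never T₂ U₁ U₂ x₃) (g₂ : Glue Never S₂ T₁ T₂ x₂) (g₁ : Glue (Only u v) S S₁ S₂ x₁) (u~v : u ~ v) where

    private
      module A = Glue g₁
      module B = Glue g₂
      module C = Glue g₃

      x₂∈T₂ : x₂ ∈ T₂
      x₂∈T₂ = C.⊆₁ _ (link-source e₃)
      x₃∈T₂ : x₃ ∈ T₂
      x₃∈T₂ = C.⊆₁ _ (link-target e₃)
      v∈T₂ : v ∈ T₂
      v∈T₂ = C.⊆₂ _ (link-target e₄)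
      u∉S₂ : u ∉ S₂
      u∉S₂ m = link-≢ e₁ (A.meet (link-source e₁) m)
      x₁∉T₂ : x₁ ∉ T₂
      x₁∉T₂ m = link-≢ e₂ (B.meet (link-source e₂) m)
      x₂∉U₂ : x₂ ∉ U₂
      x₂∉U₂ m = link-≢ e₃ (C.meet (link-source e₃) m)
      ≢-from : ∀ (A : VSet n) {x y} → y ∈ A → x ∉ A → x ≢ y
      ≢-from A y∈ x∉ refl = x∉ y∈

    cycle : Fin 5 → Fin n
    cycle 0F = u
    cycle 1F = x₁
    cycle 2F = x₂
    cycle 3F = x₃
    cycle 4F = v

    cycle-~ : ∀ i → cycle i ~ cycle (next i)
    cycle-~ 0F = link-~ e₁
    cycle-~ 1F = link-~ e₂
    cycle-~ 2F = link-~ e₃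
    cycle-~ 3F = link-~ e₄
    cycle-~ 4F = ~-sym u~v

    cycle-≢ : ∀ i → cycle i ≢ cycle (next (next i))
    cycle-≢ 0F = ≢-from S₂ (B.⊆₂ _ x₂∈T₂) u∉S₂
    cycle-≢ 1F = ≢-from T₂ x₃∈T₂ x₁∉T₂
    cycle-≢ 2F = ≢-from U₂ (link-target e₄) x₂∉U₂
    cycle-≢ 3F = ≢-from S₂ (B.⊆₂ _ x₃∈T₂) u∉S₂ ∘ ≡-sym
    cycle-≢ 4F = ≢-from T₂ v∈T₂ x₁∉T₂ ∘ ≡-sym

    -- Any two nonconsecutive vertices lie strictly on different sides of some joint, where at most
    -- the edge `u v` may pass.
    cycle-≁ : ∀ i → ¬ (cycle i ~ cycle (next (next i)))
    cycle-≁ 0F a = cycle-≢ 2F (proj₂ (A.cross (link-source e₁) (B.⊆₂ _ x₂∈T₂) (link-≢ e₁) (link-≢ e₂ ∘ ≡-sym) a))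
    cycle-≁ 1F a = B.cross (link-source e₂) x₃∈T₂ (link-≢ e₂) (link-≢ e₃ ∘ ≡-sym) a
    cycle-≁ 2F a = C.cross (link-source e₃) (link-target e₄) (link-≢ e₃) (link-≢ e₄ ∘ ≡-sym) a
    cycle-≁ 3F a = link-≢ e₄ (proj₂ (A.cross (link-source e₁) (B.⊆₂ _ x₃∈T₂) (link-≢ e₁) (cycle-≢ 1F ∘ ≡-sym) (~-sym a)))
    cycle-≁ 4F a = B.cross (link-source e₂) v∈T₂ (link-≢ e₂) (cycle-≢ 2F ∘ ≡-sym) (~-sym a)

    cycle-toG : ∀ i j → c5adj i j → cycle i ~ cycle j
    cycle-toG i j a with c5adj⇒next i j a
    ... | inj₁ refl = cycle-~ i
    ... | inj₂ refl = ~-sym (cycle-~ j)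

    cycle-toC5 : ∀ i j → cycle i ~ cycle j → c5adj i j
    cycle-toC5 i j a with c5-cases i j
    ... | inj₁ adjacent = adjacent
    ... | inj₂ (inj₁ refl) = ⊥-elim (~-irrefl a)
    ... | inj₂ (inj₂ (inj₁ refl)) = ⊥-elim (cycle-≁ i a)
    ... | inj₂ (inj₂ (inj₂ refl)) = ⊥-elim (cycle-≁ j (~-sym a))

    cycle-injective : ∀ {i j} → cycle i ≡ cycle j → i ≡ j
    cycle-injective {i} {j} eq with c5-cases i j
    ... | inj₁ adjacent = ⊥-elim (~⇒≢ (cycle-toG i j adjacent) eq)
    ... | inj₂ (inj₁ i≡j) = i≡j
    ... | inj₂ (inj₂ (inj₁ refl)) = ⊥-elim (cycle-≢ i eq)
    ... | inj₂ (inj₂ (inj₂ refl)) = ⊥-elim (cycle-≢ j (≡-sym eq))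

    cycle-iso : ∀ {B} → (∀ x → x ∈ B → ∃[ i ] cycle i ≡ x) → (∀ i → cycle i ∈ B) → IsoC5 G B
    cycle-iso onto into = cycle , cycle-injective , onto , into , cycle-toC5 , cycle-toG

  -- Blocks of a tree of pentagons

  module CactusBlock {S} (block : IsBlock G S) {p q} (p∈ : p ∈ S) (q∈ : q ∈ S) (p≢q : p ≢ q) where

    private
      rob : Robust S
      rob = robust (proj₁ (proj₂ block)) (proj₁ (proj₂ (proj₂ block)))

    rooted-block : ∀ {S₀ u} {r : Rooted S₀ u} → CactusRooted r → S ⊆ S₀ → IsoC5 G S
    chain-block : ∀ {S₀ u v} {c : Chain S₀ u v} → CactusChain c → S ⊆ S₀ → IsoC5 G S
    pentagon-block : ∀ {S₀ u v} {e : Link S₀ u v} → Pentagon e → S ⊆ S₀ → IsoC5 G S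
    -- If the block contains a vertex hanging beyond an end of the link, it is trapped in the tree
    -- of pentagons there, and induction applies to that tree.
    plain-block : ∀ {S₀ T a b} {e : Link T a b} → Plain e → S ⊆ S₀ → Attached S₀ T a b →
      IsoC5 G S ⊎ (∀ {x} → x ∈ S → x ∈ T → x ≡ a ⊎ x ≡ b)

    rooted-block (leaf {only = only}) S⊆ = ⊥-elim (p≢q (trans (only (S⊆ p p∈)) (≡-sym (only (S⊆ q q∈)))))
    rooted-block (grow c) S⊆ = chain-block c S⊆

    chain-block (one e) S⊆ = pentagon-block e S⊆
    chain-block (cons {e = e} {c} {g} k ks) S⊆ with dichotomy g (link-target e) (chain-source c) rob S⊆
    ... | inj₁ S⊆₁ = pentagon-block k S⊆₁
    ... | inj₂ S⊆₂ = chain-block ks S⊆₂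

    plain-block {a = a} {b} (plain {S₁ = T₁} {T₂} {l = l} {r} {β} k k') S⊆ att
      with any? (λ x → T? (S x) ×-dec T? (T₁ x) ×-dec ¬? (x ≟ a)) | any? (λ x → T? (S x) ×-dec T? (T₂ x) ×-dec ¬? (x ≟ b))
    ... | yes (x , x∈ , x∈₁ , x≢a) | _ = inj₁ (rooted-block k (hang₁ x∈ x∈₁ x≢a))
      where open Hanging β (root-∈ l) (root-∈ r) att rob S⊆
    ... | no _ | yes (x , x∈ , x∈₂ , x≢b) = inj₁ (rooted-block k' (hang₂ x∈ x∈₂ x≢b))
      where open Hanging β (root-∈ l) (root-∈ r) att rob S⊆
    ... | no none₁ | no none₂ = inj₂ λ {x} x∈ x∈T → at-end x x∈ (Bridge.cover β x∈T)
      where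
      at-end : ∀ x → x ∈ S → x ∈ T₁ ⊎ x ∈ T₂ → x ≡ a ⊎ x ≡ b
      at-end x x∈ (inj₁ x∈₁) with x ≟ a
      ... | yes x≡a = inj₁ x≡a
      ... | no x≢a  = ⊥-elim (none₁ (x , x∈ , x∈₁ , x≢a))
      at-end x x∈ (inj₂ x∈₂) with x ≟ b
      ... | yes x≡b = inj₂ x≡b
      ... | no x≢b  = ⊥-elim (none₂ (x , x∈ , x∈₂ , x≢b))

    pentagon-block {S₀} {u} {v} (pentagon {e = e₁} {c₁} {u~v} {g₁}
        k₁ (cons {w = x₂} {e = e₂} {c₂} {g₂} k₂ (cons {w = x₃} {e = e₃} {g = g₃} k₃ (one {e = e₄} k₄)))) S⊆
      with plain-block k₁ S⊆ att₁ | plain-block k₂ S⊆ att₂ | plain-block k₃ S⊆ att₃ | plain-block k₄ S⊆ att₄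
      where
      att₀ : Attached S₀ S₀ u v
      att₀ _ _ _ y∈ _ = y∈
      att₁ = attached₁ g₁ id e₁ c₁ att₀
      att' = attached₂ g₁ id e₁ c₁ att₀
      att₂ = attached₁ g₂ (λ ()) e₂ c₂ att'
      att'' = attached₂ g₂ (λ ()) e₂ c₂ att'
      att₃ = attached₁ g₃ (λ ()) e₃ (one e₄) att''
      att₄ = attached₂ g₃ (λ ()) e₃ (one e₄) att''
    ... | inj₁ iso | _ | _ | _ = iso
    ... | inj₂ _ | inj₁ iso | _ | _ = iso
    ... | inj₂ _ | inj₂ _ | inj₁ iso | _ = iso
    ... | inj₂ _ | inj₂ _ | inj₂ _ | inj₁ iso = iso
    ... | inj₂ h₁ | inj₂ h₂ | inj₂ h₃ | inj₂ h₄ = cycle-iso e₁ e₂ e₃ e₄ g₃ g₂ g₁ u~v onto into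
      where
      f = cycle e₁ e₂ e₃ e₄ g₃ g₂ g₁ u~v
      link = face e₁ c₁ u~v g₁
      onto : ∀ x → x ∈ S → ∃[ i ] f i ≡ x
      onto x x∈ with Glue.cover g₁ (S⊆ x x∈)
      ... | inj₁ m = [ (λ e → 0F , ≡-sym e) , (λ e → 1F , ≡-sym e) ] (h₁ x∈ m)
      ... | inj₂ m with Glue.cover g₂ m
      ...   | inj₁ m' = [ (λ e → 1F , ≡-sym e) , (λ e → 2F , ≡-sym e) ] (h₂ x∈ m')
      ...   | inj₂ m' with Glue.cover g₃ m'
      ...     | inj₁ m'' = [ (λ e → 2F , ≡-sym e) , (λ e → 3F , ≡-sym e) ] (h₃ x∈ m'')
      ...     | inj₂ m'' = [ (λ e → 3F , ≡-sym e) , (λ e → 4F , ≡-sym e) ] (h₄ x∈ m'')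
      inB : ∀ i → f i ∈ linkB link
      inB 0F = linkB-source link
      inB 1F = ∪₁ (linkB e₁) (chainB c₁) _ (linkB-target e₁)
      inB 2F = ∪₂ (linkB e₁) (chainB c₁) _ (∪₁ (linkB e₂) (chainB c₂) _ (linkB-target e₂))
      inB 3F = ∪₂ (linkB e₁) (chainB c₁) _ (∪₂ (linkB e₂) (chainB c₂) _ (∪₁ (linkB e₃) (linkB e₄) _ (linkB-target e₃)))
      inB 4F = linkB-target link
      S⊆B : S ⊆ linkB link
      S⊆B x x∈ with onto x x∈
      ... | i , refl = inB i
      -- `S` is contained in the connected set `linkB link`, which has no cut vertex; maximality of
      -- the block then gives equality.
      into : ∀ i → f i ∈ S
      into i = proj₂ (proj₂ (proj₂ block)) (linkB link) S⊆B
        (robust⇒connected u~v (linkB-source link) (linkB-target link) (link-robust link)) (λ x _ → link-robust link x) (f i) (inB i)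

  -- Recognising a tree of pentagons from its blocks

  data Bare : ∀ {S u v} → Link S u v → Set where
    bare : ∀ {S S₁ S₂ u v} {l : Rooted S₁ u} {r : Rooted S₂ v} {b : Bridge S S₁ S₂ u v} → Bare (bridge l r b)

  data BarePath : ℕ → ∀ {S u v} → Chain S u v → Set where
    one  : ∀ {S u v} {e : Link S u v} → Bare e → BarePath 1 (one e)
    cons : ∀ {k S S₁ S₂ u w v} {e : Link S₁ u w} {c : Chain S₂ w v} {g : Glue Never S S₁ S₂ w} →
      Bare e → BarePath k c → BarePath (suc k) (cons e c g)

  bare? : ∀ {S u v} (e : Link S u v) → Dec (Bare e)
  bare? (bridge _ _ _) = yes bare
  bare? (face _ _ _ _) = no λ ()

  barePath? : ∀ k {S u v} (c : Chain S u v) → Dec (BarePath k c)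
  barePath? zero c = no λ ()
  barePath? (suc zero) (one e) with bare? e
  ... | yes b = yes (one b)
  ... | no ¬b = no λ { (one b) → ¬b b }
  barePath? (suc (suc k)) (one e) = no λ ()
  barePath? (suc k) (cons e c g) with bare? e | barePath? k c
  ... | yes b | yes bs = yes (cons b bs)
  ... | no ¬b | _      = no λ { (cons b _) → ¬b b }
  ... | yes _ | no ¬bs = no λ { (cons _ bs) → ¬bs bs }

  module _ {B : VSet n} (iso : IsoC5 G B) where
    open Pentagonal iso

    -- If the link were a face, `a` would have three neighbours in the pentagon: `y`, the far end of
    -- the closing edge and the far end of the first link.
    c5-bare : ∀ {T a b y} (e : Link T a b) → linkB e ⊆ B → y ∈ B → a ~ y → y ∉ T → Bare e
    c5-bare (bridge _ _ _) _ _ _ _ = bare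
    c5-bare {T} e₀@(face e c u~v g) B⊆ y∈ a~y y∉ = ⊥-elim (degree
      (B⊆ _ (linkB-source e₀)) y∈ (B⊆ _ (linkB-target e₀)) (B⊆ _ (∪₁ (linkB e) (chainB c) _ (linkB-target e)))
      a~y u~v (link-~ e) (∉⇒≢ T y∉ (link-target e₀)) (∉⇒≢ T y∉ (Glue.⊆₁ g _ (link-target e))) (chain-≢ c ∘ ≡-sym))

    -- For each further link the source of the preceding one serves as the outside neighbour `y`.
    c5-barePath : ∀ {T a b y} (c : Chain T a b) → chainB c ⊆ B → y ∈ B → a ~ y → y ∉ T → ∃[ k ] BarePath k c
    c5-barePath (one e) B⊆ y∈ a~y y∉ = 1 , one (c5-bare e B⊆ y∈ a~y y∉)
    c5-barePath (cons e c g) B⊆ y∈ a~y y∉ with c5-barePath c (λ x → B⊆ x ∘ ∪₂ (linkB e) (chainB c) x)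
        (B⊆ _ (∪₁ (linkB e) (chainB c) _ (linkB-source e))) (~-sym (link-~ e)) (λ m → link-≢ e (Glue.meet g (link-source e) m))
    ... | k , path = suc k , cons (c5-bare e (λ x → B⊆ x ∘ ∪₁ (linkB e) (chainB c) x) y∈ a~y (y∉ ∘ Glue.⊆₁ g _)) path

    -- One link would form a triangle with `u`, two links a square. From four links on, the path
    -- from `u` to `x₄` has four edges and closes up in a pentagon, so `u` would have the three
    -- neighbours `x₁`, `v` and `x₄`.
    c5-length : ∀ {k T u x₁ v} (c : Chain T x₁ v) → BarePath k c → chainB c ⊆ B → u ∈ B → u ~ x₁ → u ~ v → u ∉ T → k ≡ 3
    c5-length c@(one e) (one _) B⊆ u∈ u~x₁ u~v u∉ = ⊥-elim (triangle-free
      u∈ (B⊆ _ (linkB-source e)) (B⊆ _ (linkB-target e)) u~x₁ (link-~ e) (~-sym u~v))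
    c5-length {T = T} c@(cons {S₂ = S₂} e₂ (one e₃) g) (cons _ (one _)) B⊆ u∈ u~x₁ u~v u∉ = ⊥-elim (square-free
      u∈ (B⊆ _ (chainB-source c)) (B⊆ _ (∪₁ (linkB e₂) (linkB e₃) _ (linkB-target e₂))) (B⊆ _ (chainB-target c))
      u~x₁ (link-~ e₂) (∉⇒≢ T u∉ (Glue.⊆₁ g _ (link-target e₂))) (link-~ e₃) (chain-≢ c) (~-sym u~v))
    c5-length (cons _ (cons _ (one _) _) _) (cons _ (cons _ (one _))) _ _ _ _ _ = refl
    c5-length {T = T} {u} {x₁} {v} c@(cons {S₂ = S₂} {x₂} e₂ c₂@(cons {S₂ = S₃} {x₃} e₃ c₃@(cons {w = x₄} e₄ c₄ g₄) g₃) g₂) (cons _ (cons _ (cons _ _))) B⊆ u∈ u~x₁ u~v u∉ =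
        ⊥-elim (degree u∈ x₁∈ v∈ x₄∈ u~x₁ u~v
          (path-closes u∈ x₁∈ x₂∈ x₃∈ x₄∈ u~x₁ (link-~ e₂) u≢x₂ (link-~ e₃) x₁≢x₃ (link-~ e₄) x₂≢x₄)
          (chain-≢ c) x₁≢x₄ (chain-≢ c₄ ∘ ≡-sym))
      where
      in₂ : chainB c₂ ⊆ B
      in₂ x = B⊆ x ∘ ∪₂ (linkB e₂) (chainB c₂) x
      in₃ : chainB c₃ ⊆ B
      in₃ x = in₂ x ∘ ∪₂ (linkB e₃) (chainB c₃) x
      in₄ : chainB c₄ ⊆ B
      in₄ x = in₃ x ∘ ∪₂ (linkB e₄) (chainB c₄) x
      x₁∈ : x₁ ∈ B
      x₁∈ = B⊆ _ (chainB-source c)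
      x₂∈ : x₂ ∈ B
      x₂∈ = in₂ _ (chainB-source c₂)
      x₃∈ : x₃ ∈ B
      x₃∈ = in₃ _ (chainB-source c₃)
      x₄∈ : x₄ ∈ B
      x₄∈ = in₄ _ (chainB-source c₄)
      v∈ : v ∈ B
      v∈ = B⊆ _ (chainB-target c)
      x₄∈S₃ : x₄ ∈ S₃
      x₄∈S₃ = Glue.⊆₁ g₄ _ (link-target e₄)
      x₁∉S₂ : x₁ ∉ S₂
      x₁∉S₂ m = link-≢ e₂ (Glue.meet g₂ (link-source e₂) m)
      x₂∉S₃ : x₂ ∉ S₃
      x₂∉S₃ m = link-≢ e₃ (Glue.meet g₃ (link-source e₃) m)
      u≢x₂ : u ≢ x₂
      u≢x₂ = ∉⇒≢ T u∉ (Glue.⊆₁ g₂ _ (link-target e₂))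
      x₁≢x₃ : x₁ ≢ x₃
      x₁≢x₃ = ∉⇒≢ S₂ x₁∉S₂ (Glue.⊆₁ g₃ _ (link-target e₃))
      x₁≢x₄ : x₁ ≢ x₄
      x₁≢x₄ = ∉⇒≢ S₂ x₁∉S₂ (Glue.⊆₂ g₃ _ x₄∈S₃)
      x₂≢x₄ : x₂ ≢ x₄
      x₂≢x₄ = ∉⇒≢ S₃ x₂∉S₃ x₄∈S₃

  -- Three of the five vertices of the cycle would already have to share two places.
  bridge-not-c5 : ∀ {u v} → ¬ IsoC5 G (⟨ u ⟩ ∪ ⟨ v ⟩)
  bridge-not-c5 {u} {v} (f , injective , _ , into , _) = absurd (which 0F) (which 1F) (which 2F)
    where
    which : ∀ i → u ≡ f i ⊎ v ≡ f i
    which i with ∪-elim ⟨ u ⟩ ⟨ v ⟩ {f i} (into i)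
    ... | inj₁ m = inj₁ (⟨⟩-≡ {u} m)
    ... | inj₂ m = inj₂ (⟨⟩-≡ {v} m)
    same : ∀ {w i j} → w ≡ f i → w ≡ f j → i ≡ j
    same p q = injective (trans (≡-sym p) q)
    0≢1 : _≢_ {A = Fin 5} 0F 1F
    0≢1 ()
    0≢2 : _≢_ {A = Fin 5} 0F 2F
    0≢2 ()
    1≢2 : _≢_ {A = Fin 5} 1F 2F
    1≢2 ()
    absurd : u ≡ f 0F ⊎ v ≡ f 0F → u ≡ f 1F ⊎ v ≡ f 1F → u ≡ f 2F ⊎ v ≡ f 2F → ⊥
    absurd (inj₁ p) (inj₁ q) _        = 0≢1 (same p q)
    absurd (inj₂ p) (inj₂ q) _        = 0≢1 (same p q)
    absurd (inj₁ p) (inj₂ _) (inj₁ r) = 0≢2 (same p r)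
    absurd (inj₁ _) (inj₂ q) (inj₂ r) = 1≢2 (same q r)
    absurd (inj₂ _) (inj₁ q) (inj₁ r) = 1≢2 (same q r)
    absurd (inj₂ p) (inj₁ _) (inj₂ r) = 0≢2 (same p r)

  NonC5Block : Set
  NonC5Block = ∃[ S ] (IsBlock G S × ¬ IsoC5 G S)

  module _ {S₀} (closed : Closed S₀) {T T₁ T₂ a b} (β : Bridge T T₁ T₂ a b) (a∈ : a ∈ T₁) (b∈ : b ∈ T₂)
    (att : Attached S₀ T a b) (T⊆ : T ⊆ S₀) where
    open Bridge β

    -- Of two distinct vertices at least one differs from `a`, and that one traps the robust set in
    -- `T₁`.
    closed-hang₁ : Closed T₁
    closed-hang₁ {S} rob {x} {y} x∈ x∈₁ y∈ y∈₁ x≢y = by (x ≟ a)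
      where
      open Hanging β a∈ b∈ att rob (closed rob x∈ (T⊆ _ (⊆₁ _ x∈₁)) y∈ (T⊆ _ (⊆₁ _ y∈₁)) x≢y)
      by : Dec (x ≡ a) → S ⊆ T₁
      by (no x≢a)   = hang₁ x∈ x∈₁ x≢a
      by (yes refl) = hang₁ y∈ y∈₁ (x≢y ∘ ≡-sym)

    closed-hang₂ : Closed T₂
    closed-hang₂ {S} rob {x} {y} x∈ x∈₂ y∈ y∈₂ x≢y = by (x ≟ b)
      where
      open Hanging β a∈ b∈ att rob (closed rob x∈ (T⊆ _ (⊆₂ _ x∈₂)) y∈ (T⊆ _ (⊆₂ _ y∈₂)) x≢y)
      by : Dec (x ≡ b) → S ⊆ T₂
      by (no x≢b)   = hang₂ x∈ x∈₂ x≢b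
      by (yes refl) = hang₂ y∈ y∈₂ (x≢y ∘ ≡-sym)

  closed-side : ∀ {S₀ S₁ S₂ w} → Closed S₀ → Glue Never S₀ S₁ S₂ w → w ∈ S₁ → Closed S₁
  closed-side {S₁ = S₁} {w = w} closed g w∈ {S} rob {x} {y} x∈ x∈₁ y∈ y∈₁ x≢y = by (x ≟ w)
    where
    S⊆ = closed rob x∈ (Glue.⊆₁ g _ x∈₁) y∈ (Glue.⊆₁ g _ y∈₁) x≢y
    by : Dec (x ≡ w) → S ⊆ S₁
    by (no x≢w)   = one-side g w∈ rob S⊆ x∈ x∈₁ x≢w
    by (yes refl) = one-side g w∈ rob S⊆ y∈ y∈₁ (x≢y ∘ ≡-sym)

  rooted-cactus : ∀ {S u} (r : Rooted S u) → Closed S → CactusRooted r ⊎ NonC5Block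
  chain-cactus  : ∀ {S u v} (c : Chain S u v) → Closed S → CactusChain c ⊎ NonC5Block
  -- The shape of the face is tested first, with `Bare` ignoring what hangs at the ends. If it is
  -- wrong, `linkB e` itself is a block other than a pentagon; if it is right, the search continues
  -- in the hanging pieces, which are again `Closed`.
  link-pentagon : ∀ {S u v} (e : Link S u v) → Closed S → Pentagon e ⊎ NonC5Block
  bare-plain    : ∀ {S₀ T a b} (e : Link T a b) → Bare e → Closed S₀ → Attached S₀ T a b → T ⊆ S₀ → Plain e ⊎ NonC5Block
  path-plain    : ∀ {k S₀ T a b} (c : Chain T a b) → BarePath k c → Closed S₀ → Attached S₀ T a b → T ⊆ S₀ → PlainPath k c ⊎ NonC5Block

  rooted-cactus (leaf _ _) closed = inj₁ leaf
  rooted-cactus (grow c) closed with chain-cactus c closed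
  ... | inj₁ k = inj₁ (grow k)
  ... | inj₂ N = inj₂ N

  chain-cactus (one e) closed with link-pentagon e closed
  ... | inj₁ k = inj₁ (one k)
  ... | inj₂ N = inj₂ N
  chain-cactus (cons e c g) closed
    with link-pentagon e (closed-side closed g (link-target e)) | chain-cactus c (closed-side closed (glue-swap g) (chain-source c))
  ... | inj₁ k | inj₁ ks = inj₁ (cons k ks)
  ... | inj₁ _ | inj₂ N  = inj₂ N
  ... | inj₂ N | _       = inj₂ N

  bare-plain (bridge l r β) bare closed att T⊆
    with rooted-cactus l (closed-hang₁ closed β (root-∈ l) (root-∈ r) att T⊆)
       | rooted-cactus r (closed-hang₂ closed β (root-∈ l) (root-∈ r) att T⊆)
  ... | inj₁ k | inj₁ k' = inj₁ (plain k k')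
  ... | inj₁ _ | inj₂ N  = inj₂ N
  ... | inj₂ N | _       = inj₂ N

  path-plain (one e) (one b) closed att T⊆ with bare-plain e b closed att T⊆
  ... | inj₁ k = inj₁ (one k)
  ... | inj₂ N = inj₂ N
  path-plain (cons e c g) (cons b bs) closed att T⊆
    with bare-plain e b closed (attached₁ g (λ ()) e c att) (λ x → T⊆ x ∘ Glue.⊆₁ g x)
       | path-plain c bs closed (attached₂ g (λ ()) e c att) (λ x → T⊆ x ∘ Glue.⊆₂ g x)
  ... | inj₁ k | inj₁ ks = inj₁ (cons k ks)
  ... | inj₁ _ | inj₂ N  = inj₂ N
  ... | inj₂ N | _       = inj₂ N

  link-pentagon {u = u} {v} e@(bridge _ _ _) closed = inj₂ (linkB e , link-block e closed , bridge-not-c5 {u} {v})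
  link-pentagon {S} {u} {v} e₀@(face {S₁} {S₂} e c u~v g) closed with bare? e | barePath? 3 c
  ... | yes b | yes bs
    with bare-plain e b closed (attached₁ g id e c (λ _ _ _ y∈ _ → y∈)) (Glue.⊆₁ g)
       | path-plain c bs closed (attached₂ g id e c (λ _ _ _ y∈ _ → y∈)) (Glue.⊆₂ g)
  ...   | inj₁ k | inj₁ ks = inj₁ (pentagon k ks)
  ...   | inj₁ _ | inj₂ N  = inj₂ N
  ...   | inj₂ N | _       = inj₂ N
  link-pentagon {S} {u} {v} e₀@(face {S₁} {S₂} e c u~v g) closed | no ¬b | _ =
    inj₂ (linkB e₀ , link-block e₀ closed , λ iso → ¬b (c5-bare iso e (∪₁ (linkB e) (chainB c)) (linkB-target e₀) u~v
      (λ m → chain-≢ c (≡-sym (Glue.meet g m (chain-target c))))))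
  link-pentagon {S} {u} {v} e₀@(face {S₁} {S₂} e c u~v g) closed | yes _ | no ¬bs =
    inj₂ (linkB e₀ , link-block e₀ closed , contra)
    where
    u∉ : u ∉ S₂
    u∉ m = link-≢ e (Glue.meet g (link-source e) m)
    contra : ¬ IsoC5 G (linkB e₀)
    contra iso with c5-barePath iso c (∪₂ (linkB e) (chainB c)) (linkB-source e₀) (~-sym (link-~ e)) u∉
    ... | k , path = ¬bs (subst (λ k → BarePath k c)
      (c5-length iso c path (∪₂ (linkB e) (chainB c)) (linkB-source e₀) (link-~ e) u~v u∉) path)

-- The root and the main theorem

-- Positions before that of v are shifted by n, so that the cyclic order is read off from v.
module Rotation {n : ℕ} (G : Graph n) (v : Fin n) (outerplanar : Outerplanar G) where

  open Trees G

  private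
    P : Fin n → ℕ
    P x = toℕ (proj₁ outerplanar x)

    P-injective : ∀ {x y} → P x ≡ P y → x ≡ y
    P-injective = proj₁ (proj₂ outerplanar) ∘ toℕ-injective

    P< : ∀ x → P x < n
    P< x = toℕ<n (proj₁ outerplanar x)

    noncrossing = proj₂ (proj₂ outerplanar)

  data Key (x : Fin n) : ℕ → Set where
    after  : P v ≤ P x → Key x (P x)
    before : P x < P v → Key x (P x + n)

  view : ∀ x → ∃[ k ] Key x k
  view x with P x <? P v
  ... | yes lt = _ , before lt
  ... | no ¬lt = _ , after (≮⇒≥ ¬lt)

  key : Fin n → ℕ
  key x = proj₁ (view x)

  after<before : ∀ {x y} → ¬ (P y + n < P x)
  after<before {x} {y} lt = <-irrefl refl (<-trans (≤-<-trans (m≤n+m n (P y)) lt) (P< x))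

  view-injective : ∀ {x y k} → Key x k → Key y k → x ≡ y
  view-injective {x} {y} {k} p q = go p q refl
    where
    go : ∀ {k l} → Key x k → Key y l → k ≡ l → x ≡ y
    go (after _)  (after _)  eq = P-injective eq
    go (before _) (before _) eq = P-injective (+-cancelʳ-≡ n (P x) (P y) eq)
    go (after _)  (before _) eq = ⊥-elim (<-irrefl refl (≤-<-trans (subst (n ≤_) (≡-sym eq) (m≤n+m n (P y))) (P< x)))
    go (before _) (after _)  eq = ⊥-elim (<-irrefl refl (≤-<-trans (subst (n ≤_) eq (m≤n+m n (P x))) (P< y)))

  -- Shifted keys are at least `n` and the others below `n`, so in the order a, c, b, d the shifted
  -- vertices form a final segment. Each of the five possibilities is a crossing in a cyclic shift
  -- of the original positions, and exchanging the edges or their ends brings it into the form of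
  -- `noncrossing`.
  view-planar : ∀ {a b c d ka kb kc kd} → Key a ka → Key b kb → Key c kc → Key d kd →
    a ~ b → c ~ d → ka < kc → kc < kb → kb < kd → ⊥
  view-planar {a} {b} {c} {d} (after _) (after _) (after _) (after _) a~b c~d p q r = noncrossing a b c d a~b c~d p q r
  view-planar {a} {b} {c} {d} (after v≤a) (after _) (after _) (before d<v) a~b c~d p q r =
    noncrossing d c a b (~-sym c~d) a~b (<-≤-trans d<v v≤a) p q
  view-planar {a} {b} {c} {d} (after v≤a) (before _) (after _) (before d<v) a~b c~d p q r =
    noncrossing b a d c (~-sym a~b) (~-sym c~d) (+-cancelʳ-< n _ _ r) (<-≤-trans d<v v≤a) p
  view-planar {a} {b} {c} {d} (after v≤a) (before _) (before _) (before d<v) a~b c~d p q r =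
    noncrossing c d b a c~d (~-sym a~b) (+-cancelʳ-< n _ _ q) (+-cancelʳ-< n _ _ r) (<-≤-trans d<v v≤a)
  view-planar {a} {b} {c} {d} (before _) (before _) (before _) (before _) a~b c~d p q r =
    noncrossing a b c d a~b c~d (+-cancelʳ-< n _ _ p) (+-cancelʳ-< n _ _ q) (+-cancelʳ-< n _ _ r)
  view-planar {a} {c = c} (before _) _ (after _) _ _ _ p _ _ = after<before {c} {a} p
  view-planar {b = b} {c} _ (after _) (before _) _ _ _ _ q _ = after<before {b} {c} q
  view-planar {b = b} {d = d} _ (before _) _ (after _) _ _ _ _ r = after<before {d} {b} r

  order : Order
  order = record
    { _≺_     = λ x y → key x < key y
    ; ≺-trans = <-trans
    ; compare = compare
    ; planar  = λ {a} {b} {c} {d} → view-planar (proj₂ (view a)) (proj₂ (view b)) (proj₂ (view c)) (proj₂ (view d))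
    }
    where
    compare : ∀ x y → _
    compare x y with <-cmp (key x) (key y)
    ... | tri< lt ne gt = tri< lt (λ { refl → ne refl }) gt
    ... | tri≈ lt eq gt = tri≈ lt (view-injective (proj₂ (view x)) (subst (Key y) (≡-sym eq) (proj₂ (view y)))) gt
    ... | tri> lt ne gt = tri> lt (λ { refl → ne refl }) gt

  root-min : Order.IsMin order all v
  root-min = tt , λ {x} _ → least (proj₂ (view x)) (proj₂ (view v))
    where
    least : ∀ {x k l} → Key x k → Key v l → ¬ (k < l)
    least _ (before v<v) _ = <-irrefl refl v<v
    least (after v≤x) (after _) lt = <-irrefl refl (<-≤-trans lt v≤x)
    least {x} (before _) (after _) lt = after<before {v} {x} lt

another : ∀ {n} → 2 ≤ n → (x : Fin n) → ∃[ y ] x ≢ y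
another (s≤s (s≤s _)) zero    = 1F , λ ()
another (s≤s (s≤s _)) (suc x) = 0F , λ ()

theorem1p5 : (n : ℕ) → 2 ≤ n → (G : Graph n) → (v : Fin n) →
    Connected G → Outerplanar G →
    (∃[ φ ] RootedOddColoring {k = 4} G v φ) ⇔ (∃[ S ] (IsBlock G S × ¬ IsoC5 G S))
theorem1p5 n 2≤n G v connected outerplanar = mk⇔ coloring⇒block block⇒coloring
  where
  open Cacti G
  open Rotation G v outerplanar using (order; root-min)

  tree : Rooted all v
  tree = buildRooted (count {n} all) order ≤-refl connected root-min

  -- Makes the odd condition of a colouring available at every vertex, and gives each block an edge
  -- to be compared with.
  neighbour : ∀ x → NonIsolated G x
  neighbour x with another 2≤n x
  ... | y , x≢y with first-step (connected x y tt tt) x≢y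
  ...   | z , _ , x~z = z , x~z

  coloring⇒block : (∃[ φ ] RootedOddColoring {k = 4} G v φ) → NonC5Block
  coloring⇒block (φ , (proper , odd) , odd-v , _) with rooted-cactus tree (λ _ _ _ _ _ _ _ _ → tt)
  ... | inj₂ N = N
  ... | inj₁ k = ⊥-elim (odd⇒val≢0 proper v odd-v
    (Vanishing.rooted-vanishes proper k (λ {x} _ _ → odd⇒val≢0 proper x (odd x (neighbour x)))))

  -- A single vertex is not a block here: together with a neighbour it forms a larger connected set
  -- without a cut vertex.
  second : ∀ {S} → IsBlock G S → ∃[ p ] ∃[ q ] (p ∈ S × q ∈ S × p ≢ q)
  second {S} ((p , p∈) , _ , _ , maximal) with any? (λ q → T? (S q) ×-dec ¬? (p ≟ q))
  ... | yes (q , q∈ , p≢q) = p , q , p∈ , q∈ , p≢q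
  ... | no none with neighbour p
  ...   | q , p~q = p , q , p∈ , maximal B S⊆B (robust⇒connected p~q p∈B q∈B rob) (λ x _ → rob x) q q∈B , ~⇒≢ p~q
    where
    B = ⟨ p ⟩ ∪ ⟨ q ⟩
    rob = edge-robust p~q
    p∈B : p ∈ B
    p∈B = ∪₁ ⟨ p ⟩ ⟨ q ⟩ p (∈⟨⟩ p)
    q∈B : q ∈ B
    q∈B = ∪₂ ⟨ p ⟩ ⟨ q ⟩ q (∈⟨⟩ q)
    S⊆B : S ⊆ B
    S⊆B x x∈ with p ≟ x
    ... | yes refl = tt
    ... | no p≢x   = ⊥-elim (none (x , x∈ , p≢x))

  block⇒coloring : NonC5Block → ∃[ φ ] RootedOddColoring {k = 4} G v φ
  block⇒coloring (S , block , ¬c5) with cactus-or-real tree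
  ... | inj₁ k with second block
  ...   | p , q , p∈ , q∈ , p≢q = ⊥-elim (¬c5 (CactusBlock.rooted-block block p∈ q∈ p≢q k (λ _ _ → tt)))
  block⇒coloring (S , block , ¬c5) | inj₂ (a , a≢0 , real) =
    φ , (proper' , λ x _ → val≢0⇒odd proper' x (nonzero x)) , val≢0⇒odd proper' v (nonzero v) , lap≢0⇒even proper' v lap≢0
    where
    open RootReal real
    proper' : Proper G φ
    proper' x y = proper {x} {y} tt tt
    lap≢0 : proj₁ (val all φ v) ≢ 0F
    lap≢0 eq = a≢0 (trans (cong proj₁ (≡-sym at-u)) eq)
    nonzero : ∀ x → val all φ x ≢ 0ᵛ
    nonzero x with x ≟ v
    ... | yes refl = lap≢0 ∘ cong proj₁
    ... | no x≢v   = inner {x} tt x≢v
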